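{- For all integers $k \ge t \ge 2$ there exist a constant $C=C(t)>0$ depending only on $t$ and an integer $v_0=v_0(t,k)$ such that, for all $v>v_0$ and all $\epsilon < C k^{ -2t}$, every $(1-\epsilon)$-dense simple $t$-graph $G$ on $v$ vertices admits a fractional decomposition into copies of the complete $t$-graph $K_k^t$.
   Context: A (simple) $t$-graph $G$ on a finite vertex set $V$ is a set of edges $E\subseteq\binom{V}{t}$, where $\binom{V}{t}$ is the set of $t$-element subsets of $V$. The degree of a vertex subset $S$ is the number of edges containing $S$, and $\delta_{t-1}(G)$ is the minimum degree over all $(t-1)$-subsets of $V$. With $|V|=v$, $G$ is $(1-\epsilon)$-dense if $\delta_{t-1}(G)\ge(1-\epsilon)(v-t+1)$. The complete $t$-graph $K_k^t$ has $k$ vertices and all $t$-subsets of them as edges. A fractional decomposition of $G$ into copies of a $t$-graph $H$ is a set of pairs $(H_i,w_i)$ where each $H_i$ is a subgraph of $G$ isomorphic to $H$, the $w_i$ are positive rational weights, and for every edge $T$ of $G$ one has $\sum_{i:\,T\in H_i}w_i=1$ (here $T\in H_i$ means that $T$ is an edge of $H_i$). -}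

module Defs where

open import Data.Bool.Properties using () renaming (_≟_ to _≟ᵇ_)
open import Data.Fin using (Fin)
open import Data.Fin.Properties using (any?) renaming (_≟_ to _≟ᶠ_)
open import Data.Fin.Subset using (Subset; inside; outside; ∣_∣)
  renaming (_∈_ to _∈ˢ_; _⊆_ to _⊆ˢ_)
open import Data.Fin.Subset.Properties using (_⊆?_) renaming (_∈?_ to _∈ˢ?_)
open import Data.Integer using (+_) renaming (_+_ to _+ᶻ_; _-_ to _-ᶻ_)
open import Data.List using (List; []; _∷_; _++_; map; filter; foldr; length)
open import Data.List.Extrema.Nat using (min)
open import Data.List.Membership.Propositional using (_∈_)
open import Data.List.Membership.Propositional.Properties
  using (∈-map⁺; ∈-map⁻; ∈-++⁺ˡ; ∈-++⁺ʳ; ∈-filter⁺)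
import Data.List.Membership.DecPropositional as DecMembership
open import Data.List.Relation.Binary.Subset.Propositional using (_⊆_)
open import Data.List.Relation.Unary.All using (All; []; _∷_)
open import Data.List.Relation.Unary.All.Properties using (all-filter)
open import Data.List.Relation.Unary.AllPairs using ([]; _∷_)
open import Data.List.Relation.Unary.Any using (here)
open import Data.List.Relation.Unary.Unique.Propositional using (Unique)
import Data.List.Relation.Unary.Unique.Propositional.Properties as Unique
open import Data.Nat using (ℕ; zero; suc; _∸_; _^_; NonZero) renaming (_≟_ to _≟ⁿ_)
open import Data.Nat.Properties using (m^n≢0)
open import Data.Product using (_×_; _,_; proj₁; proj₂; ∃-syntax)
open import Data.Rational using (ℚ; 0ℚ; 1ℚ; _/_; _+_; _-_; _*_; _<_; _≤_)
open import Data.Vec using (tabulate; []; _∷_)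
open import Data.Vec.Properties using (∷-injectiveʳ; ≡-dec)
open import Function.Bundles using (_⇔_)
open import Function.Definitions using (Injective)
open import Relation.Binary.PropositionalEquality using (_≡_; refl)
open import Relation.Nullary using (does)
open import Relation.Nullary.Decidable using (_×-dec_)

-- A simple t-graph on the vertex set Fin n.  The edge set is a duplicate-free
-- list; only membership in it and its length are ever used, so the order of
-- the list plays no role.
record TGraph (t n : ℕ) : Set where
  field
    edges   : List (Subset n)
    unique  : Unique edges
    uniform : All (λ e → ∣ e ∣ ≡ t) edges

subsets : (n : ℕ) → List (Subset n)
subsets zero    = [] ∷ []
subsets (suc n) = map (inside ∷_) (subsets n) ++ map (outside ∷_) (subsets n)

subsets-complete : ∀ {n} (S : Subset n) → S ∈ subsets n
subsets-complete []            = here refl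
subsets-complete (inside  ∷ S) = ∈-++⁺ˡ (∈-map⁺ (inside ∷_) (subsets-complete S))
subsets-complete {suc n} (outside ∷ S) =
  ∈-++⁺ʳ (map (inside ∷_) (subsets n)) (∈-map⁺ (outside ∷_) (subsets-complete S))

subsets-unique : ∀ n → Unique (subsets n)
subsets-unique zero    = [] ∷ []
subsets-unique (suc n) = Unique.++⁺
  (Unique.map⁺ ∷-injectiveʳ (subsets-unique n))
  (Unique.map⁺ ∷-injectiveʳ (subsets-unique n))
  λ { (p , q) → disjoint (∈-map⁻ (inside ∷_) p) (∈-map⁻ (outside ∷_) q) }
  where
  open import Data.Empty using (⊥)
  disjoint : ∀ {S : Subset (suc n)} →
             ∃[ A ] (A ∈ subsets n × S ≡ inside ∷ A) →
             ∃[ B ] (B ∈ subsets n × S ≡ outside ∷ B) → ⊥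
  disjoint (_ , _ , refl) (_ , _ , ())

subsetsOfSize : (s n : ℕ) → List (Subset n)
subsetsOfSize s n = filter (λ S → ∣ S ∣ ≟ⁿ s) (subsets n)

subsetsOfSize-complete : ∀ {s n} (S : Subset n) → ∣ S ∣ ≡ s → S ∈ subsetsOfSize s n
subsetsOfSize-complete {s} S = ∈-filter⁺ (λ S → ∣ S ∣ ≟ⁿ s) (subsets-complete S)

complete : (t k : ℕ) → TGraph t k
complete t k = record
  { edges   = subsetsOfSize t k
  ; unique  = Unique.filter⁺ (λ S → ∣ S ∣ ≟ⁿ t) (subsets-unique k)
  ; uniform = all-filter (λ S → ∣ S ∣ ≟ⁿ t) (subsets k)
  }

degree : ∀ {t n} → TGraph t n → Subset n → ℕ
degree G S = length (filter (S ⊆?_) (TGraph.edges G))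

-- The minimum degree δₛ(G) over all s-element vertex subsets.  The first
-- argument of min is an upper bound for every degree, so it affects the value
-- only if there are no s-element subsets at all.
δ : ∀ {t n} → (s : ℕ) → TGraph t n → ℕ
δ {n = n} s G = min (length (TGraph.edges G)) (map (degree G) (subsetsOfSize s n))

-- G is (1 - ε)-dense.  The number v - t + 1 is computed in ℤ, without truncation.
Dense : ∀ {t v} → ℚ → TGraph t v → Set
Dense {t} {v} ε G =
  (1ℚ - ε) * ((+ v -ᶻ + t +ᶻ + 1) / 1) ≤ (+ δ (t ∸ 1) G) / 1

record Subgraph {t n : ℕ} (G : TGraph t n) : Set where
  field
    vertices : Subset n
    edges    : List (Subset n)
    unique   : Unique edges
    edges⊆   : edges ⊆ TGraph.edges G
    within   : All (_⊆ˢ vertices) edges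

image : ∀ {m n} → (Fin m → Fin n) → Subset m → Subset n
image φ S = tabulate λ y → does (any? λ x → (x ∈ˢ? S) ×-dec (φ x ≟ᶠ y))

-- An isomorphism from H to the subgraph K of G: a bijection from the vertices
-- of H onto those of K that preserves and reflects edges.
record _≅_ {t m n : ℕ} {G : TGraph t n} (H : TGraph t m) (K : Subgraph G) : Set where
  field
    φ         : Fin m → Fin n
    injective : Injective _≡_ _≡_ φ
    onto      : ∀ y → (y ∈ˢ Subgraph.vertices K) ⇔ (∃[ x ] φ x ≡ y)
    edge⇔     : ∀ S → (S ∈ TGraph.edges H) ⇔ (image φ S ∈ Subgraph.edges K)

sum : List ℚ → ℚ
sum = foldr _+_ 0ℚ

-- The sum of w over those pairs (K , w) in the family for which T is an edge of K.
weightAt : ∀ {t n} {G : TGraph t n} → List (Subgraph G × ℚ) → Subset n → ℚ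
weightAt {n = n} family T =
  sum (map proj₂ (filter (λ p → T ∈? Subgraph.edges (proj₁ p)) family))
  where open DecMembership {A = Subset n} (≡-dec _≟ᵇ_) using (_∈?_)

-- The weighted subgraphs form a finite family indexed by list positions.
record FractionalDecomposition {t m n : ℕ} (H : TGraph t m) (G : TGraph t n) : Set where
  field
    family   : List (Subgraph G × ℚ)
    copies   : All (λ p → H ≅ proj₁ p) family
    positive : All (λ p → 0ℚ < proj₂ p) family
    total    : ∀ T → T ∈ TGraph.edges G → weightAt family T ≡ 1ℚ

-- k ^- m is k to the power -m.
infixr 8 _^-_
_^-_ : (k m : ℕ) .{{_ : NonZero k}} → ℚ
k ^- m = (+ 1 / (k ^ m)) {{m^n≢0 k m}}

{-# OPTIONS --safe #-}

-- Start from equal weights on all k-cliques, normalised so that no edge receives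
-- more than 1.  If β = O(k^(t-1) ε) bounds the proportion of vertices that fail to
-- extend a given clique, every edge T lies in almost the same number of k-cliques
-- and therefore misses only d(T) = O(k β) of its total.
--
-- The deficit d(T) is repaired inside the (t + k)-cliques containing T.  In such a
-- clique, weights φ(∣K ∩ T∣) on its k-subsets K can be chosen to total 1 at T and 0
-- at every other edge, with ∣φ(s)∣ C(k , s) ≤ 1.  Adding d(T) times the average of
-- these weights over all (t + k)-cliques through T, for every T, makes all totals
-- equal to 1.  The correction changes each weight by a relative amount of at most
-- O(k^t · k β) = O(k^(2t) ε), so all weights stay positive when ε < C k^(-2t).
--
-- Cliques are enumerated as tuples of distinct vertices.  This replaces binomial
-- estimates by iterated sums over the vertex set, and the same k-clique may occur
-- several times in the resulting family.

module Submission where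

open import Defs
open import Data.Bool using (if_then_else_; true; false)
open import Data.Bool.Properties using () renaming (_≟_ to _≟ᵇ_)
open import Data.Fin using (Fin; zero; suc)
import Data.Fin.Properties as Fin
open import Data.Fin.Subset using (Subset; inside; outside; ∣_∣; _∪_; ⁅_⁆; ⊥; ∁)
  renaming (_∈_ to _∈ˢ_; _∉_ to _∉ˢ_; _⊆_ to _⊆ˢ_; _-_ to _∖_)
open import Data.Fin.Subset.Properties
  using (_⊆?_; p─⊥≡p; p─q⊆p; x∈p∧x≢y⇒x∈p-y; p⊆q⇒∣p∣≤∣q∣; ∣p∣≤n; ∣⊥∣≡0; ∣⁅x⁆∣≡1; ∣∁p∣≡n∸∣p∣;
         x∈p∪q⁻; x∈p∪q⁺; p⊆p∪q; x∈⁅x⁆; x∈⁅y⁆⇒x≡y; ⊆-antisym; ∉⊥; Empty-unique; drop-∷-⊆; nonempty?)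
  renaming (_∈?_ to _∈ˢ?_)
open import Data.Integer using () renaming (+_ to pos)
import Data.Integer as ℤ
import Data.Integer.Properties as ℤ
open import Data.List
  using (List; []; _∷_; _++_; map; filter; concatMap; length; allFin; take; lookup)
open import Data.List.Extrema.Nat using (min≤xs)
open import Data.List.Properties using (map-tabulate; length-tabulate; length-take)
import Data.List.Membership.DecPropositional as DecMembership
open import Data.List.Membership.Propositional using (_∈_)
open import Data.List.Membership.Propositional.Properties
  using (∈-concatMap⁻; ∈-map⁻; ∈-map⁺; ∈-filter⁻; ∈-filter⁺; ∈-allFin)
open import Data.List.Relation.Binary.Sublist.Propositional
  using ([]; _∷_; _∷ʳ_; minimum; ⊆-refl) renaming (_⊆_ to _⊑_)
open import Data.List.Relation.Binary.Sublist.Propositional.Properties using (++⁺; ++⁺ʳ; take-⊆)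
open import Data.List.Relation.Unary.All using ([]; _∷_)
import Data.List.Relation.Unary.All as All
open import Data.List.Relation.Unary.All.Properties using (map⁺; all-filter)
open import Data.List.Relation.Unary.AllPairs using ([]; _∷_)
open import Data.List.Relation.Unary.Any using (here; there; satisfied)
open import Data.List.Relation.Unary.Unique.Propositional using (Unique)
import Data.List.Relation.Unary.Unique.Propositional.Properties as Unique
open import Data.Nat
  using (ℕ; zero; suc; NonZero; _∸_; _^_; _!; >-nonZero; >-nonZero⁻¹; ≢-nonZero⁻¹; z≤n; s≤s)
  renaming (_≤_ to _≤ⁿ_; _<_ to _<ⁿ_; _*_ to _*ⁿ_; _+_ to _+ⁿ_; _≟_ to _≟ⁿ_)
open import Data.Nat.Combinatorics
  using (_C_; nCk≡n!/k![n-k]!; nCk+nC[k+1]≡[n+1]C[k+1]; k>n⇒nCk≡0; k![n∸k]!∣n!; nCn≡1)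
open import Data.Nat.DivMod using (m/n*n≡m)
open import Data.Nat.Properties using (≤-trans)
import Data.Nat.Properties as ℕ
import Data.Nat.Tactic.RingSolver as ℕ-Solver
open import Data.Product using (_×_; _,_; _,′_; proj₁; proj₂; ∃-syntax)
open import Data.Rational
  using (ℚ; 0ℚ; 1ℚ; _/_; _+_; _-_; _*_; -_; _<_; _≤_; 1/_; toℚᵘ; nonNegative; positive; ≢-nonZero)
  renaming (∣_∣ to abs)
import Data.Rational.Properties as ℚ
open import Data.Rational.Unnormalised using (mkℚᵘ; *≡*) renaming (_≃_ to _≃ᵘ_; _+_ to _+ᵘ_; _*_ to _*ᵘ_)
import Data.Rational.Unnormalised.Properties as ℚᵘ
open import Data.Sum using (_⊎_; inj₁; inj₂; [_,_]′)
import Data.Vec as Vec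
open import Data.Vec using ([]; _∷_; here; there)
open import Data.Vec.Properties using (≡-dec; lookup∘tabulate; lookup⇒[]=; []=⇒lookup)
open import Function using (_∘_; case_of_)
open import Function.Bundles using (mk⇔)
open import Function.Definitions using (Injective)
open import Level using (0ℓ)
open import Relation.Binary.PropositionalEquality
  using (_≡_; _≢_; refl; sym; trans; cong; cong₂; subst; subst₂; module ≡-Reasoning)
open import Relation.Nullary using (Dec; yes; no; does; ¬_; ¬?; contradiction)
open import Relation.Nullary.Decidable using (dec⇒maybe; dec-true; dec-false; map′; _×-dec_; _→-dec_)
open import Relation.Unary using (Pred; Decidable)
open import Tactic.RingSolver using (solve-∀)
open import Tactic.RingSolver.Core.AlmostCommutativeRing
  using (AlmostCommutativeRing; fromCommutativeRing)

-- Why t + k vertices: around an edge T this is the smallest clique in which a k-subset K can avoid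
-- T altogether, so that ∣K ∩ T∣ takes every value 0, ..., t. By symmetry the total at an edge e
-- depends only on ∣e ∩ T∣, which leaves t + 1 linear equations for the t + 1 unknowns φ(0), ...,
-- φ(t).
--
-- Why the repair costs a factor k^t: C(k , s) of the k-subsets meet T in a given s-set, so the
-- bound on φ keeps the sum of ∣φ∣ over all k-subsets at most 2^t, whatever k is. The factor k^t
-- comes from the uniform weight instead. In a k-tuple each of the t vertices of an edge has at most
-- k positions, so at most about k^t v^(k - t) tuples contain the edge and the uniform weight can be
-- as small as v^(t - k) / k^t. A k-tuple has v^t completions for each choice of its positions in a
-- (t + k)-tuple, each completion carrying about d(T) / v^k, so its correction has order 2^t v^(t -
-- k) d(T).

ℚ-ring : AlmostCommutativeRing 0ℓ 0ℓ
ℚ-ring = fromCommutativeRing ℚ.+-*-commutativeRing (λ p → dec⇒maybe (0ℚ ℚ.≟ p))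

-- Ordered field arithmetic

*-monoʳ-≤ : ∀ {p q r} → 0ℚ ≤ r → p ≤ q → r * p ≤ r * q
*-monoʳ-≤ {r = r} 0≤r = ℚ.*-monoˡ-≤-nonNeg r {{nonNegative 0≤r}}

*-monoˡ-≤ : ∀ {p q r} → 0ℚ ≤ r → p ≤ q → p * r ≤ q * r
*-monoˡ-≤ {r = r} 0≤r = ℚ.*-monoʳ-≤-nonNeg r {{nonNegative 0≤r}}

*-mono-≤ : ∀ {p q r s} → 0ℚ ≤ p → 0ℚ ≤ s → p ≤ q → r ≤ s → p * r ≤ q * s
*-mono-≤ 0≤p 0≤s p≤q r≤s = ℚ.≤-trans (*-monoʳ-≤ 0≤p r≤s) (*-monoˡ-≤ 0≤s p≤q)

0≤* : ∀ {p q} → 0ℚ ≤ p → 0ℚ ≤ q → 0ℚ ≤ p * q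
0≤* {p} {q} 0≤p 0≤q = subst (_≤ p * q) (ℚ.*-zeroʳ p) (*-monoʳ-≤ 0≤p 0≤q)

0<* : ∀ {p q} → 0ℚ < p → 0ℚ < q → 0ℚ < p * q
0<* {p} {q} 0<p 0<q =
  subst (_< p * q) (ℚ.*-zeroʳ p) (ℚ.*-monoʳ-<-pos p {{positive 0<p}} 0<q)

*-cancelʳ-≤ : ∀ {p q r} → 0ℚ < r → p * r ≤ q * r → p ≤ q
*-cancelʳ-≤ {r = r} 0<r = ℚ.*-cancelʳ-≤-pos r {{positive 0<r}}

*-cancelʳ-< : ∀ {p q r} → 0ℚ ≤ r → p * r < q * r → p < q
*-cancelʳ-< {r = r} 0≤r = ℚ.*-cancelʳ-<-nonNeg r {{nonNegative 0≤r}}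

0≤+ : ∀ {p q} → 0ℚ ≤ p → 0ℚ ≤ q → 0ℚ ≤ p + q
0≤+ {p} {q} 0≤p 0≤q = subst (_≤ p + q) (ℚ.+-identityʳ 0ℚ) (ℚ.+-mono-≤ 0≤p 0≤q)

p≤p+q : ∀ {p q} → 0ℚ ≤ q → p ≤ p + q
p≤p+q {p} {q} 0≤q = subst (_≤ p + q) (ℚ.+-identityʳ p) (ℚ.+-monoʳ-≤ p 0≤q)

0≤1 : 0ℚ ≤ 1ℚ
0≤1 = ℚ.nonNegative⁻¹ 1ℚ

0<1 : 0ℚ < 1ℚ
0<1 = ℚ.positive⁻¹ 1ℚ

p≤q⇒0≤q-p : ∀ {p q} → p ≤ q → 0ℚ ≤ q - p
p≤q⇒0≤q-p {p} {q} p≤q = subst (_≤ q - p) (ℚ.+-inverseʳ p) (ℚ.+-monoˡ-≤ (- p) p≤q)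

0≤q-p⇒p≤q : ∀ {p q} → 0ℚ ≤ q - p → p ≤ q
0≤q-p⇒p≤q {p} {q} h =
  subst (p ≤_) (lemma p q) (p≤p+q h)
  where
  lemma : ∀ p q → p + (q - p) ≡ q
  lemma = solve-∀ ℚ-ring

-- recip 0ℚ is 0ℚ.
recip : ℚ → ℚ
recip p with p ℚ.≟ 0ℚ
... | yes _   = 0ℚ
... | no  p≢0 = (1/ p) {{≢-nonZero p≢0}}

recip-inverse : ∀ {p} → p ≢ 0ℚ → recip p * p ≡ 1ℚ
recip-inverse {p} p≢0 with p ℚ.≟ 0ℚ
... | yes p≡0  = contradiction p≡0 p≢0
... | no  p≢0′ = ℚ.*-inverseˡ p {{≢-nonZero p≢0′}}

0<⇒≢0 : ∀ {p} → 0ℚ < p → p ≢ 0ℚ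
0<⇒≢0 0<p refl = ℚ.<-irrefl refl 0<p

recip-pos : ∀ {p} → 0ℚ < p → 0ℚ < recip p
recip-pos {p} 0<p with p ℚ.≟ 0ℚ
... | yes p≡0  = contradiction p≡0 (0<⇒≢0 0<p)
... | no  p≢0′ = ℚ.positive⁻¹ _ {{ℚ.1/pos⇒pos p {{positive 0<p}}}}

recip-nonNeg : ∀ {p} → 0ℚ ≤ p → 0ℚ ≤ recip p
recip-nonNeg {p} 0≤p with p ℚ.≟ 0ℚ
... | yes _ = ℚ.≤-refl
... | no p≢0 = ℚ.<⇒≤ (ℚ.positive⁻¹ _ {{ℚ.1/pos⇒pos p {{positive 0<p}}}})
  where
  0<p : 0ℚ < p
  0<p = ℚ.≰⇒> λ p≤0 → p≢0 (ℚ.≤-antisym p≤0 0≤p)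

recip-antitone : ∀ {p q} → 0ℚ < p → p ≤ q → recip q ≤ recip p
recip-antitone {p} {q} 0<p p≤q = *-cancelʳ-≤ 0<q (*-cancelʳ-≤ 0<p (begin
  recip q * q * p   ≡⟨ cong (_* p) (recip-inverse (0<⇒≢0 0<q)) ⟩
  1ℚ * p            ≤⟨ *-monoʳ-≤ 0≤1 p≤q ⟩
  1ℚ * q            ≡⟨ cong (_* q) (recip-inverse (0<⇒≢0 0<p)) ⟨
  recip p * p * q   ≡⟨ lemma (recip p) p q ⟩
  recip p * q * p   ∎))
  where
  open ℚ.≤-Reasoning
  0<q : 0ℚ < q
  0<q = ℚ.<-≤-trans 0<p p≤q
  lemma : ∀ x y z → x * y * z ≡ x * z * y
  lemma = solve-∀ ℚ-ring

-∣p∣≤p : ∀ p → - abs p ≤ p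
-∣p∣≤p p with ℚ.∣p∣≡p∨∣p∣≡-p p
... | inj₁ eq = ℚ.≤-trans (ℚ.neg-antimono-≤ (ℚ.0≤∣p∣ p)) (subst (0ℚ ≤_) eq (ℚ.0≤∣p∣ p))
... | inj₂ eq = ℚ.≤-reflexive (trans (cong -_ eq) (lemma p))
  where
  lemma : ∀ p → - (- p) ≡ p
  lemma = solve-∀ ℚ-ring

pow : ℚ → ℕ → ℚ
pow p zero    = 1ℚ
pow p (suc n) = p * pow p n

pow-nonNeg : ∀ {p} n → 0ℚ ≤ p → 0ℚ ≤ pow p n
pow-nonNeg zero    0≤p = 0≤1
pow-nonNeg (suc n) 0≤p = 0≤* 0≤p (pow-nonNeg n 0≤p)

pow-pos : ∀ {p} n → 0ℚ < p → 0ℚ < pow p n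
pow-pos zero    0<p = 0<1
pow-pos (suc n) 0<p = 0<* 0<p (pow-pos n 0<p)

pow-≤1 : ∀ {p} n → 0ℚ ≤ p → p ≤ 1ℚ → pow p n ≤ 1ℚ
pow-≤1 zero    0≤p p≤1 = ℚ.≤-refl
pow-≤1 (suc n) 0≤p p≤1 = *-mono-≤ 0≤p 0≤1 p≤1 (pow-≤1 n 0≤p p≤1)

pow-mono : ∀ {p q} n → 0ℚ ≤ p → p ≤ q → pow p n ≤ pow q n
pow-mono zero    0≤p p≤q = ℚ.≤-refl
pow-mono (suc n) 0≤p p≤q =
  *-mono-≤ 0≤p (pow-nonNeg n (ℚ.≤-trans 0≤p p≤q)) p≤q (pow-mono n 0≤p p≤q)

pow-* : ∀ p q n → pow (p * q) n ≡ pow p n * pow q n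
pow-* p q zero    = refl
pow-* p q (suc n) = trans (cong (p * q *_) (pow-* p q n)) (lemma p q (pow p n) (pow q n))
  where
  lemma : ∀ p q r s → p * q * (r * s) ≡ p * r * (q * s)
  lemma = solve-∀ ℚ-ring

-- The recursion lets cardinalities, powers and binomials pass to ℚ by induction, and numerals such
-- as `ι 2` unfold for the ring solver. `ι≡/1` and `1/n*n` link it to the fractions in `Dense` and
-- `_^-_`.
ι : ℕ → ℚ
ι zero    = 0ℚ
ι (suc n) = 1ℚ + ι n

ι-+ : ∀ m n → ι (m +ⁿ n) ≡ ι m + ι n
ι-+ zero    n = sym (ℚ.+-identityˡ _)
ι-+ (suc m) n = trans (cong (1ℚ +_) (ι-+ m n)) (sym (ℚ.+-assoc 1ℚ (ι m) (ι n)))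

ι-* : ∀ m n → ι (m *ⁿ n) ≡ ι m * ι n
ι-* zero    n = sym (ℚ.*-zeroˡ (ι n))
ι-* (suc m) n = trans (ι-+ n (m *ⁿ n)) (trans (cong (λ x → ι n + x) (ι-* m n)) (lemma (ι m) (ι n)))
  where
  lemma : ∀ p q → q + p * q ≡ (1ℚ + p) * q
  lemma = solve-∀ ℚ-ring

ι-^ : ∀ m n → ι (m ^ n) ≡ pow (ι m) n
ι-^ m zero    = refl
ι-^ m (suc n) = trans (ι-* m (m ^ n)) (cong (ι m *_) (ι-^ m n))

ι-nonNeg : ∀ n → 0ℚ ≤ ι n
ι-nonNeg zero    = ℚ.≤-refl
ι-nonNeg (suc n) = 0≤+ 0≤1 (ι-nonNeg n)

ι-mono : ∀ {m n} → m ≤ⁿ n → ι m ≤ ι n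
ι-mono {n = n} z≤n = ι-nonNeg n
ι-mono (s≤s m≤n) = ℚ.+-monoʳ-≤ 1ℚ (ι-mono m≤n)

1≤ι-suc : ∀ n → 1ℚ ≤ ι (suc n)
1≤ι-suc n = p≤p+q (ι-nonNeg n)

ι-suc-pos : ∀ n → 0ℚ < ι (suc n)
ι-suc-pos n = ℚ.<-≤-trans 0<1 (1≤ι-suc n)

ι-pos : ∀ {n} → 0 <ⁿ n → 0ℚ < ι n
ι-pos {suc n} _ = ι-suc-pos n

/1-toℚᵘ : ∀ i → toℚᵘ (i / 1) ≃ᵘ mkℚᵘ i 0
/1-toℚᵘ i = ℚ.toℚᵘ-fromℚᵘ (mkℚᵘ i 0)

ι≡/1 : ∀ n → ι n ≡ pos n / 1
ι≡/1 zero    = refl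
ι≡/1 (suc n) = trans (cong (1ℚ +_) (ι≡/1 n)) (ℚ.toℚᵘ-injective (begin
  toℚᵘ (1ℚ + pos n / 1)            ≈⟨ ℚ.toℚᵘ-homo-+ 1ℚ (pos n / 1) ⟩
  toℚᵘ 1ℚ +ᵘ toℚᵘ (pos n / 1)      ≈⟨ ℚᵘ.+-congʳ (toℚᵘ 1ℚ) (/1-toℚᵘ (pos n)) ⟩
  toℚᵘ 1ℚ +ᵘ mkℚᵘ (pos n) 0        ≈⟨ *≡* (cong (λ i → (pos 1 ℤ.+ i) ℤ.* pos 1) (ℤ.*-identityʳ (pos n))) ⟩
  mkℚᵘ (pos (suc n)) 0               ≈⟨ /1-toℚᵘ (pos (suc n)) ⟨
  toℚᵘ (pos (suc n) / 1)             ∎))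
  where
  open ℚᵘ.≃-Reasoning
  import Data.Integer as ℤ
  import Data.Integer.Properties as ℤ

1/n*n : ∀ n .{{_ : NonZero n}} → (pos 1 / n) * ι n ≡ 1ℚ
1/n*n n@(suc n-1) = trans (cong ((pos 1 / n) *_) (ι≡/1 n)) (ℚ.toℚᵘ-injective (begin
  toℚᵘ ((pos 1 / n) * (pos n / 1))        ≈⟨ ℚ.toℚᵘ-homo-* (pos 1 / n) (pos n / 1) ⟩
  toℚᵘ (pos 1 / n) *ᵘ toℚᵘ (pos n / 1) ≈⟨ ℚᵘ.*-cong (ℚ.toℚᵘ-fromℚᵘ (mkℚᵘ (pos 1) n-1)) (/1-toℚᵘ (pos n)) ⟩
  mkℚᵘ (pos 1) n-1 *ᵘ mkℚᵘ (pos n) 0   ≈⟨ *≡* (cong pos (lemma n-1)) ⟩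
  toℚᵘ 1ℚ                             ∎))
  where
  open ℚᵘ.≃-Reasoning
  import Data.Nat.Tactic.RingSolver as ℕ
  lemma : ∀ m → (suc m +ⁿ 0) *ⁿ 1 ≡ suc m *ⁿ 1 +ⁿ 0
  lemma = ℕ.solve-∀

-- Indicators and finite sums

ind : ∀ {ℓ} {P : Set ℓ} → Dec P → ℚ
ind P? = if does P? then 1ℚ else 0ℚ

module _ {ℓ} {P : Set ℓ} where

  ind-yes : (P? : Dec P) → P → ind P? ≡ 1ℚ
  ind-yes P? p = cong (if_then 1ℚ else 0ℚ) (dec-true P? p)

  ind-no : (P? : Dec P) → ¬ P → ind P? ≡ 0ℚ
  ind-no P? ¬p = cong (if_then 1ℚ else 0ℚ) (dec-false P? ¬p)

  ind-nonNeg : (P? : Dec P) → 0ℚ ≤ ind P?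
  ind-nonNeg P? with does P?
  ... | true  = 0≤1
  ... | false = ℚ.≤-refl

  ind-≤1 : (P? : Dec P) → ind P? ≤ 1ℚ
  ind-≤1 P? with does P?
  ... | true  = ℚ.≤-refl
  ... | false = 0≤1

  ind-guard : (P? : Dec P) → ∀ {x y} → (P → x ≡ y) → ind P? * x ≡ ind P? * y
  ind-guard P? {x} {y} h with P?
  ... | yes p = cong (1ℚ *_) (h p)
  ... | no _  = trans (ℚ.*-zeroˡ x) (sym (ℚ.*-zeroˡ y))

  ind-guard-≤ : (P? : Dec P) → ∀ {x y} → (P → x ≤ y) → ind P? * x ≤ ind P? * y
  ind-guard-≤ P? {x} {y} h with P?
  ... | yes p = *-monoʳ-≤ 0≤1 (h p)
  ... | no _  = ℚ.≤-reflexive (trans (ℚ.*-zeroˡ x) (sym (ℚ.*-zeroˡ y)))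

module _ {ℓ ℓ′} {P : Set ℓ} {Q : Set ℓ′} where

  ind-mono : (P? : Dec P) (Q? : Dec Q) → (P → Q) → ind P? ≤ ind Q?
  ind-mono P? Q? f with P?
  ... | yes p = ℚ.≤-reflexive (sym (ind-yes Q? (f p)))
  ... | no _  = ind-nonNeg Q?

  ind-× : (P? : Dec P) (Q? : Dec Q) → ind (P? ×-dec Q?) ≡ ind P? * ind Q?
  ind-× P? Q? with does P?
  ... | true  = sym (ℚ.*-identityˡ _)
  ... | false = sym (ℚ.*-zeroˡ (ind Q?))

ind-cong : ∀ {ℓ ℓ′} {P : Set ℓ} {Q : Set ℓ′} (P? : Dec P) (Q? : Dec Q) →
           (P → Q) → (Q → P) → ind P? ≡ ind Q?
ind-cong P? Q? f g = ℚ.≤-antisym (ind-mono P? Q? f) (ind-mono Q? P? g)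

∑ : ∀ {ℓ} {A : Set ℓ} → List A → (A → ℚ) → ℚ
∑ xs f = sum (map f xs)

module _ {ℓ} {A : Set ℓ} where

  ∑-cong : ∀ (xs : List A) {f g : A → ℚ} → (∀ {x} → x ∈ xs → f x ≡ g x) → ∑ xs f ≡ ∑ xs g
  ∑-cong []       eq = refl
  ∑-cong (x ∷ xs) eq = cong₂ _+_ (eq (here refl)) (∑-cong xs (eq ∘ there))

  ∑-mono : ∀ (xs : List A) {f g : A → ℚ} → (∀ {x} → x ∈ xs → f x ≤ g x) → ∑ xs f ≤ ∑ xs g
  ∑-mono []       le = ℚ.≤-refl
  ∑-mono (x ∷ xs) le = ℚ.+-mono-≤ (le (here refl)) (∑-mono xs (le ∘ there))

  ∑-zero : ∀ (xs : List A) {f : A → ℚ} → (∀ {x} → x ∈ xs → f x ≡ 0ℚ) → ∑ xs f ≡ 0ℚ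
  ∑-zero []       eq = refl
  ∑-zero (x ∷ xs) eq = cong₂ _+_ (eq (here refl)) (∑-zero xs (eq ∘ there))

  ∑-nonNeg : ∀ (xs : List A) {f : A → ℚ} → (∀ {x} → x ∈ xs → 0ℚ ≤ f x) → 0ℚ ≤ ∑ xs f
  ∑-nonNeg xs h =
    subst (_≤ ∑ xs _) (∑-zero xs {λ _ → 0ℚ} λ _ → refl) (∑-mono xs h)

  ∑-+ : ∀ (xs : List A) (f g : A → ℚ) → ∑ xs (λ x → f x + g x) ≡ ∑ xs f + ∑ xs g
  ∑-+ []       f g = refl
  ∑-+ (x ∷ xs) f g =
    trans (cong (f x + g x +_) (∑-+ xs f g)) (lemma (f x) (g x) (∑ xs f) (∑ xs g))
    where
    lemma : ∀ p q r s → p + q + (r + s) ≡ p + r + (q + s)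
    lemma = solve-∀ ℚ-ring

  ∑-*ˡ : ∀ (xs : List A) c (f : A → ℚ) → ∑ xs (λ x → c * f x) ≡ c * ∑ xs f
  ∑-*ˡ []       c f = sym (ℚ.*-zeroʳ c)
  ∑-*ˡ (x ∷ xs) c f =
    trans (cong (c * f x +_) (∑-*ˡ xs c f)) (sym (ℚ.*-distribˡ-+ c (f x) (∑ xs f)))

  ∑-*ʳ : ∀ (xs : List A) c (f : A → ℚ) → ∑ xs (λ x → f x * c) ≡ ∑ xs f * c
  ∑-*ʳ xs c f =
    trans (∑-cong xs λ {x} _ → ℚ.*-comm (f x) c) (trans (∑-*ˡ xs c f) (ℚ.*-comm c _))

  ∑-++ : ∀ (xs ys : List A) (f : A → ℚ) → ∑ (xs ++ ys) f ≡ ∑ xs f + ∑ ys f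
  ∑-++ []       ys f = sym (ℚ.+-identityˡ _)
  ∑-++ (x ∷ xs) ys f = trans (cong (f x +_) (∑-++ xs ys f)) (sym (ℚ.+-assoc (f x) _ _))

  ∑-const : ∀ (xs : List A) c → ∑ xs (λ _ → c) ≡ ι (length xs) * c
  ∑-const []       c = sym (ℚ.*-zeroˡ c)
  ∑-const (x ∷ xs) c = trans (cong (c +_) (∑-const xs c)) (lemma c (ι (length xs)))
    where
    lemma : ∀ c n → c + n * c ≡ (1ℚ + n) * c
    lemma = solve-∀ ℚ-ring

  ∑-∈-≤ : ∀ {xs : List A} {f : A → ℚ} → (∀ x → 0ℚ ≤ f x) → ∀ {x} → x ∈ xs → f x ≤ ∑ xs f
  ∑-∈-≤ {x ∷ xs} 0≤f (here refl)  = p≤p+q (∑-nonNeg xs λ {x} _ → 0≤f x)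
  ∑-∈-≤ {y ∷ xs} {f} 0≤f (there x∈xs) =
    ℚ.≤-trans (∑-∈-≤ 0≤f x∈xs) (subst (_ ≤_) (ℚ.+-comm _ (f y)) (p≤p+q (0≤f y)))

  ∑-filter : ∀ {p} {P : Pred A p} (P? : Decidable P) (xs : List A) (f : A → ℚ) →
             ∑ (filter P? xs) f ≡ ∑ xs (λ x → ind (P? x) * f x)
  ∑-filter P? []       f = refl
  ∑-filter P? (x ∷ xs) f with does (P? x)
  ... | true  = cong₂ _+_ (sym (ℚ.*-identityˡ (f x))) (∑-filter P? xs f)
  ... | false = trans (∑-filter P? xs f)
    (sym (trans (cong (_+ ∑ xs (λ x → ind (P? x) * f x)) (ℚ.*-zeroˡ (f x))) (ℚ.+-identityˡ _)))

  ι-length-filter : ∀ {p} {P : Pred A p} (P? : Decidable P) (xs : List A) →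
                    ι (length (filter P? xs)) ≡ ∑ xs (λ x → ind (P? x))
  ι-length-filter P? []       = refl
  ι-length-filter P? (x ∷ xs) with does (P? x)
  ... | true  = cong (1ℚ +_) (ι-length-filter P? xs)
  ... | false = trans (ι-length-filter P? xs) (sym (ℚ.+-identityˡ _))

module _ {ℓ ℓ′} {A : Set ℓ} {B : Set ℓ′} where

  ∑-map : ∀ (h : B → A) (xs : List B) (f : A → ℚ) → ∑ (map h xs) f ≡ ∑ xs (f ∘ h)
  ∑-map h []       f = refl
  ∑-map h (x ∷ xs) f = cong (f (h x) +_) (∑-map h xs f)

  ∑-concatMap : ∀ (h : B → List A) (xs : List B) (f : A → ℚ) →
                ∑ (concatMap h xs) f ≡ ∑ xs (λ x → ∑ (h x) f)
  ∑-concatMap h []       f = refl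
  ∑-concatMap h (x ∷ xs) f =
    trans (∑-++ (h x) (concatMap h xs) f) (cong (∑ (h x) f +_) (∑-concatMap h xs f))

  ∑-swap : ∀ (xs : List A) (ys : List B) (f : A → B → ℚ) →
           ∑ xs (λ x → ∑ ys (f x)) ≡ ∑ ys (λ y → ∑ xs (λ x → f x y))
  ∑-swap []       ys f = sym (∑-zero ys λ _ → refl)
  ∑-swap (x ∷ xs) ys f =
    trans (cong (∑ ys (f x) +_) (∑-swap xs ys f)) (sym (∑-+ ys (f x) _))

∑-allFin-suc : ∀ {n} (f : Fin (suc n) → ℚ) →
               ∑ (allFin (suc n)) f ≡ f zero + ∑ (allFin n) (f ∘ suc)
∑-allFin-suc {n} f = cong (λ xs → f zero + sum xs)
  (trans (map-tabulate suc f) (sym (map-tabulate (λ x → x) (f ∘ suc))))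

∑-subsets-suc : ∀ n (f : Subset (suc n) → ℚ) →
                ∑ (subsets (suc n)) f ≡
                ∑ (subsets n) (f ∘ (inside ∷_)) + ∑ (subsets n) (f ∘ (outside ∷_))
∑-subsets-suc n f = trans (∑-++ (map (inside ∷_) (subsets n)) _ f)
  (cong₂ _+_ (∑-map (inside ∷_) (subsets n) f) (∑-map (outside ∷_) (subsets n) f))

ι∣S∣≡∑ : ∀ {n} (S : Subset n) → ι ∣ S ∣ ≡ ∑ (allFin n) (λ a → ind (a ∈ˢ? S))
ι∣S∣≡∑ []            = refl
ι∣S∣≡∑ (inside  ∷ S) = trans (cong (1ℚ +_) (ι∣S∣≡∑ S)) (sym (∑-allFin-suc (λ a → ind (a ∈ˢ? (inside ∷ S)))))
ι∣S∣≡∑ (outside ∷ S) = trans (ι∣S∣≡∑ S)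
  (trans (sym (ℚ.+-identityˡ _)) (sym (∑-allFin-suc (λ a → ind (a ∈ˢ? (outside ∷ S))))))

-- Binomial sums: Δ r g i is the sum of C(r , l) g(i + l) over all l.

Δ : ℕ → (ℕ → ℚ) → ℕ → ℚ
Δ zero    g i = g i
Δ (suc r) g i = Δ r (λ s → g s + g (suc s)) i

Δ-cong : ∀ r {g h : ℕ → ℚ} i → (∀ s → i ≤ⁿ s → s ≤ⁿ i +ⁿ r → g s ≡ h s) → Δ r g i ≡ Δ r h i
Δ-cong zero    i eq = eq i ℕ.≤-refl (ℕ.m≤m+n i 0)
Δ-cong (suc r) i eq = Δ-cong r i λ s i≤s s≤i+r →
  cong₂ _+_ (eq s i≤s (ℕ.≤-trans s≤i+r (ℕ.+-monoʳ-≤ i (ℕ.n≤1+n r))))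
            (eq (suc s) (ℕ.m≤n⇒m≤1+n i≤s) (subst (suc s ≤ⁿ_) (sym (ℕ.+-suc i r)) (s≤s s≤i+r)))

Δ-∘suc : ∀ r (g : ℕ → ℚ) i → Δ r (g ∘ suc) i ≡ Δ r g (suc i)
Δ-∘suc zero    g i = refl
Δ-∘suc (suc r) g i = Δ-∘suc r (λ s → g s + g (suc s)) i

Δ-+ : ∀ r (g h : ℕ → ℚ) i → Δ r (λ s → g s + h s) i ≡ Δ r g i + Δ r h i
Δ-+ zero    g h i = refl
Δ-+ (suc r) g h i = trans
  (Δ-cong r i λ s _ _ → lemma (g s) (h s) (g (suc s)) (h (suc s)))
  (Δ-+ r (λ s → g s + g (suc s)) (λ s → h s + h (suc s)) i)
  where
  lemma : ∀ p q r s → p + q + (r + s) ≡ p + r + (q + s)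
  lemma = solve-∀ ℚ-ring

Δ-*ˡ : ∀ r c (g : ℕ → ℚ) i → Δ r (λ s → c * g s) i ≡ c * Δ r g i
Δ-*ˡ zero    c g i = refl
Δ-*ˡ (suc r) c g i = trans
  (Δ-cong r i λ s _ _ → sym (ℚ.*-distribˡ-+ c (g s) (g (suc s))))
  (Δ-*ˡ r c (λ s → g s + g (suc s)) i)

Δ-zero : ∀ r {g : ℕ → ℚ} i → (∀ s → i ≤ⁿ s → s ≤ⁿ i +ⁿ r → g s ≡ 0ℚ) → Δ r g i ≡ 0ℚ
Δ-zero r {g} i eq = begin
  Δ r g i                 ≡⟨ Δ-cong r i (λ s i≤s s≤ → trans (eq s i≤s s≤) (sym (ℚ.*-zeroˡ 0ℚ))) ⟩
  Δ r (λ _ → 0ℚ * 0ℚ) i   ≡⟨ Δ-*ˡ r 0ℚ (λ _ → 0ℚ) i ⟩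
  0ℚ * Δ r (λ _ → 0ℚ) i   ≡⟨ ℚ.*-zeroˡ (Δ r (λ _ → 0ℚ) i) ⟩
  0ℚ                      ∎
  where open ≡-Reasoning

-- Binomial identities

bin : ℕ → ℕ → ℚ
bin n k = ι (n C k)

bin-pascal : ∀ n k → bin (suc n) (suc k) ≡ bin n k + bin n (suc k)
bin-pascal n k = trans (cong ι (sym (nCk+nC[k+1]≡[n+1]C[k+1] n k))) (ι-+ (n C k) (n C suc k))

bin-zero : ∀ {n k} → n <ⁿ k → bin n k ≡ 0ℚ
bin-zero n<k = cong ι (k>n⇒nCk≡0 n<k)

C-factorials : ∀ {n k} → k ≤ⁿ n → (n C k) *ⁿ (k ! *ⁿ (n ∸ k) !) ≡ n !
C-factorials {n} {k} k≤n =
  trans (cong (_*ⁿ (k ! *ⁿ (n ∸ k) !)) (nCk≡n!/k![n-k]! k≤n)) (m/n*n≡m (k![n∸k]!∣n! k≤n))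
  where
  instance
    _ = k ℕ.!* (n ∸ k) !≢0

bin-pos : ∀ {n k} → k ≤ⁿ n → 0ℚ < bin n k
bin-pos {n} {k} k≤n with n C k in eq
... | suc m = ι-suc-pos m
... | zero  = contradiction
  (trans (sym (C-factorials k≤n)) (cong (_*ⁿ (k ! *ⁿ (n ∸ k) !)) eq)) (≢-nonZero⁻¹ (n !) {{n ℕ.!≢0}})

bin-nonNeg : ∀ n k → 0ℚ ≤ bin n k
bin-nonNeg n k = ι-nonNeg (n C k)

-- Both sides count the ordered pairs of disjoint subsets of sizes `r` and `s` in an `n`-set. The
-- factorial formula covers `r +ⁿ s ≤ⁿ n`; otherwise both sides are 0.
C-trinomial : ∀ {n r s} → r ≤ⁿ n → s ≤ⁿ n → ((n ∸ r) C s) *ⁿ (n C r) ≡ ((n ∸ s) C r) *ⁿ (n C s)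
C-trinomial {n} {r} {s} r≤n s≤n = case ℕ.≤-total (r +ⁿ s) n of λ where
    (inj₁ r+s≤n) → generic r+s≤n
    (inj₂ n≤r+s) → case r +ⁿ s ℕ.≟ n of λ where
      (yes r+s≡n) → generic (ℕ.≤-reflexive r+s≡n)
      (no  r+s≢n) →
        let n<r+s = ℕ.≤∧≢⇒< n≤r+s (r+s≢n ∘ sym) in
        trans (cong (_*ⁿ (n C r)) (k>n⇒nCk≡0 (smaller r≤n n<r+s)))
              (sym (cong (_*ⁿ (n C s)) (k>n⇒nCk≡0 (smaller s≤n (subst (n <ⁿ_) (ℕ.+-comm r s) n<r+s)))))
  where
  open ≡-Reasoning
  smaller : ∀ {r s} → r ≤ⁿ n → n <ⁿ r +ⁿ s → n ∸ r <ⁿ s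
  smaller {r} {s} r≤n n<r+s = ℕ.+-cancelˡ-< r _ _ (subst (_<ⁿ r +ⁿ s) (sym (ℕ.m+[n∸m]≡n r≤n)) n<r+s)
  half : ∀ {r s} → r ≤ⁿ n → s ≤ⁿ n ∸ r →
         ((n ∸ r) C s) *ⁿ (n C r) *ⁿ (r ! *ⁿ (s ! *ⁿ (n ∸ (r +ⁿ s)) !)) ≡ n !
  half {r} {s} r≤n s≤n∸r = begin
    ((n ∸ r) C s) *ⁿ (n C r) *ⁿ (r ! *ⁿ (s ! *ⁿ (n ∸ (r +ⁿ s)) !))
      ≡⟨ lemma ((n ∸ r) C s) (n C r) (r !) (s !) ((n ∸ (r +ⁿ s)) !) ⟩
    (n C r) *ⁿ (r ! *ⁿ (((n ∸ r) C s) *ⁿ (s ! *ⁿ (n ∸ (r +ⁿ s)) !)))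
      ≡⟨ cong (λ m → (n C r) *ⁿ (r ! *ⁿ (((n ∸ r) C s) *ⁿ (s ! *ⁿ m !)))) (sym (ℕ.∸-+-assoc n r s)) ⟩
    (n C r) *ⁿ (r ! *ⁿ (((n ∸ r) C s) *ⁿ (s ! *ⁿ (n ∸ r ∸ s) !)))
      ≡⟨ cong (λ m → (n C r) *ⁿ (r ! *ⁿ m)) (C-factorials s≤n∸r) ⟩
    (n C r) *ⁿ (r ! *ⁿ (n ∸ r) !)
      ≡⟨ C-factorials r≤n ⟩
    n ! ∎
    where
    lemma : ∀ a b c d e → a *ⁿ b *ⁿ (c *ⁿ (d *ⁿ e)) ≡ b *ⁿ (c *ⁿ (a *ⁿ (d *ⁿ e)))
    lemma = ℕ-Solver.solve-∀
  generic : r +ⁿ s ≤ⁿ n → ((n ∸ r) C s) *ⁿ (n C r) ≡ ((n ∸ s) C r) *ⁿ (n C s)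
  generic r+s≤n = ℕ.*-cancelʳ-≡ _ _ (r ! *ⁿ (s ! *ⁿ (n ∸ (r +ⁿ s)) !)) (begin
    ((n ∸ r) C s) *ⁿ (n C r) *ⁿ (r ! *ⁿ (s ! *ⁿ (n ∸ (r +ⁿ s)) !))
      ≡⟨ half r≤n (ℕ.m+n≤o⇒m≤o∸n s (subst (_≤ⁿ n) (ℕ.+-comm r s) r+s≤n)) ⟩
    n !
      ≡⟨ half s≤n (ℕ.m+n≤o⇒m≤o∸n r r+s≤n) ⟨
    ((n ∸ s) C r) *ⁿ (n C s) *ⁿ (s ! *ⁿ (r ! *ⁿ (n ∸ (s +ⁿ r)) !))
      ≡⟨ cong (λ m → ((n ∸ s) C r) *ⁿ (n C s) *ⁿ (s ! *ⁿ (r ! *ⁿ (n ∸ m) !))) (ℕ.+-comm s r) ⟩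
    ((n ∸ s) C r) *ⁿ (n C s) *ⁿ (s ! *ⁿ (r ! *ⁿ (n ∸ (r +ⁿ s)) !))
      ≡⟨ lemma (((n ∸ s) C r) *ⁿ (n C s)) (r !) (s !) ((n ∸ (r +ⁿ s)) !) ⟩
    ((n ∸ s) C r) *ⁿ (n C s) *ⁿ (r ! *ⁿ (s ! *ⁿ (n ∸ (r +ⁿ s)) !)) ∎)
    where
    lemma : ∀ a b c d → a *ⁿ (c *ⁿ (b *ⁿ d)) ≡ a *ⁿ (b *ⁿ (c *ⁿ d))
    lemma = ℕ-Solver.solve-∀
    instance
      _ = ℕ.m*n≢0 (r !) _ {{r ℕ.!≢0}} {{s ℕ.!* (n ∸ (r +ⁿ s)) !≢0}}

-- Both sides count the `s`-subsets of an (n + 1)-set together with a marked element outside the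
-- subset.
C-absorption : ∀ {n s} → s ≤ⁿ n → (suc n C s) *ⁿ suc (n ∸ s) ≡ suc n *ⁿ (n C s)
C-absorption {n} {s} s≤n = ℕ.*-cancelʳ-≡ _ _ (s ! *ⁿ (n ∸ s) !) (begin
  (suc n C s) *ⁿ suc (n ∸ s) *ⁿ (s ! *ⁿ (n ∸ s) !)
    ≡⟨ lemma (suc n C s) (suc (n ∸ s)) (s !) ((n ∸ s) !) ⟩
  (suc n C s) *ⁿ (s ! *ⁿ (suc (n ∸ s)) !)
    ≡⟨ cong (λ m → (suc n C s) *ⁿ (s ! *ⁿ m !)) (sym (ℕ.+-∸-assoc 1 s≤n)) ⟩
  (suc n C s) *ⁿ (s ! *ⁿ (suc n ∸ s) !)
    ≡⟨ C-factorials (ℕ.m≤n⇒m≤1+n s≤n) ⟩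
  suc n *ⁿ n !
    ≡⟨ cong (suc n *ⁿ_) (C-factorials s≤n) ⟨
  suc n *ⁿ ((n C s) *ⁿ (s ! *ⁿ (n ∸ s) !))
    ≡⟨ ℕ.*-assoc (suc n) (n C s) _ ⟨
  suc n *ⁿ (n C s) *ⁿ (s ! *ⁿ (n ∸ s) !) ∎)
  where
  open ≡-Reasoning
  lemma : ∀ a b c d → a *ⁿ b *ⁿ (c *ⁿ d) ≡ a *ⁿ (c *ⁿ (b *ⁿ d))
  lemma = ℕ-Solver.solve-∀
  instance
    _ = s ℕ.!* (n ∸ s) !≢0

-- Among the terms C(r , l) with s + (i + l) = i + r only l = r - s survives, and C(r , r - s) = C(r
-- , s); for s > r nothing survives. The induction is Pascal's rule.
Δ-layer : ∀ r i s → Δ r (λ d → ind (s +ⁿ d ≟ⁿ i +ⁿ r)) i ≡ bin r s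
Δ-layer zero i zero    = ind-yes (i ≟ⁿ i +ⁿ 0) (sym (ℕ.+-identityʳ i))
Δ-layer zero i (suc s) = trans
  (ind-no (suc s +ⁿ i ≟ⁿ i +ⁿ 0) λ eq → ℕ.m≢1+n+m i (trans (sym (ℕ.+-identityʳ i)) (sym eq)))
  (sym (bin-zero {0} {suc s} (s≤s z≤n)))
Δ-layer (suc r) i s = begin
  Δ r (λ d → ind (s +ⁿ d ≟ⁿ i +ⁿ suc r) + ind (s +ⁿ suc d ≟ⁿ i +ⁿ suc r)) i
    ≡⟨ Δ-+ r _ _ i ⟩
  Δ r (λ d → ind (s +ⁿ d ≟ⁿ i +ⁿ suc r)) i + Δ r (λ d → ind (s +ⁿ suc d ≟ⁿ i +ⁿ suc r)) i
    ≡⟨ cong (Δ r (λ d → ind (s +ⁿ d ≟ⁿ i +ⁿ suc r)) i +_)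
         (trans (Δ-cong r i λ d _ _ → shift s d) (Δ-layer r i s)) ⟩
  Δ r (λ d → ind (s +ⁿ d ≟ⁿ i +ⁿ suc r)) i + bin r s
    ≡⟨ first s ⟩
  bin (suc r) s ∎
  where
  open ≡-Reasoning
  shift : ∀ s d → ind (s +ⁿ suc d ≟ⁿ i +ⁿ suc r) ≡ ind (s +ⁿ d ≟ⁿ i +ⁿ r)
  shift s d = ind-cong (s +ⁿ suc d ≟ⁿ i +ⁿ suc r) (s +ⁿ d ≟ⁿ i +ⁿ r)
    (λ eq → ℕ.suc-injective (trans (sym (ℕ.+-suc s d)) (trans eq (ℕ.+-suc i r))))
    (λ eq → trans (ℕ.+-suc s d) (trans (cong suc eq) (sym (ℕ.+-suc i r))))
  first : ∀ s → Δ r (λ d → ind (s +ⁿ d ≟ⁿ i +ⁿ suc r)) i + bin r s ≡ bin (suc r) s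
  first zero    = cong (_+ 1ℚ) (Δ-zero r i λ d _ d≤i+r → ind-no (d ≟ⁿ i +ⁿ suc r) λ eq →
    ℕ.1+n≰n (subst (_≤ⁿ i +ⁿ r) (trans eq (ℕ.+-suc i r)) d≤i+r))
  first (suc s) = trans
    (cong (_+ bin r (suc s)) (trans
      (Δ-cong r i λ d _ _ → trans (cong (λ m → ind (m ≟ⁿ i +ⁿ suc r)) (sym (ℕ.+-suc s d))) (shift s d))
      (Δ-layer r i s)))
    (sym (bin-pascal r s))

-- Alternating sums and isolating weights

sgn : ℕ → ℚ
sgn zero    = 1ℚ
sgn (suc n) = - sgn n

sgn² : ∀ n → sgn n * sgn n ≡ 1ℚ
sgn² zero    = refl
sgn² (suc n) = trans (lemma (sgn n)) (sgn² n)
  where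
  lemma : ∀ p → - p * - p ≡ p * p
  lemma = solve-∀ ℚ-ring

∣sgn∣≡1 : ∀ n → abs (sgn n) ≡ 1ℚ
∣sgn∣≡1 zero    = refl
∣sgn∣≡1 (suc n) = trans (ℚ.∣-p∣≡∣p∣ (sgn n)) (∣sgn∣≡1 n)

-- C(n - s , r) is a polynomial of degree r in s, so its alternating sums over
-- r + 2 consecutive values of s vanish.
Δ-alternating : ∀ r i n → i +ⁿ suc r ≤ⁿ n → Δ (suc r) (λ s → sgn s * bin (n ∸ s) r) i ≡ 0ℚ
Δ-alternating zero    i n _  = lemma (sgn i)
  where
  lemma : ∀ p → p * 1ℚ + - p * 1ℚ ≡ 0ℚ
  lemma = solve-∀ ℚ-ring
Δ-alternating (suc r) i zero le with () ← subst (_≤ⁿ 0) (ℕ.+-suc i (suc r)) le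
Δ-alternating (suc r) i (suc n) le = trans
  (Δ-cong (suc r) i step) (Δ-alternating r i n i+1+r≤n)
  where
  i+1+r≤n : i +ⁿ suc r ≤ⁿ n
  i+1+r≤n = ℕ.≤-pred (subst (_≤ⁿ suc n) (ℕ.+-suc i (suc r)) le)
  lemma : ∀ p q r → p * (q + r) + - p * r ≡ p * q
  lemma = solve-∀ ℚ-ring
  step : ∀ s → i ≤ⁿ s → s ≤ⁿ i +ⁿ suc r →
         sgn s * bin (suc n ∸ s) (suc r) + - sgn s * bin (n ∸ s) (suc r) ≡ sgn s * bin (n ∸ s) r
  step s _ s≤ = trans
    (cong (λ p → sgn s * p + - sgn s * bin (n ∸ s) (suc r))
      (trans (cong (λ m → bin m (suc r)) (ℕ.+-∸-assoc 1 (ℕ.≤-trans s≤ i+1+r≤n))) (bin-pascal (n ∸ s) r)))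
    (lemma (sgn s) (bin (n ∸ s) r) (bin (n ∸ s) (suc r)))

-- The first two conditions say that, for a t-subset T of a (k + t)-set, giving
-- weight φ ∣ K ∩ T ∣ to each k-subset K yields total 1 at T and 0 at every other
-- t-subset.  The solution for t < k is
--   φ s = (-1)^(t - s) (k - t) / ((k - s) C(k , s)).
record Isolating (t k : ℕ) (φ : ℕ → ℚ) : Set where
  field
    isolates : φ t * bin k t ≡ 1ℚ
    vanishes : ∀ r → suc r ≤ⁿ t → Δ (suc r) (λ s → φ s * bin (k ∸ suc r) s) (t ∸ suc r) ≡ 0ℚ
    bounded  : ∀ s → s ≤ⁿ t → abs (φ s) * bin k s ≤ 1ℚ

-- The general formula reads 0 / 0 at s = t = k. Here the repaired edge is itself a k-subset and
-- simply receives all the weight.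
isolating-equal : ∀ t → Isolating t t (λ s → ind (s ≟ⁿ t))
isolating-equal t = record
  { isolates = trans (cong₂ _*_ (ind-yes (t ≟ⁿ t) refl) (cong ι (nCn≡1 t))) refl
  ; vanishes = λ r r<t → Δ-zero (suc r) (t ∸ suc r) λ s _ _ → vanish r r<t s
  ; bounded  = λ s _ → bound s
  }
  where
  vanish : ∀ r → suc r ≤ⁿ t → ∀ s → ind (s ≟ⁿ t) * bin (t ∸ suc r) s ≡ 0ℚ
  vanish r r<t s = trans
    (ind-guard (s ≟ⁿ t) {y = 0ℚ} λ { refl → bin-zero (ℕ.∸-monoʳ-< (s≤s z≤n) r<t) })
    (ℚ.*-zeroʳ (ind (s ≟ⁿ t)))
  bound : ∀ s → abs (ind (s ≟ⁿ t)) * bin t s ≤ 1ℚ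
  bound s = case s ≟ⁿ t of λ where
    (yes refl) → ℚ.≤-reflexive (cong₂ (λ x m → abs x * ι m) (ind-yes (s ≟ⁿ s) refl) (nCn≡1 s))
    (no  s≢t)  → subst (_≤ 1ℚ)
      (sym (trans (cong (λ x → abs x * bin t s) (ind-no (s ≟ⁿ t) s≢t)) (ℚ.*-zeroˡ (bin t s)))) 0≤1

-- With k = n + 1, absorption gives (k - s) C(k , s) = k C(n , s), so the weight becomes (-1)^(t -
-- s) `κ` / C(n , s) with `κ` = (k - t) / k. Two facts follow from this form: ∣φ(s)∣ C(k , s) = (k -
-- t) / (k - s), which is 1 at s = t and at most 1 below; and φ(s) C(n - r , s) is a constant times
-- (-1)^s C(n - s , r), which `Δ-alternating` annihilates.
isolating-less : ∀ t n → t ≤ⁿ n → ∃[ φ ] Isolating t (suc n) φ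
isolating-less t n t≤n = φ , record { isolates = isolates ; vanishes = vanishes ; bounded = bounded }
  where
  open ≡-Reasoning
  κ : ℚ
  κ = ι (suc (n ∸ t)) * recip (ι (suc n))
  0≤κ : 0ℚ ≤ κ
  0≤κ = 0≤* (ι-nonNeg (suc (n ∸ t))) (recip-nonNeg (ι-nonNeg (suc n)))
  φ : ℕ → ℚ
  φ s = sgn t * sgn s * (κ * recip (bin n s))
  inv : ∀ {s} → s ≤ⁿ n → recip (bin n s) * bin n s ≡ 1ℚ
  inv s≤n = recip-inverse (0<⇒≢0 (bin-pos s≤n))
  inv-suc : recip (ι (suc n)) * ι (suc n) ≡ 1ℚ
  inv-suc = recip-inverse (0<⇒≢0 (ι-suc-pos n))
  absorb : ∀ {s} → s ≤ⁿ n → κ * recip (bin n s) * bin (suc n) s * ι (suc (n ∸ s)) ≡ ι (suc (n ∸ t))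
  absorb {s} s≤n = begin
    a * b * c * d * e     ≡⟨ assoc a b c d e ⟩
    a * b * c * (d * e)   ≡⟨ cong (a * b * c *_) (trans (sym (ι-* (suc n C s) (suc (n ∸ s))))
                               (trans (cong ι (C-absorption s≤n)) (ι-* (suc n) (n C s)))) ⟩
    a * b * c * (f * g)   ≡⟨ regroup a b c f g ⟩
    a * (b * f) * (c * g) ≡⟨ cong₂ (λ x y → a * x * y) inv-suc (inv s≤n) ⟩
    a * 1ℚ * 1ℚ           ≡⟨ unit a ⟩
    a                     ∎
    where
    a b c d e f g : ℚ
    a = ι (suc (n ∸ t))
    b = recip (ι (suc n))
    c = recip (bin n s)
    d = bin (suc n) s
    e = ι (suc (n ∸ s))
    f = ι (suc n)
    g = bin n s
    assoc : ∀ a b c d e → a * b * c * d * e ≡ a * b * c * (d * e)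
    assoc = solve-∀ ℚ-ring
    regroup : ∀ a b c f g → a * b * c * (f * g) ≡ a * (b * f) * (c * g)
    regroup = solve-∀ ℚ-ring
    unit : ∀ a → a * 1ℚ * 1ℚ ≡ a
    unit = solve-∀ ℚ-ring
  ∣φ∣ : ∀ {s} → s ≤ⁿ n → abs (φ s) ≡ κ * recip (bin n s)
  ∣φ∣ {s} s≤n = begin
    abs (sgn t * sgn s * (κ * recip (bin n s)))
      ≡⟨ ℚ.∣p*q∣≡∣p∣*∣q∣ (sgn t * sgn s) (κ * recip (bin n s)) ⟩
    abs (sgn t * sgn s) * abs (κ * recip (bin n s))
      ≡⟨ cong₂ _*_ (trans (ℚ.∣p*q∣≡∣p∣*∣q∣ (sgn t) (sgn s)) (cong₂ _*_ (∣sgn∣≡1 t) (∣sgn∣≡1 s)))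
                   (ℚ.0≤p⇒∣p∣≡p (0≤* 0≤κ (recip-nonNeg (bin-nonNeg n s)))) ⟩
    1ℚ * (κ * recip (bin n s))
      ≡⟨ ℚ.*-identityˡ _ ⟩
    κ * recip (bin n s) ∎
  bounded : ∀ s → s ≤ⁿ t → abs (φ s) * bin (suc n) s ≤ 1ℚ
  bounded s s≤t = *-cancelʳ-≤ (ι-suc-pos (n ∸ s)) (ℚ.≤-trans
    (ℚ.≤-reflexive (trans (cong (λ x → x * bin (suc n) s * ι (suc (n ∸ s))) (∣φ∣ s≤n)) (absorb s≤n)))
    (subst (ι (suc (n ∸ t)) ≤_) (sym (ℚ.*-identityˡ (ι (suc (n ∸ s)))))
      (ι-mono (s≤s (ℕ.∸-monoʳ-≤ n s≤t)))))
    where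
    s≤n : s ≤ⁿ n
    s≤n = ℕ.≤-trans s≤t t≤n
  isolates : φ t * bin (suc n) t ≡ 1ℚ
  isolates = begin
    sgn t * sgn t * (κ * recip (bin n t)) * bin (suc n) t
      ≡⟨ cong (λ x → x * (κ * recip (bin n t)) * bin (suc n) t) (sgn² t) ⟩
    1ℚ * (κ * recip (bin n t)) * bin (suc n) t
      ≡⟨ cong (_* bin (suc n) t) (ℚ.*-identityˡ (κ * recip (bin n t))) ⟩
    κ * recip (bin n t) * bin (suc n) t
      ≡⟨ ℚ.*-identityʳ _ ⟨
    κ * recip (bin n t) * bin (suc n) t * 1ℚ
      ≡⟨ cong (κ * recip (bin n t) * bin (suc n) t *_) q*1/q≡1 ⟨
    κ * recip (bin n t) * bin (suc n) t * (q * recip q)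
      ≡⟨ ℚ.*-assoc (κ * recip (bin n t) * bin (suc n) t) q (recip q) ⟨
    κ * recip (bin n t) * bin (suc n) t * q * recip q
      ≡⟨ cong (_* recip q) (absorb t≤n) ⟩
    q * recip q
      ≡⟨ q*1/q≡1 ⟩
    1ℚ ∎
    where
    q : ℚ
    q = ι (suc (n ∸ t))
    q*1/q≡1 : q * recip q ≡ 1ℚ
    q*1/q≡1 = trans (ℚ.*-comm q (recip q)) (recip-inverse (0<⇒≢0 (ι-suc-pos (n ∸ t))))
  vanishes : ∀ r → suc r ≤ⁿ t → Δ (suc r) (λ s → φ s * bin (n ∸ r) s) (t ∸ suc r) ≡ 0ℚ
  vanishes r r<t = begin
    Δ (suc r) (λ s → φ s * bin (n ∸ r) s) (t ∸ suc r)
      ≡⟨ Δ-cong (suc r) (t ∸ suc r) (λ s _ s≤ → step s (ℕ.≤-trans (subst (s ≤ⁿ_) (ℕ.m∸n+n≡m r<t) s≤) t≤n)) ⟩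
    Δ (suc r) (λ s → sgn t * κ * recip (bin n r) * (sgn s * bin (n ∸ s) r)) (t ∸ suc r)
      ≡⟨ Δ-*ˡ (suc r) (sgn t * κ * recip (bin n r)) (λ s → sgn s * bin (n ∸ s) r) (t ∸ suc r) ⟩
    sgn t * κ * recip (bin n r) * Δ (suc r) (λ s → sgn s * bin (n ∸ s) r) (t ∸ suc r)
      ≡⟨ cong (sgn t * κ * recip (bin n r) *_)
           (Δ-alternating r (t ∸ suc r) n (subst (_≤ⁿ n) (sym (ℕ.m∸n+n≡m r<t)) t≤n)) ⟩
    sgn t * κ * recip (bin n r) * 0ℚ
      ≡⟨ ℚ.*-zeroʳ (sgn t * κ * recip (bin n r)) ⟩
    0ℚ ∎
    where
    r≤n : r ≤ⁿ n
    r≤n = ℕ.≤-trans (ℕ.<⇒≤ r<t) t≤n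
    -- Inserting C(n , r) / C(n , r) creates the product C(n - r , s) C(n , r). `C-trinomial` turns
    -- it into C(n - s , r) C(n , s), and the second factor cancels the denominator of `φ s`.
    step : ∀ s → s ≤ⁿ n → φ s * bin (n ∸ r) s ≡ sgn t * κ * recip (bin n r) * (sgn s * bin (n ∸ s) r)
    step s s≤n = begin
      σ * τ * (κ * x) * b             ≡⟨ unit₁ σ τ κ x b ⟩
      σ * κ * τ * x * b * 1ℚ          ≡⟨ cong (σ * κ * τ * x * b *_) (inv r≤n) ⟨
      σ * κ * τ * x * b * (y * c)     ≡⟨ regroup₁ σ τ κ x y b c ⟩
      σ * κ * τ * x * y * (b * c)     ≡⟨ cong (σ * κ * τ * x * y *_) (trans (sym (ι-* ((n ∸ r) C s) (n C r)))
                                          (trans (cong ι (C-trinomial r≤n s≤n)) (ι-* ((n ∸ s) C r) (n C s)))) ⟩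
      σ * κ * τ * x * y * (d * e)     ≡⟨ regroup₂ σ τ κ x y d e ⟩
      σ * κ * y * (τ * d) * (x * e)   ≡⟨ cong (σ * κ * y * (τ * d) *_) (inv s≤n) ⟩
      σ * κ * y * (τ * d) * 1ℚ        ≡⟨ ℚ.*-identityʳ _ ⟩
      σ * κ * y * (τ * d)             ∎
      where
      σ τ x y b c d e : ℚ
      σ = sgn t
      τ = sgn s
      x = recip (bin n s)
      y = recip (bin n r)
      b = bin (n ∸ r) s
      c = bin n r
      d = bin (n ∸ s) r
      e = bin n s
      unit₁ : ∀ σ τ κ x b → σ * τ * (κ * x) * b ≡ σ * κ * τ * x * b * 1ℚ
      unit₁ = solve-∀ ℚ-ring
      regroup₁ : ∀ σ τ κ x y b c → σ * κ * τ * x * b * (y * c) ≡ σ * κ * τ * x * y * (b * c)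
      regroup₁ = solve-∀ ℚ-ring
      regroup₂ : ∀ σ τ κ x y d e → σ * κ * τ * x * y * (d * e) ≡ σ * κ * y * (τ * d) * (x * e)
      regroup₂ = solve-∀ ℚ-ring

isolating : ∀ t k → t ≤ⁿ k → ∃[ φ ] Isolating t k φ
isolating t k t≤k with t ≟ⁿ k
... | yes refl = _ , isolating-equal t
... | no  t≢k  with k | ℕ.≤∧≢⇒< t≤k t≢k
...   | suc n | s≤s t≤n = isolating-less t n t≤n

-- Removing and inserting vertices

∣T∣≡1+∣T∖a∣ : ∀ {n} {T : Subset n} {a} → a ∈ˢ T → ∣ T ∣ ≡ suc ∣ T ∖ a ∣
∣T∣≡1+∣T∖a∣ {T = inside ∷ T}  here      = cong (suc ∘ ∣_∣) (sym (p─⊥≡p T))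
∣T∣≡1+∣T∖a∣ {T = inside ∷ T}  (there h) = cong suc (∣T∣≡1+∣T∖a∣ h)
∣T∣≡1+∣T∖a∣ {T = outside ∷ T} (there h) = ∣T∣≡1+∣T∖a∣ h

a∉T⇒T∖a≡T : ∀ {n} {T : Subset n} {a} → a ∉ˢ T → T ∖ a ≡ T
a∉T⇒T∖a≡T {T = inside  ∷ T} {zero}  h = contradiction here h
a∉T⇒T∖a≡T {T = outside ∷ T} {zero}  h = cong (outside ∷_) (p─⊥≡p T)
a∉T⇒T∖a≡T {T = s ∷ T}       {suc a} h = cong (s ∷_) (a∉T⇒T∖a≡T (h ∘ there))

a∉T∖a : ∀ {n} (T : Subset n) a → a ∉ˢ (T ∖ a)
a∉T∖a (s ∷ T) (suc a) (there h) = a∉T∖a T a h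

∈-∖⁻ : ∀ {n} (T : Subset n) {a b} → b ∈ˢ (T ∖ a) → b ∈ˢ T × b ≢ a
∈-∖⁻ T {a} b∈ = p─q⊆p T ⁅ a ⁆ b∈ , λ { refl → a∉T∖a T a b∈ }

∖-mono : ∀ {n} {p q : Subset n} {a} → p ⊆ˢ q → (p ∖ a) ⊆ˢ (q ∖ a)
∖-mono {p = p} p⊆q b∈ with ∈-∖⁻ p b∈
... | b∈p , b≢a = x∈p∧x≢y⇒x∈p-y (p⊆q b∈p) b≢a

∈-insert⁻ : ∀ {n} (p : Subset n) {a b} → b ∈ˢ (p ∪ ⁅ a ⁆) → b ∈ˢ p ⊎ b ≡ a
∈-insert⁻ p {a} b∈ with x∈p∪q⁻ p ⁅ a ⁆ b∈
... | inj₁ b∈p = inj₁ b∈p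
... | inj₂ b∈a = inj₂ (x∈⁅y⁆⇒x≡y a b∈a)

∈-insert-here : ∀ {n} (p : Subset n) a → a ∈ˢ (p ∪ ⁅ a ⁆)
∈-insert-here p a = x∈p∪q⁺ {p = p} (inj₂ (x∈⁅x⁆ a))

∈-insert-there : ∀ {n} {p : Subset n} a {b} → b ∈ˢ p → b ∈ˢ (p ∪ ⁅ a ⁆)
∈-insert-there {p = p} a = p⊆p∪q {p = p} ⁅ a ⁆

insert-mono : ∀ {n} {p q : Subset n} {a} → p ⊆ˢ q → (p ∪ ⁅ a ⁆) ⊆ˢ (q ∪ ⁅ a ⁆)
insert-mono {p = p} {q} {a} p⊆q b∈ with ∈-insert⁻ p b∈
... | inj₁ b∈p  = ∈-insert-there a (p⊆q b∈p)
... | inj₂ refl = ∈-insert-here q a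

insert-∖ : ∀ {n} {p : Subset n} {a} → a ∉ˢ p → (p ∪ ⁅ a ⁆) ∖ a ≡ p
insert-∖ {p = p} {a} a∉p = ⊆-antisym
  (λ b∈ → case ∈-insert⁻ p (proj₁ (∈-∖⁻ (p ∪ ⁅ a ⁆) b∈)) of λ where
    (inj₁ b∈p) → b∈p
    (inj₂ b≡a) → contradiction b≡a (proj₂ (∈-∖⁻ (p ∪ ⁅ a ⁆) b∈)))
  (λ b∈p → x∈p∧x≢y⇒x∈p-y (∈-insert-there a b∈p) λ { refl → a∉p b∈p })

∖-insert : ∀ {n} {p : Subset n} {a} → a ∈ˢ p → (p ∖ a) ∪ ⁅ a ⁆ ≡ p
∖-insert {p = p} {a} a∈p = ⊆-antisym
  (λ b∈ → case ∈-insert⁻ (p ∖ a) b∈ of λ where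
    (inj₁ b∈p∖a) → proj₁ (∈-∖⁻ p b∈p∖a)
    (inj₂ refl)  → a∈p)
  (λ {b} b∈p → case b Fin.≟ a of λ where
    (yes refl) → ∈-insert-here (p ∖ a) a
    (no b≢a)   → ∈-insert-there a (x∈p∧x≢y⇒x∈p-y b∈p b≢a))

∣insert∣ : ∀ {n} {p : Subset n} {a} → a ∉ˢ p → ∣ p ∪ ⁅ a ⁆ ∣ ≡ suc ∣ p ∣
∣insert∣ {p = p} {a} a∉p =
  trans (∣T∣≡1+∣T∖a∣ (∈-insert-here p a)) (cong (suc ∘ ∣_∣) (insert-∖ a∉p))

∣T∣≡0⇒∉ : ∀ {n} {T : Subset n} → ∣ T ∣ ≡ 0 → ∀ {a} → a ∉ˢ T
∣T∣≡0⇒∉ ∣T∣≡0 a∈T = ℕ.1+n≢0 (trans (sym (∣T∣≡1+∣T∖a∣ a∈T)) ∣T∣≡0)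

⊆∧∣∣≤⇒≡ : ∀ {n} {p q : Subset n} → p ⊆ˢ q → ∣ q ∣ ≤ⁿ ∣ p ∣ → p ≡ q
⊆∧∣∣≤⇒≡ {p = p} {q} p⊆q ∣q∣≤∣p∣ = ⊆-antisym p⊆q λ {a} a∈q → case a ∈ˢ? p of λ where
  (yes a∈p) → a∈p
  (no  a∉p) → contradiction
    (ℕ.≤-trans (s≤s (p⊆q⇒∣p∣≤∣q∣ {p = p} {q ∖ a} λ b∈p →
        x∈p∧x≢y⇒x∈p-y (p⊆q b∈p) λ { refl → a∉p b∈p }))
      (subst (_≤ⁿ ∣ p ∣) (∣T∣≡1+∣T∖a∣ a∈q) ∣q∣≤∣p∣))
    ℕ.1+n≰n

∣p∪q∣≤∣p∣+∣q∣ : ∀ {n} (p q : Subset n) → ∣ p ∪ q ∣ ≤ⁿ ∣ p ∣ +ⁿ ∣ q ∣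
∣p∪q∣≤∣p∣+∣q∣ []            []            = z≤n
∣p∪q∣≤∣p∣+∣q∣ (outside ∷ p) (outside ∷ q) = ∣p∪q∣≤∣p∣+∣q∣ p q
∣p∪q∣≤∣p∣+∣q∣ (inside  ∷ p) (outside ∷ q) = s≤s (∣p∪q∣≤∣p∣+∣q∣ p q)
∣p∪q∣≤∣p∣+∣q∣ (inside  ∷ p) (inside  ∷ q) =
  s≤s (ℕ.≤-trans (∣p∪q∣≤∣p∣+∣q∣ p q) (ℕ.+-monoʳ-≤ ∣ p ∣ (ℕ.n≤1+n ∣ q ∣)))
∣p∪q∣≤∣p∣+∣q∣ (outside ∷ p) (inside  ∷ q) =
  subst (suc ∣ p ∪ q ∣ ≤ⁿ_) (sym (ℕ.+-suc ∣ p ∣ ∣ q ∣)) (s≤s (∣p∪q∣≤∣p∣+∣q∣ p q))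

-- Covering a set by the entries of a tuple

-- Deleting entry by entry makes covering recurse along a tuple in step with `words` and `Ok`, so
-- that counts of covering cliques satisfy a recursion. `Covers⇒⊆span` and `⊆span⇒Covers` translate
-- to containment in the spanned set.
rest : ∀ {v} → Subset v → List (Fin v) → Subset v
rest T []      = T
rest T (a ∷ x) = rest (T ∖ a) x

Covers : ∀ {v} → Subset v → List (Fin v) → Set
Covers T x = ∣ rest T x ∣ ≡ 0

covers? : ∀ {v} (T : Subset v) x → Dec (Covers T x)
covers? T x = ∣ rest T x ∣ ≟ⁿ 0

rest-++ : ∀ {v} (T : Subset v) x y → rest T (x ++ y) ≡ rest (rest T x) y
rest-++ T []      y = refl
rest-++ T (a ∷ x) y = rest-++ (T ∖ a) x y

rest-antitone : ∀ {v} {p q : Subset v} {x y} → x ⊑ y → p ⊆ˢ q → rest p y ⊆ˢ rest q x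
rest-antitone []         p⊆q = p⊆q
rest-antitone {p = p} (a ∷ʳ x⊑y) p⊆q = rest-antitone x⊑y (p⊆q ∘ proj₁ ∘ ∈-∖⁻ p)
rest-antitone (refl ∷ x⊑y) p⊆q = rest-antitone x⊑y (∖-mono p⊆q)

Covers-⊑ : ∀ {v} {T : Subset v} {x y} → x ⊑ y → Covers T x → Covers T y
Covers-⊑ {T = T} {x} {y} x⊑y cov =
  ℕ.n≤0⇒n≡0 (subst (∣ rest T y ∣ ≤ⁿ_) cov (p⊆q⇒∣p∣≤∣q∣ (rest-antitone {p = T} {x = x} {y} x⊑y (λ b∈ → b∈))))

∣∖∣-≥ : ∀ {v} (T : Subset v) a → ∣ T ∣ ≤ⁿ suc ∣ T ∖ a ∣
∣∖∣-≥ T a with a ∈ˢ? T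
... | yes a∈T = ℕ.≤-reflexive (∣T∣≡1+∣T∖a∣ a∈T)
... | no  a∉T = subst (λ T′ → ∣ T ∣ ≤ⁿ suc ∣ T′ ∣) (sym (a∉T⇒T∖a≡T a∉T)) (ℕ.n≤1+n ∣ T ∣)

Covers⇒∣∣≤length : ∀ {v} {T : Subset v} x → Covers T x → ∣ T ∣ ≤ⁿ length x
Covers⇒∣∣≤length []      cov = ℕ.≤-reflexive cov
Covers⇒∣∣≤length {T = T} (a ∷ x) cov =
  ℕ.≤-trans (∣∖∣-≥ T a) (s≤s (Covers⇒∣∣≤length x cov))

span : ∀ {v} → Subset v → List (Fin v) → Subset v
span p []      = p
span p (a ∷ x) = span (p ∪ ⁅ a ⁆) x

⊆-span : ∀ {v} {p : Subset v} x → p ⊆ˢ span p x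
⊆-span []      b∈p = b∈p
⊆-span (a ∷ x) b∈p = ⊆-span x (∈-insert-there a b∈p)

∣span∣ : ∀ {v} (p : Subset v) x → ∣ span p x ∣ ≤ⁿ ∣ p ∣ +ⁿ length x
∣span∣ p []      = ℕ.m≤m+n ∣ p ∣ 0
∣span∣ p (a ∷ x) = ℕ.≤-trans (∣span∣ (p ∪ ⁅ a ⁆) x)
  (subst (∣ p ∪ ⁅ a ⁆ ∣ +ⁿ length x ≤ⁿ_) (sym (ℕ.+-suc ∣ p ∣ (length x)))
    (ℕ.+-monoˡ-≤ (length x) (subst (∣ p ∪ ⁅ a ⁆ ∣ ≤ⁿ_)
      (trans (cong (∣ p ∣ +ⁿ_) (∣⁅x⁆∣≡1 a)) (ℕ.+-comm ∣ p ∣ 1)) (∣p∪q∣≤∣p∣+∣q∣ p ⁅ a ⁆))))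

Covers⇒⊆span : ∀ {v} {p T : Subset v} x → Covers T x → T ⊆ˢ span p x
Covers⇒⊆span []      cov a∈T = contradiction a∈T (∣T∣≡0⇒∉ cov)
Covers⇒⊆span {p = p} (b ∷ x) cov {a} a∈T with a Fin.≟ b
... | yes refl = ⊆-span x (∈-insert-here p a)
... | no  a≢b  = Covers⇒⊆span x cov (x∈p∧x≢y⇒x∈p-y a∈T a≢b)

-- `span p x` contains `p` as well, so disjointness from `p` is what forces the vertices of `T` to
-- occur among the entries of `x`.
⊆span⇒Covers : ∀ {v} {p T : Subset v} x → (∀ {a} → a ∈ˢ T → a ∉ˢ p) → T ⊆ˢ span p x → Covers T x
⊆span⇒Covers {v} {T = T} [] T∩p T⊆p =
  trans (cong ∣_∣ (Empty-unique {p = T} λ (a , a∈T) → T∩p a∈T (T⊆p a∈T))) (∣⊥∣≡0 v)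
⊆span⇒Covers {p = p} {T} (b ∷ x) T∩p T⊆ = ⊆span⇒Covers x
  (λ a∈ a∈p∪b → case ∈-∖⁻ T a∈ ,′ ∈-insert⁻ p a∈p∪b of λ where
    ((a∈T , _) , inj₁ a∈p) → T∩p a∈T a∈p
    ((_ , a≢b) , inj₂ a≡b) → a≢b a≡b)
  (T⊆ ∘ proj₁ ∘ ∈-∖⁻ T)

Covers-⊥ : ∀ {v} (x : List (Fin v)) → Covers ⊥ x
Covers-⊥ x = ⊆span⇒Covers {p = ⊥} x (λ a∈⊥ _ → ∉⊥ a∈⊥) (λ a∈⊥ → contradiction a∈⊥ ∉⊥)

∈-span⁻ : ∀ {v} {p : Subset v} x {b} → b ∈ˢ span p x → b ∈ˢ p ⊎ ∃[ i ] lookup x i ≡ b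
∈-span⁻ []      b∈p = inj₁ b∈p
∈-span⁻ {p = p} (a ∷ x) b∈ with ∈-span⁻ x b∈
... | inj₂ (i , eq) = inj₂ (suc i , eq)
... | inj₁ b∈p∪a with ∈-insert⁻ p b∈p∪a
...   | inj₁ b∈p  = inj₁ b∈p
...   | inj₂ refl = inj₂ (zero , refl)

lookup-∈-span : ∀ {v} {p : Subset v} x i → lookup x i ∈ˢ span p x
lookup-∈-span {p = p} (a ∷ x) zero    = ⊆-span x (∈-insert-here p a)
lookup-∈-span         (a ∷ x) (suc i) = lookup-∈-span x i

-- Enumeration of tuples

words : ∀ v → ℕ → List (List (Fin v))
words v zero    = [] ∷ []
words v (suc k) = concatMap (λ a → map (a ∷_) (words v k)) (allFin v)

module _ {v : ℕ} where

  ∑-words-suc : ∀ k (f : List (Fin v) → ℚ) →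
                ∑ (words v (suc k)) f ≡ ∑ (allFin v) (λ a → ∑ (words v k) (λ x → f (a ∷ x)))
  ∑-words-suc k f = trans (∑-concatMap (λ a → map (a ∷_) (words v k)) (allFin v) f)
    (∑-cong (allFin v) λ {a} _ → ∑-map (a ∷_) (words v k) f)

  words-length : ∀ k {x} → x ∈ words v k → length x ≡ k
  words-length zero    (here refl) = refl
  words-length (suc k) x∈ with satisfied (∈-concatMap⁻ (λ a → map (a ∷_) (words v k)) {xs = allFin v} x∈)
  ... | a , x∈′ with ∈-map⁻ (a ∷_) x∈′
  ...   | x′ , x′∈ , refl = cong suc (words-length k x′∈)

  ∑-words-const : ∀ k c → ∑ (words v k) (λ _ → c) ≡ pow (ι v) k * c
  ∑-words-const zero    c = lemma c
    where
    lemma : ∀ c → c + 0ℚ ≡ 1ℚ * c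
    lemma = solve-∀ ℚ-ring
  ∑-words-const (suc k) c = begin
    ∑ (words v (suc k)) (λ _ → c)                 ≡⟨ ∑-words-suc k (λ _ → c) ⟩
    ∑ (allFin v) (λ _ → ∑ (words v k) (λ _ → c))  ≡⟨ ∑-cong (allFin v) (λ _ → ∑-words-const k c) ⟩
    ∑ (allFin v) (λ _ → pow (ι v) k * c)          ≡⟨ ∑-const (allFin v) (pow (ι v) k * c) ⟩
    ι (length (allFin v)) * (pow (ι v) k * c)     ≡⟨ cong (λ n → ι n * (pow (ι v) k * c))
                                                        (length-tabulate {n = v} (λ a → a)) ⟩
    ι v * (pow (ι v) k * c)                       ≡⟨ ℚ.*-assoc (ι v) (pow (ι v) k) c ⟨
    pow (ι v) (suc k) * c                         ∎
    where open ≡-Reasoning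

  ∑-words-+ : ∀ m n (f : List (Fin v) → ℚ) →
              ∑ (words v (m +ⁿ n)) f ≡ ∑ (words v m) (λ x → ∑ (words v n) (λ y → f (x ++ y)))
  ∑-words-+ zero    n f = sym (ℚ.+-identityʳ (∑ (words v n) f))
  ∑-words-+ (suc m) n f = trans (∑-words-suc (m +ⁿ n) f) (trans
    (∑-cong (allFin v) λ {a} _ → ∑-words-+ m n (f ∘ (a ∷_)))
    (sym (∑-words-suc m λ x → ∑ (words v n) (λ y → f (x ++ y)))))

select : ∀ {ℓ} {A : Set ℓ} {n} → Subset n → List A → List A
select []            x       = []
select (_ ∷ K)       []      = []
select (inside  ∷ K) (a ∷ x) = a ∷ select K x
select (outside ∷ K) (a ∷ x) = select K x

take-length-++ : ∀ {ℓ} {A : Set ℓ} {n} (x y : List A) → length x ≡ n → take n (x ++ y) ≡ x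
take-length-++ []      y refl = refl
take-length-++ (a ∷ x) y refl = cong (a ∷_) (take-length-++ x y refl)

-- A right inverse of x ↦ (select K x , select (∁ K) x); junk if the lengths do not fit.
merge : ∀ {ℓ} {A : Set ℓ} {n} → Subset n → List A → List A → List A
merge []            x       u       = []
merge (inside  ∷ K) (a ∷ x) u       = a ∷ merge K x u
merge (outside ∷ K) x       (a ∷ u) = a ∷ merge K x u
merge (inside  ∷ K) []      u       = []
merge (outside ∷ K) x       []      = []

select-⊑ : ∀ {ℓ} {A : Set ℓ} {n} (K : Subset n) (x : List A) → select K x ⊑ x
select-⊑ []            x       = minimum x
select-⊑ (_ ∷ K)       []      = []
select-⊑ (inside  ∷ K) (a ∷ x) = refl ∷ select-⊑ K x
select-⊑ (outside ∷ K) (a ∷ x) = a ∷ʳ select-⊑ K x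

select-++ : ∀ {ℓ} {A : Set ℓ} {m n} (S : Subset m) (D : Subset n) (x y : List A) →
            length x ≡ m → select (S Vec.++ D) (x ++ y) ≡ select S x ++ select D y
select-++ []            D []      y eq = refl
select-++ (inside  ∷ S) D (a ∷ x) y eq = cong (a ∷_) (select-++ S D x y (ℕ.suc-injective eq))
select-++ (outside ∷ S) D (a ∷ x) y eq = select-++ S D x y (ℕ.suc-injective eq)

-- For a fixed set of positions `K`, a tuple is the same thing as its entries in `K` together with
-- its entries outside. This later exchanges "all gadgets, then a k-tuple inside" for "all k-tuples,
-- then the gadgets around it".
∑-words-split : ∀ {v n} (K : Subset n) (f : List (Fin v) → List (Fin v) → ℚ) →
  ∑ (words v n) (λ y → f (select K y) y) ≡
  ∑ (words v ∣ K ∣) (λ x → ∑ (words v ∣ ∁ K ∣) (λ u → f x (merge K x u)))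
∑-words-split []            f = cong (_+ 0ℚ) (sym (ℚ.+-identityʳ (f [] [])))
∑-words-split {v} {suc n} (inside ∷ K) f = begin
  ∑ (words v (suc n)) (λ y → f (select (inside ∷ K) y) y)
    ≡⟨ ∑-words-suc n (λ y → f (select (inside ∷ K) y) y) ⟩
  ∑ (allFin v) (λ a → ∑ (words v n) (λ y → f (a ∷ select K y) (a ∷ y)))
    ≡⟨ ∑-cong (allFin v) (λ {a} _ → ∑-words-split K (λ x y → f (a ∷ x) (a ∷ y))) ⟩
  ∑ (allFin v) (λ a → ∑ (words v ∣ K ∣) (λ x → ∑ (words v ∣ ∁ K ∣) (λ u → f (a ∷ x) (a ∷ merge K x u))))
    ≡⟨ ∑-words-suc ∣ K ∣ (λ x → ∑ (words v ∣ ∁ K ∣) (λ u → f x (merge (inside ∷ K) x u))) ⟨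
  ∑ (words v (suc ∣ K ∣)) (λ x → ∑ (words v ∣ ∁ K ∣) (λ u → f x (merge (inside ∷ K) x u))) ∎
  where open ≡-Reasoning
∑-words-split {v} {suc n} (outside ∷ K) f = begin
  ∑ (words v (suc n)) (λ y → f (select (outside ∷ K) y) y)
    ≡⟨ ∑-words-suc n (λ y → f (select (outside ∷ K) y) y) ⟩
  ∑ (allFin v) (λ a → ∑ (words v n) (λ y → f (select K y) (a ∷ y)))
    ≡⟨ ∑-cong (allFin v) (λ {a} _ → ∑-words-split K (λ x y → f x (a ∷ y))) ⟩
  ∑ (allFin v) (λ a → ∑ (words v ∣ K ∣) (λ x → ∑ (words v ∣ ∁ K ∣) (λ u → f x (a ∷ merge K x u))))
    ≡⟨ ∑-swap (allFin v) (words v ∣ K ∣) (λ a x → ∑ (words v ∣ ∁ K ∣) (λ u → f x (a ∷ merge K x u))) ⟩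
  ∑ (words v ∣ K ∣) (λ x → ∑ (allFin v) (λ a → ∑ (words v ∣ ∁ K ∣) (λ u → f x (a ∷ merge K x u))))
    ≡⟨ ∑-cong (words v ∣ K ∣) (λ {x} _ → sym (∑-words-suc ∣ ∁ K ∣ (λ u → f x (merge (outside ∷ K) x u)))) ⟩
  ∑ (words v ∣ K ∣) (λ x → ∑ (words v (suc ∣ ∁ K ∣)) (λ u → f x (merge (outside ∷ K) x u))) ∎
  where open ≡-Reasoning

∑-subsets-size : ∀ n (g : ℕ → ℚ) → ∑ (subsets n) (λ D → g ∣ D ∣) ≡ Δ n g 0
∑-subsets-size zero    g = ℚ.+-identityʳ (g 0)
∑-subsets-size (suc n) g = begin
  ∑ (subsets (suc n)) (λ D → g ∣ D ∣)
    ≡⟨ ∑-subsets-suc n (λ D → g ∣ D ∣) ⟩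
  ∑ (subsets n) (λ D → g (suc ∣ D ∣)) + ∑ (subsets n) (λ D → g ∣ D ∣)
    ≡⟨ ℚ.+-comm (∑ (subsets n) (λ D → g (suc ∣ D ∣))) (∑ (subsets n) (λ D → g ∣ D ∣)) ⟩
  ∑ (subsets n) (λ D → g ∣ D ∣) + ∑ (subsets n) (λ D → g (suc ∣ D ∣))
    ≡⟨ ∑-+ (subsets n) (λ D → g ∣ D ∣) (λ D → g (suc ∣ D ∣)) ⟨
  ∑ (subsets n) (λ D → g ∣ D ∣ + g (suc ∣ D ∣))
    ≡⟨ ∑-subsets-size n (λ s → g s + g (suc s)) ⟩
  Δ (suc n) g 0 ∎
  where open ≡-Reasoning

∑-subsets-++ : ∀ m n (f : Subset (m +ⁿ n) → ℚ) →
               ∑ (subsets (m +ⁿ n)) f ≡ ∑ (subsets m) (λ S → ∑ (subsets n) (λ D → f (S Vec.++ D)))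
∑-subsets-++ zero    n f = sym (ℚ.+-identityʳ (∑ (subsets n) f))
∑-subsets-++ (suc m) n f = begin
  ∑ (subsets (suc m +ⁿ n)) f
    ≡⟨ ∑-subsets-suc (m +ⁿ n) f ⟩
  ∑ (subsets (m +ⁿ n)) (f ∘ (inside ∷_)) + ∑ (subsets (m +ⁿ n)) (f ∘ (outside ∷_))
    ≡⟨ cong₂ _+_ (∑-subsets-++ m n (f ∘ (inside ∷_))) (∑-subsets-++ m n (f ∘ (outside ∷_))) ⟩
  ∑ (subsets m) (λ S → ∑ (subsets n) (λ D → f (inside ∷ (S Vec.++ D)))) +
  ∑ (subsets m) (λ S → ∑ (subsets n) (λ D → f (outside ∷ (S Vec.++ D))))
    ≡⟨ ∑-subsets-suc m (λ S → ∑ (subsets n) (λ D → f (S Vec.++ D))) ⟨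
  ∑ (subsets (suc m)) (λ S → ∑ (subsets n) (λ D → f (S Vec.++ D))) ∎
  where open ≡-Reasoning

∑-subsets-1 : ∀ n → ∑ (subsets n) (λ _ → 1ℚ) ≡ pow (ι 2) n
∑-subsets-1 zero    = refl
∑-subsets-1 (suc n) = trans (∑-subsets-suc n (λ _ → 1ℚ))
  (trans (cong₂ _+_ (∑-subsets-1 n) (∑-subsets-1 n)) (lemma (pow (ι 2) n)))
  where
  lemma : ∀ p → p + p ≡ (1ℚ + (1ℚ + 0ℚ)) * p
  lemma = solve-∀ ℚ-ring

∣++∣ : ∀ {m n} (S : Subset m) (D : Subset n) → ∣ S Vec.++ D ∣ ≡ ∣ S ∣ +ⁿ ∣ D ∣
∣++∣ []            D = refl
∣++∣ (inside  ∷ S) D = cong suc (∣++∣ S D)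
∣++∣ (outside ∷ S) D = ∣++∣ S D

take-++ : ∀ {m n} (S : Subset m) (D : Subset n) → Vec.take m (S Vec.++ D) ≡ S
take-++ []      D = refl
take-++ (s ∷ S) D = cong (s ∷_) (take-++ S D)

∁-size : ∀ t {k} (K : Subset (t +ⁿ k)) → ∣ K ∣ ≡ k → ∣ ∁ K ∣ ≡ t
∁-size t {k} K ∣K∣≡k =
  trans (∣∁p∣≡n∸∣p∣ K) (trans (cong (t +ⁿ k ∸_) ∣K∣≡k) (ℕ.m+n∸n≡m t k))

-- Cliques, and the sub-tuples of a clique that cover a set

module Graph {t v : ℕ} (G : TGraph t v) where

  open DecMembership {A = Subset v} (≡-dec _≟ᵇ_) using (_∈?_)

  -- Vacuous below `t` vertices, so cliques can be grown one vertex at a time from small sets.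
  Clique : Subset v → Set
  Clique p = ∀ e → ∣ e ∣ ≡ t → e ⊆ˢ p → e ∈ TGraph.edges G

  clique? : ∀ p → Dec (Clique p)
  clique? p = map′ to from
    (All.all? (λ e → (e ⊆? p) →-dec (e ∈? TGraph.edges G)) (subsetsOfSize t v))
    where
    to : All.All (λ e → e ⊆ˢ p → e ∈ TGraph.edges G) (subsetsOfSize t v) → Clique p
    to all e ∣e∣≡t = All.lookup all (subsetsOfSize-complete e ∣e∣≡t)
    from : Clique p → All.All (λ e → e ⊆ˢ p → e ∈ TGraph.edges G) (subsetsOfSize t v)
    from cl = All.tabulate λ {e} e∈ →
      cl e (proj₂ (∈-filter⁻ (λ S → ∣ S ∣ ≟ⁿ t) {xs = subsets v} e∈))

  Clique-⊆ : ∀ {p q} → p ⊆ˢ q → Clique q → Clique p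
  Clique-⊆ p⊆q cl e ∣e∣≡t e⊆p = cl e ∣e∣≡t (p⊆q ∘ e⊆p)

  -- The entries of x are distinct, avoid p, and span a clique together with p.
  Ok : Subset v → List (Fin v) → Set
  Ok p []      = Clique p
  Ok p (a ∷ x) = a ∉ˢ p × Ok (p ∪ ⁅ a ⁆) x

  ok? : ∀ p x → Dec (Ok p x)
  ok? p []      = clique? p
  ok? p (a ∷ x) = ¬? (a ∈ˢ? p) ×-dec ok? (p ∪ ⁅ a ⁆) x

  Ok-⊑ : ∀ {p q x y} → x ⊑ y → p ⊆ˢ q → Ok q y → Ok p x
  Ok-⊑ []           p⊆q ok       = Clique-⊆ p⊆q ok
  Ok-⊑ {p = p} (a ∷ʳ x⊑y)   p⊆q (_ , ok) = Ok-⊑ {p = p} x⊑y (∈-insert-there a ∘ p⊆q) ok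
  Ok-⊑ {p = p} (refl ∷ x⊑y) p⊆q (a∉q , ok) = a∉q ∘ p⊆q , Ok-⊑ x⊑y (insert-mono {p = p} p⊆q) ok

  Ok⇒Clique : ∀ {p} x → Ok p x → Clique (span p x)
  Ok⇒Clique []      ok       = ok
  Ok⇒Clique (a ∷ x) (_ , ok) = Ok⇒Clique x ok

  ok?-++ : ∀ {p} x y → Ok p x → ind (ok? p (x ++ y)) ≡ ind (ok? (span p x) y)
  ok?-++ {p} x y ok = ind-cong (ok? p (x ++ y)) (ok? (span p x) y) (to x ok) (from x ok)
    where
    to : ∀ {p} x → Ok p x → Ok p (x ++ y) → Ok (span p x) y
    to []      _        ok′       = ok′
    to (a ∷ x) (_ , ok) (_ , ok′) = to x ok ok′
    from : ∀ {p} x → Ok p x → Ok (span p x) y → Ok p (x ++ y)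
    from []      _          ok′ = ok′
    from (a ∷ x) (a∉p , ok) ok′ = a∉p , from x ok ok′

  Ok⇒∈rest : ∀ {p T a} x → Ok p x → a ∈ˢ p → a ∈ˢ T → a ∈ˢ rest T x
  Ok⇒∈rest []      ok         a∈p a∈T = a∈T
  Ok⇒∈rest (b ∷ x) (b∉p , ok) a∈p a∈T =
    Ok⇒∈rest x ok (∈-insert-there b a∈p) (x∈p∧x≢y⇒x∈p-y a∈T λ { refl → b∉p a∈p })

  Ok⇒¬Covers : ∀ {p T a} x → Ok p x → a ∈ˢ p → a ∈ˢ T → ¬ Covers T x
  Ok⇒¬Covers x ok a∈p a∈T cov = ∣T∣≡0⇒∉ cov (Ok⇒∈rest x ok a∈p a∈T)

  -- The entries of `y` are distinct, so each vertex of `T` occupies exactly one position, which `K`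
  -- must contain. The other `length y ∸ ∣ T ∣` positions are free; choosing l of them gives the
  -- binomial weights of `Δ`.
  ∑-covering : ∀ {p} y T (g : ℕ → ℚ) → Ok p y → Covers T y →
    ∑ (subsets (length y)) (λ K → ind (covers? T (select K y)) * g ∣ K ∣) ≡
    Δ (length y ∸ ∣ T ∣) g ∣ T ∣
  ∑-covering [] T g ok cov = begin
    ind (covers? T []) * g 0 + 0ℚ  ≡⟨ ℚ.+-identityʳ (ind (covers? T []) * g 0) ⟩
    ind (covers? T []) * g 0       ≡⟨ cong (_* g 0) (ind-yes (covers? T []) cov) ⟩
    1ℚ * g 0                       ≡⟨ ℚ.*-identityˡ (g 0) ⟩
    g 0                            ≡⟨ cong (λ m → Δ (0 ∸ m) g m) cov ⟨
    Δ (0 ∸ ∣ T ∣) g ∣ T ∣          ∎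
    where open ≡-Reasoning
  ∑-covering (a ∷ y) T g (a∉p , ok) cov with a ∈ˢ? T
  ... | yes a∈T = begin
    ∑ (subsets (suc n)) (λ K → ind (covers? T (select K (a ∷ y))) * g ∣ K ∣)
      ≡⟨ ∑-subsets-suc n (λ K → ind (covers? T (select K (a ∷ y))) * g ∣ K ∣) ⟩
    ∑ (subsets n) (λ K → ind (covers? (T ∖ a) (select K y)) * g (suc ∣ K ∣)) +
    ∑ (subsets n) (λ K → ind (covers? T (select K y)) * g ∣ K ∣)
      ≡⟨ cong₂ _+_ (∑-covering y (T ∖ a) (g ∘ suc) ok cov)
           (∑-zero (subsets n) λ {K} _ → trans
             (cong (_* g ∣ K ∣) (ind-no (covers? T (select K y))
               (Ok⇒¬Covers y ok (∈-insert-here _ a) a∈T ∘ Covers-⊑ {T = T} (select-⊑ K y))))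
             (ℚ.*-zeroˡ (g ∣ K ∣))) ⟩
    Δ (n ∸ ∣ T ∖ a ∣) (g ∘ suc) ∣ T ∖ a ∣ + 0ℚ
      ≡⟨ ℚ.+-identityʳ (Δ (n ∸ ∣ T ∖ a ∣) (g ∘ suc) ∣ T ∖ a ∣) ⟩
    Δ (n ∸ ∣ T ∖ a ∣) (g ∘ suc) ∣ T ∖ a ∣
      ≡⟨ Δ-∘suc (n ∸ ∣ T ∖ a ∣) g ∣ T ∖ a ∣ ⟩
    Δ (n ∸ ∣ T ∖ a ∣) g (suc ∣ T ∖ a ∣)
      ≡⟨ cong (λ m → Δ (suc n ∸ m) g m) (∣T∣≡1+∣T∖a∣ a∈T) ⟨
    Δ (suc n ∸ ∣ T ∣) g ∣ T ∣ ∎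
    where
    open ≡-Reasoning
    n = length y
  ... | no a∉T = begin
    ∑ (subsets (suc n)) (λ K → ind (covers? T (select K (a ∷ y))) * g ∣ K ∣)
      ≡⟨ ∑-subsets-suc n (λ K → ind (covers? T (select K (a ∷ y))) * g ∣ K ∣) ⟩
    ∑ (subsets n) (λ K → ind (covers? (T ∖ a) (select K y)) * g (suc ∣ K ∣)) +
    ∑ (subsets n) (λ K → ind (covers? T (select K y)) * g ∣ K ∣)
      ≡⟨ cong₂ _+_
           (trans (cong (λ T′ → ∑ (subsets n) (λ K → ind (covers? T′ (select K y)) * g (suc ∣ K ∣))) T∖a≡T)
                  (∑-covering y T (g ∘ suc) ok cov′))
           (∑-covering y T g ok cov′) ⟩
    Δ (n ∸ ∣ T ∣) (g ∘ suc) ∣ T ∣ + Δ (n ∸ ∣ T ∣) g ∣ T ∣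
      ≡⟨ ℚ.+-comm (Δ (n ∸ ∣ T ∣) (g ∘ suc) ∣ T ∣) (Δ (n ∸ ∣ T ∣) g ∣ T ∣) ⟩
    Δ (n ∸ ∣ T ∣) g ∣ T ∣ + Δ (n ∸ ∣ T ∣) (g ∘ suc) ∣ T ∣
      ≡⟨ Δ-+ (n ∸ ∣ T ∣) g (g ∘ suc) ∣ T ∣ ⟨
    Δ (suc (n ∸ ∣ T ∣)) g ∣ T ∣
      ≡⟨ cong (λ r → Δ r g ∣ T ∣) (ℕ.+-∸-assoc 1 (Covers⇒∣∣≤length y cov′)) ⟨
    Δ (suc n ∸ ∣ T ∣) g ∣ T ∣ ∎
    where
    open ≡-Reasoning
    n = length y
    T∖a≡T : T ∖ a ≡ T
    T∖a≡T = a∉T⇒T∖a≡T a∉T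
    cov′ : Covers T y
    cov′ = subst (λ T′ → Covers T′ y) T∖a≡T cov

  -- The same count with separate sizes in the two blocks: `i` vertices of `T` have their position
  -- forced in `τ`, the vertices of `rest T τ` have theirs forced in `z`, and the free positions of
  -- each block contribute their own `Δ`.
  ∑-covering₂ : ∀ {p} τ z T → Ok p (τ ++ z) → Covers T (τ ++ z) →
    ∃[ i ] (i +ⁿ ∣ rest T τ ∣ ≡ ∣ T ∣ × i ≤ⁿ length τ × (∀ (g : ℕ → ℕ → ℚ) →
      ∑ (subsets (length τ)) (λ S → ∑ (subsets (length z)) (λ D →
        ind (covers? T (select S τ ++ select D z)) * g ∣ S ∣ ∣ D ∣)) ≡
      Δ (length τ ∸ i) (λ s → Δ (length z ∸ ∣ rest T τ ∣) (g s) ∣ rest T τ ∣) i))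
  ∑-covering₂ [] z T ok cov = 0 , refl , z≤n , λ g →
    trans (ℚ.+-identityʳ (∑ (subsets (length z)) (λ D → ind (covers? T (select D z)) * g 0 ∣ D ∣)))
          (∑-covering z T (g 0) ok cov)
  ∑-covering₂ (a ∷ τ) z T (a∉p , ok) cov with ∑-covering₂ τ z (T ∖ a) ok cov | a ∈ˢ? T
  ... | i , i+j≡ , i≤ , eq | yes a∈T =
    suc i , trans (cong suc i+j≡) (sym (∣T∣≡1+∣T∖a∣ a∈T)) , s≤s i≤ , λ g → begin
      ∑ (subsets (suc m)) (F g)
        ≡⟨ ∑-subsets-suc m (F g) ⟩
      ∑ (subsets m) (F g ∘ (inside ∷_)) + ∑ (subsets m) (F g ∘ (outside ∷_))
        ≡⟨ cong₂ _+_ (eq (g ∘ suc)) (∑-zero (subsets m) λ {S} _ → ∑-zero (subsets n) λ {D} _ → zero-term g S D) ⟩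
      Δ (m ∸ i) (λ s → Δ (n ∸ j) (g (suc s)) j) i + 0ℚ
        ≡⟨ ℚ.+-identityʳ (Δ (m ∸ i) (λ s → Δ (n ∸ j) (g (suc s)) j) i) ⟩
      Δ (m ∸ i) (λ s → Δ (n ∸ j) (g (suc s)) j) i
        ≡⟨ Δ-∘suc (m ∸ i) (λ s → Δ (n ∸ j) (g s) j) i ⟩
      Δ (m ∸ i) (λ s → Δ (n ∸ j) (g s) j) (suc i) ∎
    where
    open ≡-Reasoning
    m = length τ
    n = length z
    j = ∣ rest (T ∖ a) τ ∣
    F : (ℕ → ℕ → ℚ) → Subset (suc m) → ℚ
    F g S = ∑ (subsets n) (λ D → ind (covers? T (select S (a ∷ τ) ++ select D z)) * g ∣ S ∣ ∣ D ∣)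
    zero-term : ∀ g S D → ind (covers? T (select S τ ++ select D z)) * g ∣ S ∣ ∣ D ∣ ≡ 0ℚ
    zero-term g S D = trans
      (cong (_* g ∣ S ∣ ∣ D ∣) (ind-no (covers? T (select S τ ++ select D z))
        (Ok⇒¬Covers (τ ++ z) ok (∈-insert-here _ a) a∈T ∘ Covers-⊑ {T = T} (++⁺ (select-⊑ S τ) (select-⊑ D z)))))
      (ℚ.*-zeroˡ (g ∣ S ∣ ∣ D ∣))
  ... | i , i+j≡ , i≤ , eq | no a∉T =
    i , trans i+j≡ (cong ∣_∣ T∖a≡T) , ℕ.m≤n⇒m≤1+n i≤ , λ g → begin
      ∑ (subsets (suc m)) (F g)
        ≡⟨ ∑-subsets-suc m (F g) ⟩
      ∑ (subsets m) (F g ∘ (inside ∷_)) + ∑ (subsets m) (F g ∘ (outside ∷_))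
        ≡⟨ cong₂ _+_ (eq (g ∘ suc)) (trans (cong (F′ g) (sym T∖a≡T)) (eq g)) ⟩
      Δ (m ∸ i) (H g ∘ suc) i + Δ (m ∸ i) (H g) i
        ≡⟨ ℚ.+-comm (Δ (m ∸ i) (H g ∘ suc) i) (Δ (m ∸ i) (H g) i) ⟩
      Δ (m ∸ i) (H g) i + Δ (m ∸ i) (H g ∘ suc) i
        ≡⟨ Δ-+ (m ∸ i) (H g) (H g ∘ suc) i ⟨
      Δ (suc (m ∸ i)) (H g) i
        ≡⟨ cong (λ r → Δ r (H g) i) (ℕ.+-∸-assoc 1 i≤) ⟨
      Δ (suc m ∸ i) (H g) i ∎
    where
    open ≡-Reasoning
    m = length τ
    n = length z
    j = ∣ rest (T ∖ a) τ ∣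
    T∖a≡T : T ∖ a ≡ T
    T∖a≡T = a∉T⇒T∖a≡T a∉T
    H : (ℕ → ℕ → ℚ) → ℕ → ℚ
    H g s = Δ (n ∸ j) (g s) j
    F : (ℕ → ℕ → ℚ) → Subset (suc m) → ℚ
    F g S = ∑ (subsets n) (λ D → ind (covers? T (select S (a ∷ τ) ++ select D z)) * g ∣ S ∣ ∣ D ∣)
    F′ : (ℕ → ℕ → ℚ) → Subset v → ℚ
    F′ g T′ = ∑ (subsets m) (λ S → ∑ (subsets n) (λ D →
      ind (covers? T′ (select S τ ++ select D z)) * g ∣ S ∣ ∣ D ∣))

-- The signed weights on the k-subsets of a (t + k)-clique

-- `K` is a set of positions in a (t + k)-tuple whose first `t` entries form the edge to be
-- repaired, so `Vec.take t K` stands for the intersection of the k-subset with that edge. The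
-- indicator allows sums over all sets of positions, without restriction on size.
schemeWeight : ∀ t k → (ℕ → ℚ) → Subset (t +ⁿ k) → ℚ
schemeWeight t k φ K = φ ∣ Vec.take t K ∣ * ind (∣ K ∣ ≟ⁿ k)

schemeWeight-++ : ∀ t k φ (S : Subset t) (D : Subset k) →
                  schemeWeight t k φ (S Vec.++ D) ≡ φ ∣ S ∣ * ind (∣ S ∣ +ⁿ ∣ D ∣ ≟ⁿ k)
schemeWeight-++ t k φ S D =
  cong₂ (λ S′ m → φ ∣ S′ ∣ * ind (m ≟ⁿ k)) (take-++ S D) (∣++∣ S D)

∑-layer : ∀ k s → ∑ (subsets k) (λ D → ind (s +ⁿ ∣ D ∣ ≟ⁿ k)) ≡ bin k s
∑-layer k s = trans (∑-subsets-size k (λ d → ind (s +ⁿ d ≟ⁿ k))) (Δ-layer k 0 s)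

module _ {t k : ℕ} {φ : ℕ → ℚ} (iso : Isolating t k φ) where

  open Isolating iso

  -- Of the k-subsets, C(k , s) meet the repaired edge in a given s-set, so `bounded` limits each of
  -- the 2^t possible intersections to a contribution of at most 1.
  ∑-∣schemeWeight∣ : ∑ (subsets (t +ⁿ k)) (λ K → abs (schemeWeight t k φ K)) ≤ pow (ι 2) t
  ∑-∣schemeWeight∣ = ℚ.≤-trans (ℚ.≤-reflexive (trans
      (∑-subsets-++ t k (λ K → abs (schemeWeight t k φ K)))
      (∑-cong (subsets t) λ {S} _ → row S)))
    (subst (∑ (subsets t) (λ S → abs (φ ∣ S ∣) * bin k ∣ S ∣) ≤_) (∑-subsets-1 t)
      (∑-mono (subsets t) λ {S} _ → bounded ∣ S ∣ (∣p∣≤n S)))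
    where
    open ≡-Reasoning
    row : ∀ S → ∑ (subsets k) (λ D → abs (schemeWeight t k φ (S Vec.++ D))) ≡ abs (φ ∣ S ∣) * bin k ∣ S ∣
    row S = begin
      ∑ (subsets k) (λ D → abs (schemeWeight t k φ (S Vec.++ D)))
        ≡⟨ ∑-cong (subsets k) (λ {D} _ → trans (cong abs (schemeWeight-++ t k φ S D))
             (trans (ℚ.∣p*q∣≡∣p∣*∣q∣ (φ ∣ S ∣) (ind (∣ S ∣ +ⁿ ∣ D ∣ ≟ⁿ k)))
               (cong (abs (φ ∣ S ∣) *_) (ℚ.0≤p⇒∣p∣≡p (ind-nonNeg (∣ S ∣ +ⁿ ∣ D ∣ ≟ⁿ k)))))) ⟩
      ∑ (subsets k) (λ D → abs (φ ∣ S ∣) * ind (∣ S ∣ +ⁿ ∣ D ∣ ≟ⁿ k))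
        ≡⟨ ∑-*ˡ (subsets k) (abs (φ ∣ S ∣)) (λ D → ind (∣ S ∣ +ⁿ ∣ D ∣ ≟ⁿ k)) ⟩
      abs (φ ∣ S ∣) * ∑ (subsets k) (λ D → ind (∣ S ∣ +ⁿ ∣ D ∣ ≟ⁿ k))
        ≡⟨ cong (abs (φ ∣ S ∣) *_) (∑-layer k ∣ S ∣) ⟩
      abs (φ ∣ S ∣) * bin k ∣ S ∣ ∎

  -- Here an edge has `i` vertices in the repaired edge and `j` outside. A k-subset containing it
  -- takes s vertices of the repaired edge, in C(t - i , s - i) ways with t - i = j, and k - s of
  -- the others, `j` of them prescribed, in C(k - j , k - s - j) = C(k - j , s) ways. This is the
  -- sum in `vanishes` for j > 0, and the single term of `isolates` for j = 0.
  Δ-isolating : ∀ i j → i +ⁿ j ≡ t → j ≤ⁿ k →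
    Δ (t ∸ i) (λ s → Δ (k ∸ j) (λ d → φ s * ind (s +ⁿ d ≟ⁿ k)) j) i ≡ ind (j ≟ⁿ 0)
  Δ-isolating i j i+j≡t j≤k = begin
    Δ (t ∸ i) (λ s → Δ (k ∸ j) (λ d → φ s * ind (s +ⁿ d ≟ⁿ k)) j) i
      ≡⟨ Δ-cong (t ∸ i) i (λ s _ _ → inner s) ⟩
    Δ (t ∸ i) (λ s → φ s * bin (k ∸ j) s) i
      ≡⟨ cong (λ r → Δ r (λ s → φ s * bin (k ∸ j) s) i)
           (trans (cong (_∸ i) (sym i+j≡t)) (ℕ.m+n∸m≡n i j)) ⟩
    Δ j (λ s → φ s * bin (k ∸ j) s) i
      ≡⟨ cong (Δ j (λ s → φ s * bin (k ∸ j) s)) (trans (sym (ℕ.m+n∸n≡m i j)) (cong (_∸ j) i+j≡t)) ⟩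
    Δ j (λ s → φ s * bin (k ∸ j) s) (t ∸ j)
      ≡⟨ outer j (subst (j ≤ⁿ_) i+j≡t (ℕ.m≤n+m j i)) ⟩
    ind (j ≟ⁿ 0) ∎
    where
    open ≡-Reasoning
    inner : ∀ s → Δ (k ∸ j) (λ d → φ s * ind (s +ⁿ d ≟ⁿ k)) j ≡ φ s * bin (k ∸ j) s
    inner s = trans (Δ-*ˡ (k ∸ j) (φ s) (λ d → ind (s +ⁿ d ≟ⁿ k)) j)
      (cong (φ s *_) (trans
        (cong (λ m → Δ (k ∸ j) (λ d → ind (s +ⁿ d ≟ⁿ m)) j) (sym (ℕ.m+[n∸m]≡n j≤k)))
        (Δ-layer (k ∸ j) j s)))
    outer : ∀ j → j ≤ⁿ t → Δ j (λ s → φ s * bin (k ∸ j) s) (t ∸ j) ≡ ind (j ≟ⁿ 0)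
    outer zero    _   = isolates
    outer (suc r) r<t = vanishes r r<t

  module _ {v : ℕ} (G : TGraph t v) where

    open Graph G

    -- The repaired edge is the one listed by `τ`, and `T` is the edge at which the total is read
    -- off. If the whole tuple fails to cover `T`, no sub-tuple covers it and both sides are 0;
    -- otherwise `∑-covering₂` reduces the sum to `Δ-isolating`.
    ∑-isolating : ∀ {p} τ z T → length τ ≡ t → length z ≡ k → t ≤ⁿ k → ∣ T ∣ ≡ t → Ok p (τ ++ z) →
      ∑ (subsets (t +ⁿ k)) (λ K → schemeWeight t k φ K * ind (covers? T (select K (τ ++ z)))) ≡
      ind (covers? T τ)
    ∑-isolating {p} τ z T refl refl t≤k ∣T∣≡t ok = begin
      ∑ (subsets (t +ⁿ k)) (λ K → schemeWeight t k φ K * ind (covers? T (select K (τ ++ z))))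
        ≡⟨ ∑-subsets-++ t k (λ K → schemeWeight t k φ K * ind (covers? T (select K (τ ++ z)))) ⟩
      ∑ (subsets t) (λ S → ∑ (subsets k) (λ D →
        schemeWeight t k φ (S Vec.++ D) * ind (covers? T (select (S Vec.++ D) (τ ++ z)))))
        ≡⟨ ∑-cong (subsets t) (λ {S} _ → ∑-cong (subsets k) (λ {D} _ → term S D)) ⟩
      ∑ (subsets t) (λ S → ∑ (subsets k) (λ D →
        ind (covers? T (select S τ ++ select D z)) * g ∣ S ∣ ∣ D ∣))
        ≡⟨ total (covers? T (τ ++ z)) ⟩
      ind (covers? T τ) ∎
      where
      open ≡-Reasoning
      g : ℕ → ℕ → ℚ
      g s d = φ s * ind (s +ⁿ d ≟ⁿ k)
      term : ∀ S D → schemeWeight t k φ (S Vec.++ D) * ind (covers? T (select (S Vec.++ D) (τ ++ z))) ≡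
                     ind (covers? T (select S τ ++ select D z)) * g ∣ S ∣ ∣ D ∣
      term S D = trans
        (cong₂ (λ x y → x * ind (covers? T y)) (schemeWeight-++ t k φ S D) (select-++ S D τ z refl))
        (ℚ.*-comm (g ∣ S ∣ ∣ D ∣) (ind (covers? T (select S τ ++ select D z))))
      total : Dec (Covers T (τ ++ z)) →
        ∑ (subsets t) (λ S → ∑ (subsets k) (λ D →
          ind (covers? T (select S τ ++ select D z)) * g ∣ S ∣ ∣ D ∣)) ≡ ind (covers? T τ)
      total (yes cov) with ∑-covering₂ τ z T ok cov
      ... | i , i+j≡∣T∣ , i≤t , eq = trans (eq g) (Δ-isolating i ∣ rest T τ ∣ i+j≡t
          (ℕ.≤-trans (subst (∣ rest T τ ∣ ≤ⁿ_) i+j≡t (ℕ.m≤n+m _ i)) t≤k))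
        where
        i+j≡t = trans i+j≡∣T∣ ∣T∣≡t
      total (no ¬cov) = trans
        (∑-zero (subsets t) λ {S} _ → ∑-zero (subsets k) λ {D} _ → trans
          (cong (_* g ∣ S ∣ ∣ D ∣) (ind-no (covers? T (select S τ ++ select D z))
            (¬cov ∘ Covers-⊑ {T = T} (++⁺ (select-⊑ S τ) (select-⊑ D z)))))
          (ℚ.*-zeroˡ (g ∣ S ∣ ∣ D ∣)))
        (sym (ind-no (covers? T τ) (¬cov ∘ Covers-⊑ {T = T} {τ} (++⁺ʳ z ⊆-refl))))

-- Counting covering cliques

-- Revealing an m-tuple entry by entry, with q choices for each entry outside a
-- given s-set, L q m s counts the tuples that cover the set.

L : ℚ → ℕ → ℕ → ℚ
L q zero    zero    = 1ℚ
L q zero    (suc s) = 0ℚ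
L q (suc m) zero    = q * L q m zero
L q (suc m) (suc s) = ι (suc s) * L q m s + q * L q m (suc s)

-- A uniform form of the recursion: at s = 0 the truncated `s ∸ 1` is a junk argument, but its
-- coefficient `ι s` is 0.
L-suc : ∀ q m s → L q (suc m) s ≡ ι s * L q m (s ∸ 1) + q * L q m s
L-suc q m zero    = lemma (L q m 0) q
  where
  lemma : ∀ x q → q * x ≡ 0ℚ * x + q * x
  lemma = solve-∀ ℚ-ring
L-suc q m (suc s) = refl

L-pow : ∀ q m → L q m 0 ≡ pow q m
L-pow q zero    = refl
L-pow q (suc m) = cong (q *_) (L-pow q m)

L-vanishes : ∀ q {m s} → m <ⁿ s → L q m s ≡ 0ℚ
L-vanishes q {zero}  {suc s} _         = refl
L-vanishes q {suc m} {suc s} (s≤s m<s) = trans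
  (cong₂ (λ x y → ι (suc s) * x + q * y) (L-vanishes q m<s) (L-vanishes q (ℕ.m<n⇒m<1+n m<s)))
  (lemma (ι (suc s)) q)
  where
  lemma : ∀ x y → x * 0ℚ + y * 0ℚ ≡ 0ℚ
  lemma = solve-∀ ℚ-ring

module _ {q : ℚ} (0≤q : 0ℚ ≤ q) where

  L-nonNeg : ∀ m s → 0ℚ ≤ L q m s
  L-nonNeg zero    zero    = 0≤1
  L-nonNeg zero    (suc s) = ℚ.≤-refl
  L-nonNeg (suc m) zero    = 0≤* 0≤q (L-nonNeg m zero)
  L-nonNeg (suc m) (suc s) = 0≤+ (0≤* (ι-nonNeg (suc s)) (L-nonNeg m s)) (0≤* 0≤q (L-nonNeg m (suc s)))

  1≤L : ∀ m → 1ℚ ≤ L q m m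
  1≤L zero    = ℚ.≤-refl
  1≤L (suc m) = ℚ.≤-trans (*-mono-≤ 0≤1 (L-nonNeg m m) (1≤ι-suc m) (1≤L m))
    (p≤p+q (0≤* 0≤q (L-nonNeg m (suc m))))

  -- For s ≤ m the recursion has the closed form m (m - 1) ... (m - s + 1) q^(m - s): positions for
  -- the `s` vertices, then free entries. Bounding the falling factorial by m^s and multiplying by
  -- q^s gives the claim without a subtraction in the exponent.
  L-upper : ∀ m s → L q m s * pow q s ≤ pow (ι m) s * pow q m
  L-upper zero    zero    = ℚ.≤-refl
  L-upper zero    (suc s) = ℚ.≤-reflexive (lemma (pow q (suc s)) (pow (ι 0) s))
    where
    lemma : ∀ x y → 0ℚ * x ≡ 0ℚ * y * 1ℚ
    lemma = solve-∀ ℚ-ring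
  L-upper (suc m) zero    = ℚ.≤-reflexive
    (trans (cong (λ x → q * x * 1ℚ) (L-pow q m)) (lemma q (pow q m)))
    where
    lemma : ∀ q x → q * x * 1ℚ ≡ 1ℚ * (q * x)
    lemma = solve-∀ ℚ-ring
  L-upper (suc m) (suc s) = begin
    (c * L q m s + q * L q m (suc s)) * (q * pow q s)
      ≡⟨ split c q (L q m s) (L q m (suc s)) (pow q s) ⟩
    c * q * (L q m s * pow q s) + q * (L q m (suc s) * (q * pow q s))
      ≤⟨ ℚ.+-mono-≤ (*-monoʳ-≤ (0≤* (ι-nonNeg (suc s)) 0≤q) (L-upper m s)) (*-monoʳ-≤ 0≤q (L-upper m (suc s))) ⟩
    c * q * (pow M s * pow q m) + q * (M * pow M s * pow q m)
      ≡⟨ join c q M (pow M s) (pow q m) ⟩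
    (M * pow M s + c * pow M s) * (q * pow q m)
      ≤⟨ *-monoˡ-≤ (pow-nonNeg (suc m) 0≤q) (binomial-≤ s) ⟩
    pow (1ℚ + M) (suc s) * (q * pow q m) ∎
    where
    open ℚ.≤-Reasoning
    c M : ℚ
    c = ι (suc s)
    M = ι m
    split : ∀ c q a b p → (c * a + q * b) * (q * p) ≡ c * q * (a * p) + q * (b * (q * p))
    split = solve-∀ ℚ-ring
    join : ∀ c q M x y → c * q * (x * y) + q * (M * x * y) ≡ (M * x + c * x) * (q * y)
    join = solve-∀ ℚ-ring
    -- The left side is the first two terms in the expansion of (M + 1)^(s + 1).
    binomial-≤ : ∀ s → M * pow M s + ι (suc s) * pow M s ≤ pow (1ℚ + M) (suc s)
    binomial-≤ zero    = ℚ.≤-reflexive (lemma M)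
      where
      lemma : ∀ M → M * 1ℚ + (1ℚ + 0ℚ) * 1ℚ ≡ (1ℚ + M) * 1ℚ
      lemma = solve-∀ ℚ-ring
    binomial-≤ (suc s) = ℚ.≤-trans
      (subst (M * (M * x) + (1ℚ + d) * (M * x) ≤_) (lemma M x d)
        (p≤p+q (0≤* (ι-nonNeg (suc s)) (pow-nonNeg s (ι-nonNeg m)))))
      (*-monoʳ-≤ (ι-nonNeg (suc m)) (binomial-≤ s))
      where
      x d : ℚ
      x = pow M s
      d = ι (suc s)
      lemma : ∀ M x d → M * (M * x) + (1ℚ + d) * (M * x) + d * x ≡ (1ℚ + M) * (M * x + d * x)
      lemma = solve-∀ ℚ-ring

  -- Only the m - s free entries depend on `q`, so scaling `q` by `u` costs u^(m - s), which is at
  -- least u^m.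
  L-scale : ∀ {u} → 0ℚ ≤ u → u ≤ 1ℚ → ∀ m s → pow u m * L q m s ≤ L (u * q) m s
  L-scale 0≤u u≤1 zero zero    = ℚ.≤-refl
  L-scale 0≤u u≤1 zero (suc s) = ℚ.≤-refl
  L-scale {u} 0≤u u≤1 (suc m) zero = ℚ.≤-trans
    (ℚ.≤-reflexive (lemma u (pow u m) q (L q m 0)))
    (*-monoʳ-≤ (0≤* 0≤u 0≤q) (L-scale 0≤u u≤1 m zero))
    where
    lemma : ∀ u x q y → u * x * (q * y) ≡ u * q * (x * y)
    lemma = solve-∀ ℚ-ring
  L-scale {u} 0≤u u≤1 (suc m) (suc s) = begin
    u * P * (c * A + q * B)              ≡⟨ lemma u P c A q B ⟩
    c * (u * (P * A)) + u * q * (P * B)  ≤⟨ ℚ.+-monoˡ-≤ (u * q * (P * B)) (*-monoʳ-≤ (ι-nonNeg (suc s))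
                                              (*-monoˡ-≤ (0≤* (pow-nonNeg m 0≤u) (L-nonNeg m s)) u≤1)) ⟩
    c * (1ℚ * (P * A)) + u * q * (P * B) ≡⟨ cong (λ x → c * x + u * q * (P * B)) (ℚ.*-identityˡ (P * A)) ⟩
    c * (P * A) + u * q * (P * B)        ≤⟨ ℚ.+-mono-≤ (*-monoʳ-≤ (ι-nonNeg (suc s)) (L-scale 0≤u u≤1 m s))
                                              (*-monoʳ-≤ (0≤* 0≤u 0≤q) (L-scale 0≤u u≤1 m (suc s))) ⟩
    L (u * q) (suc m) (suc s)            ∎
    where
    open ℚ.≤-Reasoning
    P c A B : ℚ
    P = pow u m
    c = ι (suc s)
    A = L q m s
    B = L q m (suc s)
    lemma : ∀ u P c A q B → u * P * (c * A + q * B) ≡ c * (u * (P * A)) + u * q * (P * B)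
    lemma = solve-∀ ℚ-ring

L-pos : ∀ {q} → 0ℚ < q → ∀ {m s} → s ≤ⁿ m → 0ℚ < L q m s
L-pos 0<q {m} {zero} z≤n = subst (0ℚ <_) (sym (L-pow _ m)) (pow-pos m 0<q)
L-pos 0<q {suc m} {suc s} (s≤s s≤m) = ℚ.<-≤-trans
  (0<* (ι-suc-pos s) (L-pos 0<q s≤m))
  (p≤p+q (0≤* (ℚ.<⇒≤ 0<q) (L-nonNeg (ℚ.<⇒≤ 0<q) m (suc s))))

bernoulli : ∀ {β} → 0ℚ ≤ β → β ≤ 1ℚ → ∀ n → 1ℚ - ι n * β ≤ pow (1ℚ - β) n
bernoulli {β} 0≤β β≤1 zero    = ℚ.≤-reflexive (lemma β)
  where
  lemma : ∀ β → 1ℚ - 0ℚ * β ≡ 1ℚ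
  lemma = solve-∀ ℚ-ring
bernoulli {β} 0≤β β≤1 (suc n) = ℚ.≤-trans
  (subst (1ℚ - (1ℚ + ι n) * β ≤_) (lemma β (ι n)) (p≤p+q (0≤* (0≤* 0≤β 0≤β) (ι-nonNeg n))))
  (*-monoʳ-≤ (p≤q⇒0≤q-p β≤1) (bernoulli 0≤β β≤1 n))
  where
  lemma : ∀ β c → 1ℚ - (1ℚ + c) * β + β * β * c ≡ (1ℚ - β) * (1ℚ - c * β)
  lemma = solve-∀ ℚ-ring

module Counting {t v : ℕ} (G : TGraph t v) where

  open Graph G

  -- Tuples are ordered: for an edge `T`, `count ⊥ T k` is k! times the number of k-cliques through
  -- `T`, and `count ⊥ T t` is the number t! of orderings of `T`.
  count : Subset v → Subset v → ℕ → ℚ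
  count p T m = ∑ (words v m) (λ x → ind (ok? p x) * ind (covers? T x))

  count-nonNeg : ∀ p T m → 0ℚ ≤ count p T m
  count-nonNeg p T m = ∑-nonNeg (words v m) λ {x} _ → 0≤* (ind-nonNeg (ok? p x)) (ind-nonNeg (covers? T x))

  count-suc : ∀ p T m →
    count p T (suc m) ≡ ∑ (allFin v) (λ a → ind (¬? (a ∈ˢ? p)) * count (p ∪ ⁅ a ⁆) (T ∖ a) m)
  count-suc p T m = trans
    (∑-words-suc m (λ x → ind (ok? p x) * ind (covers? T x)))
    (∑-cong (allFin v) λ {a} _ → trans
      (∑-cong (words v m) λ {x} _ → trans
        (cong (_* ind (covers? (T ∖ a) x)) (ind-× (¬? (a ∈ˢ? p)) (ok? (p ∪ ⁅ a ⁆) x)))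
        (ℚ.*-assoc (ind (¬? (a ∈ˢ? p))) (ind (ok? (p ∪ ⁅ a ⁆) x)) (ind (covers? (T ∖ a) x))))
      (∑-*ˡ (words v m) (ind (¬? (a ∈ˢ? p)))
        (λ x → ind (ok? (p ∪ ⁅ a ⁆) x) * ind (covers? (T ∖ a) x))))

  count-zero : ∀ p T → count p T 0 ≡ ind (clique? p) * ind (∣ T ∣ ≟ⁿ 0)
  count-zero p T = ℚ.+-identityʳ (ind (clique? p) * ind (∣ T ∣ ≟ⁿ 0))

  ∑-∈ : ∀ (T : Subset v) c → ∑ (allFin v) (λ a → ind (a ∈ˢ? T) * c) ≡ ι ∣ T ∣ * c
  ∑-∈ T c = trans (∑-*ʳ (allFin v) c (λ a → ind (a ∈ˢ? T))) (cong (_* c) (sym (ι∣S∣≡∑ T)))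

  ∑-allFin-const : ∀ c → ∑ (allFin v) (λ _ → c) ≡ ι v * c
  ∑-allFin-const c =
    trans (∑-const (allFin v) c) (cong (λ n → ι n * c) (length-tabulate {n = v} (λ a → a)))

  -- The next entry either lies in `T`, which leaves one vertex fewer to cover, or is one of at most
  -- `v` vertices. Dropping the clique condition and charging the entries of `T` to both cases
  -- yields exactly the recursion of `L`.
  count-upper : ∀ m p T → count p T m ≤ L (ι v) m ∣ T ∣
  count-upper zero p T = subst (_≤ L (ι v) 0 ∣ T ∣) (sym (count-zero p T)) (base ∣ T ∣)
    where
    base : ∀ s → ind (clique? p) * ind (s ≟ⁿ 0) ≤ L (ι v) 0 s
    base zero    = *-mono-≤ (ind-nonNeg (clique? p)) 0≤1 (ind-≤1 (clique? p)) ℚ.≤-refl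
    base (suc s) = ℚ.≤-reflexive (ℚ.*-zeroʳ (ind (clique? p)))
  count-upper (suc m) p T = begin
    count p T (suc m)
      ≡⟨ count-suc p T m ⟩
    ∑ (allFin v) (λ a → ind (¬? (a ∈ˢ? p)) * count (p ∪ ⁅ a ⁆) (T ∖ a) m)
      ≤⟨ ∑-mono (allFin v) (λ {a} _ → step a) ⟩
    ∑ (allFin v) (λ a → ind (a ∈ˢ? T) * l (∣ T ∣ ∸ 1) + l ∣ T ∣)
      ≡⟨ ∑-+ (allFin v) (λ a → ind (a ∈ˢ? T) * l (∣ T ∣ ∸ 1)) (λ _ → l ∣ T ∣) ⟩
    ∑ (allFin v) (λ a → ind (a ∈ˢ? T) * l (∣ T ∣ ∸ 1)) + ∑ (allFin v) (λ _ → l ∣ T ∣)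
      ≡⟨ cong₂ _+_ (∑-∈ T (l (∣ T ∣ ∸ 1))) (∑-allFin-const (l ∣ T ∣)) ⟩
    ι ∣ T ∣ * l (∣ T ∣ ∸ 1) + ι v * l ∣ T ∣
      ≡⟨ L-suc (ι v) m ∣ T ∣ ⟨
    L (ι v) (suc m) ∣ T ∣ ∎
    where
    open ℚ.≤-Reasoning
    l : ℕ → ℚ
    l = L (ι v) m
    0≤l : ∀ s → 0ℚ ≤ l s
    0≤l = L-nonNeg (ι-nonNeg v) m
    lemma : ∀ x y → x ≡ 0ℚ * y + x
    lemma = solve-∀ ℚ-ring
    bound : ∀ a → l ∣ T ∖ a ∣ ≤ ind (a ∈ˢ? T) * l (∣ T ∣ ∸ 1) + l ∣ T ∣
    bound a = case a ∈ˢ? T of λ where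
      (yes a∈T) → subst (λ x → l ∣ T ∖ a ∣ ≤ x * l (∣ T ∣ ∸ 1) + l ∣ T ∣) (sym (ind-yes (a ∈ˢ? T) a∈T))
        (subst (λ s → l ∣ T ∖ a ∣ ≤ 1ℚ * l (s ∸ 1) + l ∣ T ∣) (sym (∣T∣≡1+∣T∖a∣ a∈T))
          (subst (λ x → l ∣ T ∖ a ∣ ≤ x + l ∣ T ∣) (sym (ℚ.*-identityˡ (l ∣ T ∖ a ∣))) (p≤p+q (0≤l ∣ T ∣))))
      (no a∉T) → subst (λ x → l ∣ T ∖ a ∣ ≤ x * l (∣ T ∣ ∸ 1) + l ∣ T ∣) (sym (ind-no (a ∈ˢ? T) a∉T))
        (ℚ.≤-reflexive (trans (cong (l ∘ ∣_∣) (a∉T⇒T∖a≡T a∉T)) (lemma (l ∣ T ∣) (l (∣ T ∣ ∸ 1)))))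
    step : ∀ a → ind (¬? (a ∈ˢ? p)) * count (p ∪ ⁅ a ⁆) (T ∖ a) m ≤
                 ind (a ∈ˢ? T) * l (∣ T ∣ ∸ 1) + l ∣ T ∣
    step a = begin
      ind (¬? (a ∈ˢ? p)) * count (p ∪ ⁅ a ⁆) (T ∖ a) m
        ≤⟨ *-mono-≤ (ind-nonNeg (¬? (a ∈ˢ? p))) (0≤l ∣ T ∖ a ∣) (ind-≤1 (¬? (a ∈ˢ? p)))
             (count-upper m (p ∪ ⁅ a ⁆) (T ∖ a)) ⟩
      1ℚ * l ∣ T ∖ a ∣
        ≡⟨ ℚ.*-identityˡ (l ∣ T ∖ a ∣) ⟩
      l ∣ T ∖ a ∣
        ≤⟨ bound a ⟩
      ind (a ∈ˢ? T) * l (∣ T ∣ ∸ 1) + l ∣ T ∣ ∎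

  Extends : Subset v → Fin v → Set
  Extends S a = a ∉ˢ S × Clique (S ∪ ⁅ a ⁆)

  extends? : ∀ S a → Dec (Extends S a)
  extends? S a = ¬? (a ∈ˢ? S) ×-dec clique? (S ∪ ⁅ a ⁆)

  module _ {N : ℕ} {q : ℚ} (0≤q : 0ℚ ≤ q)
    (extensions : ∀ S → Clique S → ∣ S ∣ ≤ⁿ N → q ≤ ∑ (allFin v) (λ a → ind (extends? S a)))
    where

    -- The clique grows greedily with `p ∪ T` kept a clique, so that the uncovered part of `T` can
    -- still be added. The next entry is a vertex of `T`, which leaves `p ∪ T` unchanged, or one of
    -- the at least `q` vertices extending `p ∪ T`; these cases are disjoint.
    count-lower : ∀ m p T → Clique (p ∪ T) → (∀ {a} → a ∈ˢ T → a ∉ˢ p) → ∣ p ∣ +ⁿ m ≤ⁿ N →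
                  L q m ∣ T ∣ ≤ count p T m
    count-lower m p T cl T∩p ∣p∣+m≤N with ∣ T ∣ ℕ.≤? m
    -- With more than `m` vertices still to cover the bound is 0. The other case supplies the size
    -- estimate for `p ∪ T` under which `extensions` applies.
    ... | no  ∣T∣≰m = subst (_≤ count p T m) (sym (L-vanishes q (ℕ.≰⇒> ∣T∣≰m))) (count-nonNeg p T m)
    count-lower zero p T cl T∩p ∣p∣≤N | yes ∣T∣≤0 = ℚ.≤-reflexive (sym (trans (count-zero p T) (trans
      (cong₂ _*_ (ind-yes (clique? p) (Clique-⊆ (p⊆p∪q T) cl)) (ind-yes (∣ T ∣ ≟ⁿ 0) ∣T∣≡0))
      (sym (cong (L q 0) ∣T∣≡0)))))
      where
      ∣T∣≡0 : ∣ T ∣ ≡ 0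
      ∣T∣≡0 = ℕ.n≤0⇒n≡0 ∣T∣≤0
    count-lower (suc m) p T cl T∩p ∣p∣+m≤N | yes ∣T∣≤1+m = begin
      L q (suc m) ∣ T ∣
        ≡⟨ L-suc q m ∣ T ∣ ⟩
      ι ∣ T ∣ * l (∣ T ∣ ∸ 1) + q * l ∣ T ∣
        ≤⟨ ℚ.+-monoʳ-≤ (ι ∣ T ∣ * l (∣ T ∣ ∸ 1)) (*-monoˡ-≤ (0≤l ∣ T ∣) (extensions (p ∪ T) cl ∣p∪T∣≤N)) ⟩
      ι ∣ T ∣ * l (∣ T ∣ ∸ 1) + ∑ (allFin v) (λ a → ind (extends? (p ∪ T) a)) * l ∣ T ∣
        ≡⟨ cong₂ _+_ (∑-∈ T (l (∣ T ∣ ∸ 1))) (∑-*ʳ (allFin v) (l ∣ T ∣) (λ a → ind (extends? (p ∪ T) a))) ⟨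
      ∑ (allFin v) (λ a → ind (a ∈ˢ? T) * l (∣ T ∣ ∸ 1)) + ∑ (allFin v) (λ a → ind (extends? (p ∪ T) a) * l ∣ T ∣)
        ≡⟨ ∑-+ (allFin v) (λ a → ind (a ∈ˢ? T) * l (∣ T ∣ ∸ 1)) (λ a → ind (extends? (p ∪ T) a) * l ∣ T ∣) ⟨
      ∑ (allFin v) (λ a → ind (a ∈ˢ? T) * l (∣ T ∣ ∸ 1) + ind (extends? (p ∪ T) a) * l ∣ T ∣)
        ≤⟨ ∑-mono (allFin v) (λ {a} _ → step a) ⟩
      ∑ (allFin v) (λ a → ind (¬? (a ∈ˢ? p)) * count (p ∪ ⁅ a ⁆) (T ∖ a) m)
        ≡⟨ count-suc p T m ⟨
      count p T (suc m) ∎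
      where
      open ℚ.≤-Reasoning
      l : ℕ → ℚ
      l = L q m
      0≤l : ∀ s → 0ℚ ≤ l s
      0≤l = L-nonNeg 0≤q m
      ∣p∪T∣≤N : ∣ p ∪ T ∣ ≤ⁿ N
      ∣p∪T∣≤N = ℕ.≤-trans (∣p∪q∣≤∣p∣+∣q∣ p T) (ℕ.≤-trans (ℕ.+-monoʳ-≤ ∣ p ∣ ∣T∣≤1+m) ∣p∣+m≤N)
      lemma₁ : ∀ x y → 1ℚ * x + 0ℚ * y ≡ 1ℚ * x
      lemma₁ = solve-∀ ℚ-ring
      lemma₂ : ∀ x y → 0ℚ * x + 1ℚ * y ≡ 1ℚ * y
      lemma₂ = solve-∀ ℚ-ring
      lemma₃ : ∀ x y → 0ℚ * x + 0ℚ * y ≡ 0ℚ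
      lemma₃ = solve-∀ ℚ-ring
      rec : ∀ {a} → a ∉ˢ p → Clique ((p ∪ ⁅ a ⁆) ∪ (T ∖ a)) → l ∣ T ∖ a ∣ ≤ count (p ∪ ⁅ a ⁆) (T ∖ a) m
      rec {a} a∉p cl′ = count-lower m (p ∪ ⁅ a ⁆) (T ∖ a) cl′
        (λ b∈ b∈p∪a → case ∈-∖⁻ T b∈ ,′ ∈-insert⁻ p b∈p∪a of λ where
          ((b∈T , _) , inj₁ b∈p)   → T∩p b∈T b∈p
          ((_ , b≢a) , inj₂ b≡a) → b≢a b≡a)
        (subst (_≤ⁿ N) (trans (ℕ.+-suc ∣ p ∣ m) (cong (_+ⁿ m) (sym (∣insert∣ a∉p)))) ∣p∣+m≤N)
      step : ∀ a → ind (a ∈ˢ? T) * l (∣ T ∣ ∸ 1) + ind (extends? (p ∪ T) a) * l ∣ T ∣ ≤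
                   ind (¬? (a ∈ˢ? p)) * count (p ∪ ⁅ a ⁆) (T ∖ a) m
      step a = case (a ∈ˢ? T) ,′ extends? (p ∪ T) a of λ where
        (yes a∈T , _) → begin
          ind (a ∈ˢ? T) * l (∣ T ∣ ∸ 1) + ind (extends? (p ∪ T) a) * l ∣ T ∣
            ≡⟨ cong₂ (λ x y → x * l (∣ T ∣ ∸ 1) + y * l ∣ T ∣) (ind-yes (a ∈ˢ? T) a∈T)
                 (ind-no (extends? (p ∪ T) a) λ (a∉ , _) → a∉ (x∈p∪q⁺ {p = p} (inj₂ a∈T))) ⟩
          1ℚ * l (∣ T ∣ ∸ 1) + 0ℚ * l ∣ T ∣
            ≡⟨ lemma₁ (l (∣ T ∣ ∸ 1)) (l ∣ T ∣) ⟩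
          1ℚ * l (∣ T ∣ ∸ 1)
            ≡⟨ cong (λ s → 1ℚ * l (s ∸ 1)) (∣T∣≡1+∣T∖a∣ a∈T) ⟩
          1ℚ * l ∣ T ∖ a ∣
            ≤⟨ *-monoʳ-≤ 0≤1 (rec (T∩p a∈T) (Clique-⊆ (λ b∈ →
               case x∈p∪q⁻ (p ∪ ⁅ a ⁆) (T ∖ a) b∈ of λ where
                 (inj₁ b∈p∪a) → case ∈-insert⁻ p b∈p∪a of λ where
                   (inj₁ b∈p)  → x∈p∪q⁺ (inj₁ b∈p)
                   (inj₂ refl) → x∈p∪q⁺ {p = p} (inj₂ a∈T)
                 (inj₂ b∈T∖a) → x∈p∪q⁺ {p = p} (inj₂ (proj₁ (∈-∖⁻ T b∈T∖a)))) cl)) ⟩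
          1ℚ * count (p ∪ ⁅ a ⁆) (T ∖ a) m
            ≡⟨ cong (_* count (p ∪ ⁅ a ⁆) (T ∖ a) m) (ind-yes (¬? (a ∈ˢ? p)) (T∩p a∈T)) ⟨
          ind (¬? (a ∈ˢ? p)) * count (p ∪ ⁅ a ⁆) (T ∖ a) m ∎
        (no a∉T , yes ext@(a∉p∪T , cl′)) → begin
          ind (a ∈ˢ? T) * l (∣ T ∣ ∸ 1) + ind (extends? (p ∪ T) a) * l ∣ T ∣
            ≡⟨ cong₂ (λ x y → x * l (∣ T ∣ ∸ 1) + y * l ∣ T ∣) (ind-no (a ∈ˢ? T) a∉T)
                 (ind-yes (extends? (p ∪ T) a) ext) ⟩
          0ℚ * l (∣ T ∣ ∸ 1) + 1ℚ * l ∣ T ∣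
            ≡⟨ lemma₂ (l (∣ T ∣ ∸ 1)) (l ∣ T ∣) ⟩
          1ℚ * l ∣ T ∣
            ≡⟨ cong (λ T′ → 1ℚ * l ∣ T′ ∣) (a∉T⇒T∖a≡T a∉T) ⟨
          1ℚ * l ∣ T ∖ a ∣
            ≤⟨ *-monoʳ-≤ 0≤1 (rec (a∉p∪T ∘ x∈p∪q⁺ ∘ inj₁) (Clique-⊆ (λ b∈ →
               case x∈p∪q⁻ (p ∪ ⁅ a ⁆) (T ∖ a) b∈ of λ where
                 (inj₁ b∈p∪a) → case ∈-insert⁻ p b∈p∪a of λ where
                   (inj₁ b∈p)  → ∈-insert-there a (x∈p∪q⁺ (inj₁ b∈p))
                   (inj₂ refl) → ∈-insert-here (p ∪ T) a
                 (inj₂ b∈T∖a) → ∈-insert-there a (x∈p∪q⁺ {p = p} (inj₂ (proj₁ (∈-∖⁻ T b∈T∖a))))) cl′)) ⟩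
          1ℚ * count (p ∪ ⁅ a ⁆) (T ∖ a) m
            ≡⟨ cong (_* count (p ∪ ⁅ a ⁆) (T ∖ a) m) (ind-yes (¬? (a ∈ˢ? p)) (a∉p∪T ∘ x∈p∪q⁺ ∘ inj₁)) ⟨
          ind (¬? (a ∈ˢ? p)) * count (p ∪ ⁅ a ⁆) (T ∖ a) m ∎
        (no a∉T , no ¬ext) → begin
          ind (a ∈ˢ? T) * l (∣ T ∣ ∸ 1) + ind (extends? (p ∪ T) a) * l ∣ T ∣
            ≡⟨ cong₂ (λ x y → x * l (∣ T ∣ ∸ 1) + y * l ∣ T ∣) (ind-no (a ∈ˢ? T) a∉T)
                 (ind-no (extends? (p ∪ T) a) ¬ext) ⟩
          0ℚ * l (∣ T ∣ ∸ 1) + 0ℚ * l ∣ T ∣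
            ≡⟨ lemma₃ (l (∣ T ∣ ∸ 1)) (l ∣ T ∣) ⟩
          0ℚ
            ≤⟨ 0≤* (ind-nonNeg (¬? (a ∈ˢ? p))) (count-nonNeg (p ∪ ⁅ a ⁆) (T ∖ a) m) ⟩
          ind (¬? (a ∈ˢ? p)) * count (p ∪ ⁅ a ⁆) (T ∖ a) m ∎

-- From minimum degree to clique extensions

∑-subsets-within : ∀ {n} (S : Subset n) r →
  ∑ (subsets n) (λ R → ind ((∣ R ∣ ≟ⁿ r) ×-dec (R ⊆? S))) ≤ pow (ι ∣ S ∣) r
∑-subsets-within [] zero    = ℚ.≤-refl
∑-subsets-within [] (suc r) = ℚ.≤-reflexive (sym (ℚ.*-zeroˡ (pow 0ℚ r)))
∑-subsets-within {suc n} (outside ∷ S) r = begin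
  ∑ (subsets (suc n)) (f (outside ∷ S) r)
    ≡⟨ ∑-subsets-suc n (f (outside ∷ S) r) ⟩
  ∑ (subsets n) (f (outside ∷ S) r ∘ (inside ∷_)) + ∑ (subsets n) (f (outside ∷ S) r ∘ (outside ∷_))
    ≤⟨ ℚ.+-mono-≤
         (ℚ.≤-reflexive (∑-zero (subsets n) λ {R} _ →
           ind-no ((∣ inside ∷ R ∣ ≟ⁿ r) ×-dec ((inside ∷ R) ⊆? (outside ∷ S))) λ (_ , R⊆S) → case R⊆S here of λ ()))
         (∑-mono (subsets n) λ {R} _ →
           ind-mono ((∣ outside ∷ R ∣ ≟ⁿ r) ×-dec ((outside ∷ R) ⊆? (outside ∷ S))) ((∣ R ∣ ≟ⁿ r) ×-dec (R ⊆? S))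
             λ (eq , R⊆S) → eq , drop-∷-⊆ R⊆S) ⟩
  0ℚ + ∑ (subsets n) (f S r)
    ≡⟨ ℚ.+-identityˡ (∑ (subsets n) (f S r)) ⟩
  ∑ (subsets n) (f S r)
    ≤⟨ ∑-subsets-within S r ⟩
  pow (ι ∣ S ∣) r ∎
  where
  open ℚ.≤-Reasoning
  f : ∀ {n} → Subset n → ℕ → Subset n → ℚ
  f S r R = ind ((∣ R ∣ ≟ⁿ r) ×-dec (R ⊆? S))
∑-subsets-within {suc n} (inside ∷ S) r = begin
  ∑ (subsets (suc n)) (f (inside ∷ S) r)
    ≡⟨ ∑-subsets-suc n (f (inside ∷ S) r) ⟩
  ∑ (subsets n) (f (inside ∷ S) r ∘ (inside ∷_)) + ∑ (subsets n) (f (inside ∷ S) r ∘ (outside ∷_))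
    ≤⟨ ℚ.+-mono-≤ (with-head r)
         (ℚ.≤-trans
           (∑-mono (subsets n) λ {R} _ →
             ind-mono ((∣ outside ∷ R ∣ ≟ⁿ r) ×-dec ((outside ∷ R) ⊆? (inside ∷ S))) ((∣ R ∣ ≟ⁿ r) ×-dec (R ⊆? S))
               λ (eq , R⊆S) → eq , drop-∷-⊆ R⊆S)
           (∑-subsets-within S r)) ⟩
  pow⁻ r + pow m r
    ≤⟨ bound r ⟩
  pow (1ℚ + m) r ∎
  where
  open ℚ.≤-Reasoning
  f : ∀ {n} → Subset n → ℕ → Subset n → ℚ
  f S r R = ind ((∣ R ∣ ≟ⁿ r) ×-dec (R ⊆? S))
  m : ℚ
  m = ι ∣ S ∣
  0≤m : 0ℚ ≤ m
  0≤m = ι-nonNeg ∣ S ∣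
  -- Bounds the `r`-subsets that contain the head: they have r - 1 further elements, and there are
  -- none for r = 0.
  pow⁻ : ℕ → ℚ
  pow⁻ zero    = 0ℚ
  pow⁻ (suc r) = pow m r
  with-head : ∀ r → ∑ (subsets n) (f (inside ∷ S) r ∘ (inside ∷_)) ≤ pow⁻ r
  with-head zero    = ℚ.≤-reflexive (∑-zero (subsets n) λ {R} _ →
    ind-no ((suc ∣ R ∣ ≟ⁿ 0) ×-dec ((inside ∷ R) ⊆? (inside ∷ S))) λ ())
  with-head (suc r) = ℚ.≤-trans
    (∑-mono (subsets n) λ {R} _ →
      ind-mono ((suc ∣ R ∣ ≟ⁿ suc r) ×-dec ((inside ∷ R) ⊆? (inside ∷ S))) ((∣ R ∣ ≟ⁿ r) ×-dec (R ⊆? S))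
        λ (eq , R⊆S) → ℕ.suc-injective eq , drop-∷-⊆ R⊆S)
    (∑-subsets-within S r)
  bound : ∀ r → pow⁻ r + pow m r ≤ pow (1ℚ + m) r
  bound zero    = ℚ.≤-refl
  bound (suc r) = ℚ.≤-trans (ℚ.≤-reflexive (lemma m (pow m r)))
    (*-monoʳ-≤ (0≤+ 0≤1 0≤m) (pow-mono r 0≤m (subst (m ≤_) (ℚ.+-comm m 1ℚ) (p≤p+q 0≤1))))
    where
    lemma : ∀ m x → x + m * x ≡ (1ℚ + m) * x
    lemma = solve-∀ ℚ-ring

module Extension {t v : ℕ} (G : TGraph t v) (1≤t : 1 ≤ⁿ t) where

  open Graph G
  open Counting G

  open DecMembership {A = Subset v} (≡-dec _≟ᵇ_) using (_∈?_)

  Missing : Subset v → Fin v → Set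
  Missing R a = a ∉ˢ R × ¬ ((R ∪ ⁅ a ⁆) ∈ TGraph.edges G)

  missing? : ∀ R a → Dec (Missing R a)
  missing? R a = ¬? (a ∈ˢ? R) ×-dec ¬? ((R ∪ ⁅ a ⁆) ∈? TGraph.edges G)

  ∑-allFin-1 : ∑ (allFin v) (λ _ → 1ℚ) ≡ ι v
  ∑-allFin-1 = trans (∑-allFin-const 1ℚ) (ℚ.*-identityʳ (ι v))

  -- A union bound. If `a` lies outside the clique `S` and does not extend it, some t-subset of
  -- `S ∪ ⁅ a ⁆` is a non-edge. It contains `a`, since `S` is a clique, so removing `a` leaves a (t
  -- - 1)-subset of `S` that misses `a`. There are at most ∣S∣^(t - 1) such subsets, each missing at
  -- most `μ` vertices.
  ∑-extensions : ∀ {μ} → 0ℚ ≤ μ →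
    (∀ R → ∣ R ∣ ≡ t ∸ 1 → ∑ (allFin v) (λ a → ind (missing? R a)) ≤ μ) →
    ∀ S → Clique S →
    ι v ≤ ∑ (allFin v) (λ a → ind (extends? S a)) + (ι ∣ S ∣ + pow (ι ∣ S ∣) (t ∸ 1) * μ)
  ∑-extensions {μ} 0≤μ few-missing S cl = begin
    ι v
      ≡⟨ ∑-allFin-1 ⟨
    ∑ (allFin v) (λ _ → 1ℚ)
      ≤⟨ ∑-mono (allFin v) (λ {a} _ → cover a) ⟩
    ∑ (allFin v) (λ a → ind (extends? S a) + (ind (a ∈ˢ? S) + bad a))
      ≡⟨ ∑-+ (allFin v) (λ a → ind (extends? S a)) (λ a → ind (a ∈ˢ? S) + bad a) ⟩
    X + ∑ (allFin v) (λ a → ind (a ∈ˢ? S) + bad a)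
      ≡⟨ cong (X +_) (∑-+ (allFin v) (λ a → ind (a ∈ˢ? S)) bad) ⟩
    X + (∑ (allFin v) (λ a → ind (a ∈ˢ? S)) + ∑ (allFin v) bad)
      ≡⟨ cong₂ (λ x y → X + (x + y)) (sym (ι∣S∣≡∑ S))
           (∑-swap (allFin v) (subsets v) (λ a R → ind (inS? R) * ind (missing? R a))) ⟩
    X + (ι ∣ S ∣ + ∑ (subsets v) (λ R → ∑ (allFin v) (λ a → ind (inS? R) * ind (missing? R a))))
      ≡⟨ cong (λ x → X + (ι ∣ S ∣ + x)) (∑-cong (subsets v) λ {R} _ →
           ∑-*ˡ (allFin v) (ind (inS? R)) (λ a → ind (missing? R a))) ⟩
    X + (ι ∣ S ∣ + ∑ (subsets v) (λ R → ind (inS? R) * ∑ (allFin v) (λ a → ind (missing? R a))))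
      ≤⟨ ℚ.+-monoʳ-≤ X (ℚ.+-monoʳ-≤ (ι ∣ S ∣) (∑-mono (subsets v) λ {R} _ →
           ind-guard-≤ (inS? R) λ (∣R∣≡ , _) → few-missing R ∣R∣≡)) ⟩
    X + (ι ∣ S ∣ + ∑ (subsets v) (λ R → ind (inS? R) * μ))
      ≡⟨ cong (λ x → X + (ι ∣ S ∣ + x)) (∑-*ʳ (subsets v) μ (λ R → ind (inS? R))) ⟩
    X + (ι ∣ S ∣ + ∑ (subsets v) (λ R → ind (inS? R)) * μ)
      ≤⟨ ℚ.+-monoʳ-≤ X (ℚ.+-monoʳ-≤ (ι ∣ S ∣) (*-monoˡ-≤ 0≤μ (∑-subsets-within S (t ∸ 1)))) ⟩
    X + (ι ∣ S ∣ + pow (ι ∣ S ∣) (t ∸ 1) * μ) ∎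
    where
    open ℚ.≤-Reasoning
    X : ℚ
    X = ∑ (allFin v) (λ a → ind (extends? S a))
    inS? : ∀ R → Dec (∣ R ∣ ≡ t ∸ 1 × R ⊆ˢ S)
    inS? R = (∣ R ∣ ≟ⁿ (t ∸ 1)) ×-dec (R ⊆? S)
    bad : Fin v → ℚ
    bad a = ∑ (subsets v) (λ R → ind (inS? R) * ind (missing? R a))
    0≤term : ∀ a R → 0ℚ ≤ ind (inS? R) * ind (missing? R a)
    0≤term a R = 0≤* (ind-nonNeg (inS? R)) (ind-nonNeg (missing? R a))
    0≤bad : ∀ a → 0ℚ ≤ bad a
    0≤bad a = ∑-nonNeg (subsets v) λ {R} _ → 0≤term a R
    bad-≥1 : ∀ {a} → a ∉ˢ S → ¬ Clique (S ∪ ⁅ a ⁆) → 1ℚ ≤ bad a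
    -- Deciding the inequality replaces a search for the non-edge: if it failed, every t-subset of
    -- `S ∪ ⁅ a ⁆` would be an edge.
    bad-≥1 {a} a∉S ¬cl with 1ℚ ℚ.≤? bad a
    ... | yes 1≤bad = 1≤bad
    ... | no  1≰bad = contradiction cl′ ¬cl
      where
      witness : ∀ {e} → ∣ e ∣ ≡ t → e ⊆ˢ (S ∪ ⁅ a ⁆) → ¬ (e ∈ TGraph.edges G) → 1ℚ ≤ bad a
      witness {e} ∣e∣≡t e⊆S∪a e∉E = subst (_≤ bad a)
        (cong₂ _*_ (ind-yes (inS? (e ∖ a)) (∣e∖a∣≡t∸1 , e∖a⊆S))
                   (ind-yes (missing? (e ∖ a) a)
                     (a∉T∖a e a , subst (λ e′ → ¬ (e′ ∈ TGraph.edges G)) (sym (∖-insert a∈e)) e∉E)))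
        (∑-∈-≤ (0≤term a) (subsets-complete (e ∖ a)))
        where
        e∖a⊆S : (e ∖ a) ⊆ˢ S
        e∖a⊆S b∈ = case ∈-∖⁻ e b∈ of λ (b∈e , b≢a) → case ∈-insert⁻ S (e⊆S∪a b∈e) of λ where
          (inj₁ b∈S) → b∈S
          (inj₂ b≡a) → contradiction b≡a b≢a
        a∈e : a ∈ˢ e
        a∈e = case a ∈ˢ? e of λ where
          (yes a∈e) → a∈e
          (no  a∉e) → contradiction
            (cl e ∣e∣≡t λ b∈e → e∖a⊆S (x∈p∧x≢y⇒x∈p-y b∈e λ { refl → a∉e b∈e })) e∉E
        ∣e∖a∣≡t∸1 : ∣ e ∖ a ∣ ≡ t ∸ 1
        ∣e∖a∣≡t∸1 = cong (_∸ 1) (trans (sym (∣T∣≡1+∣T∖a∣ a∈e)) ∣e∣≡t)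
      cl′ : Clique (S ∪ ⁅ a ⁆)
      cl′ e ∣e∣≡t e⊆S∪a with e ∈? TGraph.edges G
      ... | yes e∈E = e∈E
      ... | no  e∉E = contradiction (witness ∣e∣≡t e⊆S∪a e∉E) 1≰bad
    sum-≥ : ∀ {x y z} → 0ℚ ≤ x → 0ℚ ≤ y → 0ℚ ≤ z → 1ℚ ≤ x ⊎ 1ℚ ≤ y ⊎ 1ℚ ≤ z → 1ℚ ≤ x + (y + z)
    sum-≥ 0≤x 0≤y 0≤z (inj₁ 1≤x) = ℚ.≤-trans 1≤x (p≤p+q (0≤+ 0≤y 0≤z))
    sum-≥ {x} {y} {z} 0≤x 0≤y 0≤z (inj₂ h) =
      ℚ.≤-trans ([ (λ 1≤y → ℚ.≤-trans 1≤y (p≤p+q 0≤z))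
                 , (λ 1≤z → ℚ.≤-trans 1≤z (subst (z ≤_) (ℚ.+-comm z y) (p≤p+q 0≤y))) ]′ h)
        (subst (y + z ≤_) (ℚ.+-comm (y + z) x) (p≤p+q 0≤x))
    cover : ∀ a → 1ℚ ≤ ind (extends? S a) + (ind (a ∈ˢ? S) + bad a)
    cover a = sum-≥ (ind-nonNeg (extends? S a)) (ind-nonNeg (a ∈ˢ? S)) (0≤bad a)
      (case (a ∈ˢ? S) ,′ extends? S a of λ where
        (yes a∈S , _)       → inj₂ (inj₁ (ℚ.≤-reflexive (sym (ind-yes (a ∈ˢ? S) a∈S))))
        (no _    , yes ext) → inj₁ (ℚ.≤-reflexive (sym (ind-yes (extends? S a) ext)))
        (no a∉S  , no ¬ext) → inj₂ (inj₂ (bad-≥1 a∉S λ cl′ → ¬ext (a∉S , cl′))))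

  ∑-unique-≤ : ∀ {xs : List (Subset v)} X → Unique xs →
               ∑ xs (λ e → ind (≡-dec _≟ᵇ_ e X)) ≤ ind (X ∈? xs)
  ∑-unique-≤ X [] = ℚ.≤-refl
  ∑-unique-≤ {x ∷ xs} X (x∉xs ∷ unique) = case ≡-dec _≟ᵇ_ x X of λ where
    (yes refl) → ℚ.≤-reflexive (trans
      (cong₂ _+_ (ind-yes (≡-dec _≟ᵇ_ x x) refl)
        (∑-zero xs λ {e} e∈xs → ind-no (≡-dec _≟ᵇ_ e x) λ e≡x → All.lookup x∉xs e∈xs (sym e≡x)))
      (sym (ind-yes (x ∈? (x ∷ xs)) (here refl))))
    (no x≢X) → ℚ.≤-trans
      (ℚ.≤-reflexive (trans (cong (_+ ∑ xs _) (ind-no (≡-dec _≟ᵇ_ x X) x≢X)) (ℚ.+-identityˡ (∑ xs _))))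
      (ℚ.≤-trans (∑-unique-≤ X unique) (ind-mono (X ∈? xs) (X ∈? (x ∷ xs)) there))

  -- An edge containing the (t - 1)-set `R` has the form `R ∪ ⁅ a ⁆` for some `a` outside `R`, and
  -- since the edge list has no duplicates each `a` accounts for at most one entry.
  degree-≤ : ∀ R → ∣ R ∣ ≡ t ∸ 1 →
    ι (degree G R) ≤ ∑ (allFin v) (λ a → ind (¬? (a ∈ˢ? R)) * ind ((R ∪ ⁅ a ⁆) ∈? TGraph.edges G))
  degree-≤ R ∣R∣≡ = begin
    ι (degree G R)
      ≡⟨ ι-length-filter (R ⊆?_) E ⟩
    ∑ E (λ e → ind (R ⊆? e))
      ≤⟨ ∑-mono E (λ {e} e∈E → edge e e∈E) ⟩
    ∑ E (λ e → ∑ (allFin v) (λ a → new a * ind (≡-dec _≟ᵇ_ e (R ∪ ⁅ a ⁆))))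
      ≡⟨ ∑-swap E (allFin v) (λ e a → new a * ind (≡-dec _≟ᵇ_ e (R ∪ ⁅ a ⁆))) ⟩
    ∑ (allFin v) (λ a → ∑ E (λ e → new a * ind (≡-dec _≟ᵇ_ e (R ∪ ⁅ a ⁆))))
      ≡⟨ ∑-cong (allFin v) (λ {a} _ → ∑-*ˡ E (new a) (λ e → ind (≡-dec _≟ᵇ_ e (R ∪ ⁅ a ⁆)))) ⟩
    ∑ (allFin v) (λ a → new a * ∑ E (λ e → ind (≡-dec _≟ᵇ_ e (R ∪ ⁅ a ⁆))))
      ≤⟨ ∑-mono (allFin v) (λ {a} _ → *-monoʳ-≤ (ind-nonNeg (¬? (a ∈ˢ? R)))
           (∑-unique-≤ (R ∪ ⁅ a ⁆) (TGraph.unique G))) ⟩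
    ∑ (allFin v) (λ a → new a * ind ((R ∪ ⁅ a ⁆) ∈? E)) ∎
    where
    open ℚ.≤-Reasoning
    E : List (Subset v)
    E = TGraph.edges G
    new : Fin v → ℚ
    new a = ind (¬? (a ∈ˢ? R))
    1+∣R∣≡t : suc ∣ R ∣ ≡ t
    1+∣R∣≡t = trans (cong suc ∣R∣≡) (ℕ.m+[n∸m]≡n 1≤t)
    term : Subset v → Fin v → ℚ
    term e a = new a * ind (≡-dec _≟ᵇ_ e (R ∪ ⁅ a ⁆))
    0≤term : ∀ e a → 0ℚ ≤ term e a
    0≤term e a = 0≤* (ind-nonNeg (¬? (a ∈ˢ? R))) (ind-nonNeg (≡-dec _≟ᵇ_ e (R ∪ ⁅ a ⁆)))
    edge : ∀ e → e ∈ E → ind (R ⊆? e) ≤ ∑ (allFin v) (term e)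
    edge e e∈E with R ⊆? e
    ... | no R⊈e  = ∑-nonNeg (allFin v) λ {a} _ → 0≤term e a
    ... | yes R⊆e with Fin.any? (λ a → (a ∈ˢ? e) ×-dec ¬? (a ∈ˢ? R))
    ...   | yes (a , a∈e , a∉R) = subst (_≤ ∑ (allFin v) (term e))
      (cong₂ _*_ (ind-yes (¬? (a ∈ˢ? R)) a∉R)
        (ind-yes (≡-dec _≟ᵇ_ e (R ∪ ⁅ a ⁆)) (sym (⊆∧∣∣≤⇒≡
          (λ b∈ → case ∈-insert⁻ R b∈ of λ where
            (inj₁ b∈R)  → R⊆e b∈R
            (inj₂ refl) → a∈e)
          (ℕ.≤-reflexive (trans (All.lookup (TGraph.uniform G) e∈E) (trans (sym 1+∣R∣≡t) (sym (∣insert∣ a∉R)))))))))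
      (∑-∈-≤ (0≤term e) (∈-allFin a))
    ...   | no ¬∃a = contradiction
      (ℕ.≤-trans (ℕ.≤-reflexive (trans 1+∣R∣≡t (sym (All.lookup (TGraph.uniform G) e∈E))))
        (p⊆q⇒∣p∣≤∣q∣ {p = e} {R} λ {a} a∈e →
        case a ∈ˢ? R of λ where
          (yes a∈R) → a∈R
          (no  a∉R) → contradiction (a , a∈e , a∉R) ¬∃a))
      ℕ.1+n≰n

  -- Each of the v - t + 1 vertices outside `R` either completes `R` to an edge or is missing, and
  -- density bounds the first kind from below.
  Dense⇒few-missing : ∀ {ε ε′} → Dense ε G → ε ≤ ε′ → 0ℚ ≤ ε′ → t ≤ⁿ v →
    ∀ R → ∣ R ∣ ≡ t ∸ 1 → ∑ (allFin v) (λ a → ind (missing? R a)) ≤ ε′ * ι v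
  Dense⇒few-missing {ε} {ε′} dense ε≤ε′ 0≤ε′ t≤v R ∣R∣≡ = begin
    M                ≡⟨ lemma₁ M D ⟩
    (M + D) - D      ≡⟨ cong (_- D) total ⟩
    x - D            ≤⟨ ℚ.+-monoʳ-≤ x (ℚ.neg-antimono-≤ D≥) ⟩
    x - (1ℚ - ε) * x ≡⟨ lemma₂ x ε ⟩
    -- `ε` may be negative, so it is replaced by the nonnegative `ε′` before v - t + 1 is enlarged
    -- to `v`.
    ε * x            ≤⟨ *-monoˡ-≤ (ι-nonNeg n) ε≤ε′ ⟩
    ε′ * x           ≤⟨ *-monoʳ-≤ 0≤ε′ (ι-mono n≤v) ⟩
    ε′ * ι v         ∎
    where
    open ℚ.≤-Reasoning
    n : ℕ
    n = v ∸ t +ⁿ 1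
    n+∣R∣≡v : n +ⁿ ∣ R ∣ ≡ v
    n+∣R∣≡v = trans (cong (n +ⁿ_) ∣R∣≡) (trans (ℕ.+-assoc (v ∸ t) 1 (t ∸ 1))
      (trans (cong (v ∸ t +ⁿ_) (ℕ.m+[n∸m]≡n 1≤t)) (ℕ.m∸n+n≡m t≤v)))
    n≤v : n ≤ⁿ v
    n≤v = subst (n ≤ⁿ_) n+∣R∣≡v (ℕ.m≤m+n n ∣ R ∣)
    x M D : ℚ
    x = ι n
    M = ∑ (allFin v) (λ a → ind (missing? R a))
    D = ∑ (allFin v) (λ a → ind (¬? (a ∈ˢ? R)) * ind ((R ∪ ⁅ a ⁆) ∈? TGraph.edges G))
    lemma₁ : ∀ M D → M ≡ (M + D) - D
    lemma₁ = solve-∀ ℚ-ring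
    lemma₂ : ∀ x ε → x - (1ℚ - ε) * x ≡ ε * x
    lemma₂ = solve-∀ ℚ-ring
    partition : ∀ {P Q : Set} (P? : Dec P) (Q? : Dec Q) →
                ind (¬? P? ×-dec ¬? Q?) + ind (¬? P?) * ind Q? + ind P? ≡ 1ℚ
    partition (yes _) (yes _) = refl
    partition (yes _) (no _)  = refl
    partition (no _)  (yes _) = refl
    partition (no _)  (no _)  = refl
    lemma₃ : ∀ y z → y ≡ (y + z) - z
    lemma₃ = solve-∀ ℚ-ring
    total : M + D ≡ x
    total = trans (lemma₃ (M + D) (ι ∣ R ∣)) (trans (cong (_- ι ∣ R ∣) (trans
      (trans (cong₂ _+_ (sym (∑-+ (allFin v) (λ a → ind (missing? R a)) _)) (ι∣S∣≡∑ R))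
        (trans (sym (∑-+ (allFin v)
            (λ a → ind (missing? R a) + ind (¬? (a ∈ˢ? R)) * ind ((R ∪ ⁅ a ⁆) ∈? TGraph.edges G))
            (λ a → ind (a ∈ˢ? R))))
          (trans (∑-cong (allFin v) λ {a} _ → partition (a ∈ˢ? R) ((R ∪ ⁅ a ⁆) ∈? TGraph.edges G))
            (trans ∑-allFin-1 (cong ι (sym n+∣R∣≡v))))))
      (ι-+ n ∣ R ∣))) (sym (lemma₃ x (ι ∣ R ∣))))
    δ≤degree : δ (t ∸ 1) G ≤ⁿ degree G R
    δ≤degree = All.lookup
      (min≤xs (length (TGraph.edges G)) (map (degree G) (subsetsOfSize (t ∸ 1) v)))
      (∈-map⁺ (degree G) (subsetsOfSize-complete R ∣R∣≡))
    v-t+1≡n : pos v ℤ.- pos t ℤ.+ pos 1 ≡ pos n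
    v-t+1≡n = cong (ℤ._+ pos 1) (trans (ℤ.m-n≡m⊖n v t) (ℤ.⊖-≥ t≤v))
    D≥ : (1ℚ - ε) * x ≤ D
    D≥ = begin
      (1ℚ - ε) * x                                ≡⟨ cong ((1ℚ - ε) *_) (trans (ι≡/1 n) (cong (_/ 1) (sym v-t+1≡n))) ⟩
      (1ℚ - ε) * ((pos v ℤ.- pos t ℤ.+ pos 1) / 1) ≤⟨ dense ⟩
      pos (δ (t ∸ 1) G) / 1                       ≡⟨ ι≡/1 (δ (t ∸ 1) G) ⟨
      ι (δ (t ∸ 1) G)                             ≤⟨ ι-mono δ≤degree ⟩
      ι (degree G R)                              ≤⟨ degree-≤ R ∣R∣≡ ⟩
      D                                           ∎

-- Images of subsets and copies of the complete graph

does-true⁻ : ∀ {ℓ} {P : Set ℓ} (P? : Dec P) → does P? ≡ true → P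
does-true⁻ (yes p) _ = p

∈-image⁺ : ∀ {m n} (φ : Fin m → Fin n) {S x} → x ∈ˢ S → φ x ∈ˢ image φ S
∈-image⁺ φ {S} {x} x∈S = lookup⇒[]= (φ x) (image φ S)
  (trans (lookup∘tabulate _ (φ x)) (dec-true (Fin.any? λ x′ → (x′ ∈ˢ? S) ×-dec (φ x′ Fin.≟ φ x)) (x , x∈S , refl)))

∈-image⁻ : ∀ {m n} (φ : Fin m → Fin n) S {y} → y ∈ˢ image φ S → ∃[ x ] (x ∈ˢ S × φ x ≡ y)
∈-image⁻ φ S {y} y∈ = does-true⁻ (Fin.any? λ x → (x ∈ˢ? S) ×-dec (φ x Fin.≟ y))
  (trans (sym (lookup∘tabulate _ y)) ([]=⇒lookup y∈))

∣image∣ : ∀ {m n} {φ : Fin m → Fin n} → Injective _≡_ _≡_ φ → ∀ S → ∣ image φ S ∣ ≡ ∣ S ∣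
∣image∣ {m} {n} {φ} injective S = go ∣ S ∣ S refl
  where
  go : ∀ s S → ∣ S ∣ ≡ s → ∣ image φ S ∣ ≡ s
  go zero S ∣S∣≡0 = trans
    (cong ∣_∣ (Empty-unique {p = image φ S} λ (y , y∈) →
      let x , x∈S , _ = ∈-image⁻ φ S y∈ in ∣T∣≡0⇒∉ ∣S∣≡0 x∈S))
    (∣⊥∣≡0 n)
  go (suc s) S ∣S∣≡1+s with nonempty? S
  ... | no empty with () ← trans (sym ∣S∣≡1+s) (trans (cong ∣_∣ (Empty-unique empty)) (∣⊥∣≡0 m))
  ... | yes (a , a∈S) = trans (∣T∣≡1+∣T∖a∣ (∈-image⁺ φ a∈S)) (cong suc (trans
    (cong ∣_∣ image-∖) (go s (S ∖ a) (ℕ.suc-injective (trans (sym (∣T∣≡1+∣T∖a∣ a∈S)) ∣S∣≡1+s)))))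
    where
    image-∖ : image φ S ∖ φ a ≡ image φ (S ∖ a)
    image-∖ = ⊆-antisym
      (λ y∈ → let y∈image , y≢φa = ∈-∖⁻ (image φ S) y∈
                  x , x∈S , φx≡y = ∈-image⁻ φ S y∈image
              in subst (_∈ˢ image φ (S ∖ a)) φx≡y
                   (∈-image⁺ φ (x∈p∧x≢y⇒x∈p-y x∈S λ x≡a → y≢φa (trans (sym φx≡y) (cong φ x≡a)))))
      (λ y∈ → let x , x∈S∖a , φx≡y = ∈-image⁻ φ (S ∖ a) y∈
                  x∈S , x≢a = ∈-∖⁻ S x∈S∖a
              in subst (_∈ˢ (image φ S ∖ φ a)) φx≡y
                   (x∈p∧x≢y⇒x∈p-y (∈-image⁺ φ x∈S) (x≢a ∘ injective)))

module Copies {t v : ℕ} (G : TGraph t v) where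

  open Graph G

  Ok⇒lookup∉ : ∀ {p} x → Ok p x → ∀ i → lookup x i ∉ˢ p
  Ok⇒lookup∉ (a ∷ x) (a∉p , _) zero    = a∉p
  Ok⇒lookup∉ (a ∷ x) (_ , ok)  (suc i) = Ok⇒lookup∉ x ok i ∘ ∈-insert-there a

  Ok⇒injective : ∀ {p} x → Ok p x → Injective _≡_ _≡_ (lookup x)
  Ok⇒injective (a ∷ x) ok {zero}  {zero}  eq = refl
  Ok⇒injective {p} (a ∷ x) (_ , ok) {zero} {suc j} eq =
    contradiction (subst (_∈ˢ (p ∪ ⁅ a ⁆)) eq (∈-insert-here p a)) (Ok⇒lookup∉ x ok j)
  Ok⇒injective {p} (a ∷ x) (_ , ok) {suc i} {zero} eq =
    contradiction (subst (_∈ˢ (p ∪ ⁅ a ⁆)) (sym eq) (∈-insert-here p a)) (Ok⇒lookup∉ x ok i)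
  Ok⇒injective (a ∷ x) (_ , ok) {suc i} {suc j} eq = cong suc (Ok⇒injective x ok eq)

  induced : List (Fin v) → Subgraph G
  induced x = record
    { vertices = span ⊥ x
    ; edges    = filter (_⊆? span ⊥ x) (TGraph.edges G)
    ; unique   = Unique.filter⁺ (_⊆? span ⊥ x) (TGraph.unique G)
    ; edges⊆   = proj₁ ∘ ∈-filter⁻ (_⊆? span ⊥ x)
    ; within   = all-filter (_⊆? span ⊥ x) (TGraph.edges G)
    }

  -- The tuple itself, read as a map from positions to vertices, is the isomorphism. Injectivity
  -- preserves sizes, so t-sets of positions go to t-subsets of a clique, and conversely only t-sets
  -- can go to edges because `G` is t-uniform.
  complete≅induced : ∀ {k} x → length x ≡ k → Ok ⊥ x → complete t k ≅ induced x
  complete≅induced x refl ok = record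
    { φ         = lookup x
    ; injective = injective
    ; onto      = λ y → mk⇔
        (λ y∈ → case ∈-span⁻ x y∈ of λ where
          (inj₁ y∈⊥) → contradiction y∈⊥ ∉⊥
          (inj₂ ∃i)  → ∃i)
        (λ { (i , refl) → lookup-∈-span x i })
    ; edge⇔     = λ S → mk⇔ (to S) (from S)
    }
    where
    injective : Injective _≡_ _≡_ (lookup x)
    injective = Ok⇒injective x ok
    to : ∀ S → S ∈ subsetsOfSize t (length x) → image (lookup x) S ∈ Subgraph.edges (induced x)
    to S S∈ = ∈-filter⁺ (_⊆? span ⊥ x)
      (Ok⇒Clique x ok (image (lookup x) S) (trans (∣image∣ injective S) ∣S∣≡t) image⊆span) image⊆span
      where
      ∣S∣≡t : ∣ S ∣ ≡ t
      ∣S∣≡t = proj₂ (∈-filter⁻ (λ S → ∣ S ∣ ≟ⁿ t) {xs = subsets (length x)} S∈)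
      image⊆span : image (lookup x) S ⊆ˢ span ⊥ x
      image⊆span y∈ with ∈-image⁻ (lookup x) S y∈
      ... | i , _ , refl = lookup-∈-span x i
    from : ∀ S → image (lookup x) S ∈ Subgraph.edges (induced x) → S ∈ subsetsOfSize t (length x)
    from S image∈ = subsetsOfSize-complete S (trans (sym (∣image∣ injective S))
      (All.lookup (TGraph.uniform G) (Subgraph.edges⊆ (induced x) image∈)))

-- The corrected weights

module Weighting {t k v : ℕ} (G : TGraph t v) (t≤k : t ≤ⁿ k)
  {φ : ℕ → ℚ} (iso : Isolating t k φ) {q : ℚ} (0<v : 0ℚ < ι v) (0<q : 0ℚ < q) (q≤1 : q ≤ 1ℚ)
  (extensions : ∀ S → Graph.Clique G S → ∣ S ∣ ≤ⁿ t +ⁿ k →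
                q * ι v ≤ ∑ (allFin v) (λ a → ind (Counting.extends? G S a)))
  (small : pow (ι 2) t * pow (ι k) t * (1ℚ - pow q k) < pow q k)
  where

  open Graph G
  open Counting G
  open Copies G
  open DecMembership {A = Subset v} (≡-dec _≟ᵇ_) using (_∈?_)

  -- `Λ` is the upper bound of `count-upper` for the k-tuples through an edge, so the uniform weight
  -- `w₀` puts at most 1 on every edge. `Q` is the number of extensions guaranteed to each clique;
  -- `count-lower` is applied with it in place of its own `q`.
  Q Λ w₀ : ℚ
  Q  = q * ι v
  Λ  = L (ι v) k t
  w₀ = recip Λ

  0<Q : 0ℚ < Q
  0<Q = 0<* 0<q 0<v

  0≤Q : 0ℚ ≤ Q
  0≤Q = ℚ.<⇒≤ 0<Q

  0<Λ : 0ℚ < Λ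
  0<Λ = L-pos 0<v t≤k

  w₀Λ≡1 : w₀ * Λ ≡ 1ℚ
  w₀Λ≡1 = recip-inverse (0<⇒≢0 0<Λ)

  -- The weight missing at T, shared equally among the orderings of T.
  γ : Subset v → ℚ
  γ T = ind (∣ T ∣ ≟ⁿ t) * ((1ℚ - w₀ * count ⊥ T k) * recip (count ⊥ T t))

  cliquesThrough : List (Fin v) → ℚ
  cliquesThrough τ = ∑ (words v k) (λ z → ind (ok? ⊥ (τ ++ z)))

  -- The gadget `y` repairs the edge listed by its first `t` entries. Summed over all gadgets (of
  -- length t + k) for the orderings of one edge, these weights give exactly the deficit of that
  -- edge.
  gadgetWeight : List (Fin v) → ℚ
  gadgetWeight y = ind (ok? ⊥ y) * (γ (span ⊥ (take t y)) * recip (cliquesThrough (take t y)))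

  f : Subset (t +ⁿ k) → ℚ
  f = schemeWeight t k φ

  -- The gadgets with `x` in the positions `K` are the tuples `merge K x u`. If `K` does not have
  -- size `k`, `merge` may return junk, but then `f K` is 0.
  correction : List (Fin v) → ℚ
  correction x = ∑ (subsets (t +ⁿ k)) (λ K → f K * ∑ (words v t) (λ u → gadgetWeight (merge K x u)))

  weight : List (Fin v) → ℚ
  weight x = w₀ + correction x

  -- This is `count-lower` with nothing left to cover; the clique grows up to t + k vertices, which
  -- is why `extensions` is assumed to that size.
  cliquesThrough-≥ : ∀ τ → length τ ≤ⁿ t → Ok ⊥ τ → pow Q k ≤ cliquesThrough τ
  cliquesThrough-≥ τ ∣τ∣≤t ok = begin
    pow Q k
      ≡⟨ trans (sym (L-pow Q k)) (cong (L Q k) (sym (∣⊥∣≡0 v))) ⟩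
    L Q k ∣ ⊥ {n = v} ∣
      ≤⟨ count-lower 0≤Q extensions k (span ⊥ τ) ⊥
           (Clique-⊆ (λ b∈ → case x∈p∪q⁻ (span ⊥ τ) ⊥ b∈ of λ where
             (inj₁ b∈τ) → b∈τ
             (inj₂ b∈⊥) → contradiction b∈⊥ ∉⊥) (Ok⇒Clique τ ok))
           (λ a∈⊥ → contradiction a∈⊥ ∉⊥)
           (ℕ.+-monoˡ-≤ k (ℕ.≤-trans (∣span∣ ⊥ τ) (subst (λ n → n +ⁿ length τ ≤ⁿ t) (sym (∣⊥∣≡0 v)) ∣τ∣≤t))) ⟩
    count (span ⊥ τ) ⊥ k
      ≡⟨ ∑-cong (words v k) (λ {z} _ → trans
           (trans (cong (ind (ok? (span ⊥ τ) z) *_) (ind-yes (covers? ⊥ z) (Covers-⊥ z)))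
             (ℚ.*-identityʳ (ind (ok? (span ⊥ τ) z))))
           (sym (ok?-++ τ z ok))) ⟩
    cliquesThrough τ ∎
    where open ℚ.≤-Reasoning

  module _ {T : Subset v} (cl : Clique T) (∣T∣≡t : ∣ T ∣ ≡ t) where

    count-≥ : ∀ m → m ≤ⁿ t +ⁿ k → L Q m t ≤ count ⊥ T m
    count-≥ m m≤ = subst (λ s → L Q m s ≤ count ⊥ T m) ∣T∣≡t
      (count-lower 0≤Q extensions m ⊥ T
        (Clique-⊆ (λ b∈ → case x∈p∪q⁻ ⊥ T b∈ of λ where
          (inj₁ b∈⊥) → contradiction b∈⊥ ∉⊥
          (inj₂ b∈T) → b∈T) cl)
        (λ _ → ∉⊥)
        (subst (λ n → n +ⁿ m ≤ⁿ t +ⁿ k) (sym (∣⊥∣≡0 v)) m≤))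

    -- The exact value is t!, and already the bound 1 shows that the share of one ordering does not
    -- exceed the whole deficit.
    1≤orderings : 1ℚ ≤ count ⊥ T t
    1≤orderings = ℚ.≤-trans (1≤L 0≤Q t) (count-≥ t (ℕ.m≤m+n t k))

    deficit-nonNeg : 0ℚ ≤ 1ℚ - w₀ * count ⊥ T k
    deficit-nonNeg = p≤q⇒0≤q-p (subst (w₀ * count ⊥ T k ≤_) w₀Λ≡1
      (*-monoʳ-≤ (recip-nonNeg (ℚ.<⇒≤ 0<Λ))
        (subst (λ s → count ⊥ T k ≤ L (ι v) k s) ∣T∣≡t (count-upper k ⊥ T))))

    -- `count-lower` and `L-scale` give at least L(q v) ≥ q^k L(v) = q^k `Λ` tuples through `T`, so
    -- its uniform total is at least q^k.
    deficit-≤ : 1ℚ - w₀ * count ⊥ T k ≤ 1ℚ - pow q k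
    deficit-≤ = ℚ.+-monoʳ-≤ 1ℚ (ℚ.neg-antimono-≤ (begin
      pow q k              ≡⟨ trans (sym (ℚ.*-identityʳ (pow q k))) (cong (pow q k *_) (sym w₀Λ≡1)) ⟩
      pow q k * (w₀ * Λ)   ≡⟨ lemma (pow q k) w₀ Λ ⟩
      w₀ * (pow q k * Λ)   ≤⟨ *-monoʳ-≤ (recip-nonNeg (ℚ.<⇒≤ 0<Λ))
                                (ℚ.≤-trans (L-scale (ℚ.<⇒≤ 0<v) (ℚ.<⇒≤ 0<q) q≤1 k t) (count-≥ k (ℕ.m≤n+m k t))) ⟩
      w₀ * count ⊥ T k     ∎))
      where
      open ℚ.≤-Reasoning
      lemma : ∀ x y z → x * (y * z) ≡ y * (x * z)
      lemma = solve-∀ ℚ-ring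

    γ-nonNeg : 0ℚ ≤ γ T
    γ-nonNeg = 0≤* (ind-nonNeg (∣ T ∣ ≟ⁿ t))
      (0≤* deficit-nonNeg (recip-nonNeg (ℚ.≤-trans 0≤1 1≤orderings)))

    γ-≤ : γ T ≤ 1ℚ - pow q k
    γ-≤ = begin
      γ T                               ≤⟨ *-mono-≤ (ind-nonNeg (∣ T ∣ ≟ⁿ t)) (0≤* 0≤1-q^k 0≤1) (ind-≤1 (∣ T ∣ ≟ⁿ t))
                                             (*-mono-≤ deficit-nonNeg 0≤1 deficit-≤ (recip-antitone 0<1 1≤orderings)) ⟩
      1ℚ * ((1ℚ - pow q k) * 1ℚ)        ≡⟨ lemma (1ℚ - pow q k) ⟩
      1ℚ - pow q k                      ∎
      where
      open ℚ.≤-Reasoning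
      0≤1-q^k : 0ℚ ≤ 1ℚ - pow q k
      0≤1-q^k = p≤q⇒0≤q-p (pow-≤1 k (ℚ.<⇒≤ 0<q) q≤1)
      lemma : ∀ x → 1ℚ * (x * 1ℚ) ≡ x
      lemma = solve-∀ ℚ-ring

    orderings*γ : count ⊥ T t * γ T ≡ 1ℚ - w₀ * count ⊥ T k
    orderings*γ = trans
      (cong (λ x → n * (x * (d * recip n))) (ind-yes (∣ T ∣ ≟ⁿ t) ∣T∣≡t))
      (trans (lemma n d (recip n)) (trans
        (cong (d *_) (recip-inverse (0<⇒≢0 (ℚ.<-≤-trans 0<1 1≤orderings)))) (ℚ.*-identityʳ d)))
      where
      n d : ℚ
      n = count ⊥ T t
      d = 1ℚ - w₀ * count ⊥ T k
      lemma : ∀ n d r → n * (1ℚ * (d * r)) ≡ d * (r * n)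
      lemma = solve-∀ ℚ-ring

  gadgetBound : ℚ
  gadgetBound = (1ℚ - pow q k) * recip (pow Q k)

  0≤1-q^k : 0ℚ ≤ 1ℚ - pow q k
  0≤1-q^k = p≤q⇒0≤q-p (pow-≤1 k (ℚ.<⇒≤ 0<q) q≤1)

  0≤gadgetBound : 0ℚ ≤ gadgetBound
  0≤gadgetBound = 0≤* 0≤1-q^k (recip-nonNeg (pow-nonNeg k 0≤Q))

  gadgetWeight-bounds : ∀ y → 0ℚ ≤ gadgetWeight y × gadgetWeight y ≤ gadgetBound
  gadgetWeight-bounds y = bounds (ok? ⊥ y) (∣ span ⊥ τ ∣ ≟ⁿ t)
    where
    τ : List (Fin v)
    τ = take t y
    zero-bounds : ∀ {x} → x ≡ 0ℚ → 0ℚ ≤ x × x ≤ gadgetBound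
    zero-bounds refl = ℚ.≤-refl , 0≤gadgetBound
    bounds : Dec (Ok ⊥ y) → Dec (∣ span ⊥ τ ∣ ≡ t) → 0ℚ ≤ gadgetWeight y × gadgetWeight y ≤ gadgetBound
    bounds (no ¬ok) _ = zero-bounds (trans
      (cong (_* (γ (span ⊥ τ) * recip (cliquesThrough τ))) (ind-no (ok? ⊥ y) ¬ok))
      (ℚ.*-zeroˡ (γ (span ⊥ τ) * recip (cliquesThrough τ))))
    -- This happens only if `y` has fewer than `t` entries, as a junk value of `merge` may; the
    -- indicator in `γ` then makes the weight 0.
    bounds (yes ok) (no ∣τ∣≢t) = zero-bounds (trans
      (cong (λ x → ind (ok? ⊥ y) * (x * c * recip (cliquesThrough τ)))
        (ind-no (∣ span ⊥ τ ∣ ≟ⁿ t) ∣τ∣≢t))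
      (lemma (ind (ok? ⊥ y)) c (recip (cliquesThrough τ))))
      where
      c : ℚ
      c = (1ℚ - w₀ * count ⊥ (span ⊥ τ) k) * recip (count ⊥ (span ⊥ τ) t)
      lemma : ∀ x y z → x * (0ℚ * y * z) ≡ 0ℚ
      lemma = solve-∀ ℚ-ring
    bounds (yes ok) (yes ∣τ∣≡t) =
      0≤* (ind-nonNeg (ok? ⊥ y)) (0≤* γ≥0 (recip-nonNeg (ℚ.<⇒≤ 0<D))) ,
      subst (gadgetWeight y ≤_) (ℚ.*-identityˡ gadgetBound)
        (*-mono-≤ (ind-nonNeg (ok? ⊥ y)) 0≤gadgetBound (ind-≤1 (ok? ⊥ y))
          (*-mono-≤ γ≥0 (recip-nonNeg (pow-nonNeg k 0≤Q)) (γ-≤ cl ∣τ∣≡t) (recip-antitone (pow-pos k 0<Q) D≥)))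
      where
      okτ : Ok ⊥ τ
      okτ = Ok-⊑ {p = ⊥} (take-⊆ t y) (λ b∈ → b∈) ok
      cl : Clique (span ⊥ τ)
      cl = Ok⇒Clique τ okτ
      γ≥0 : 0ℚ ≤ γ (span ⊥ τ)
      γ≥0 = γ-nonNeg cl ∣τ∣≡t
      D≥ : pow Q k ≤ cliquesThrough τ
      D≥ = cliquesThrough-≥ τ (subst (_≤ⁿ t) (sym (length-take t y)) (ℕ.m⊓n≤m t (length y))) okτ
      0<D : 0ℚ < cliquesThrough τ
      0<D = ℚ.<-≤-trans (pow-pos k 0<Q) D≥

  -- The correction is at least -`B`, where `B` = 2^t v^t (1 - q^k) / (q v)^k, while `L-upper` gives
  -- `w₀` ≥ v^t / (k^t v^k). The quotient of the two is at most 2^t k^t (1 - q^k) / q^k, which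
  -- `small` keeps below 1.
  weight-pos : ∀ x → 0ℚ < weight x
  weight-pos x = ℚ.<-≤-trans 0<w₀-B (ℚ.+-monoʳ-≤ w₀ (begin
    - B                                                 ≡⟨ ℚ.neg-distribˡ-* (pow (ι 2) t) b ⟩
    - pow (ι 2) t * b                                   ≤⟨ *-monoˡ-≤ 0≤b (ℚ.neg-antimono-≤ (∑-∣schemeWeight∣ iso)) ⟩
    - ∑ Ks (λ K → abs (f K)) * b                        ≡⟨ lemma (∑ Ks (λ K → abs (f K))) b ⟩
    ∑ Ks (λ K → abs (f K)) * - b                        ≡⟨ ∑-*ʳ Ks (- b) (λ K → abs (f K)) ⟨
    ∑ Ks (λ K → abs (f K) * - b)                        ≤⟨ ∑-mono Ks (λ {K} _ → term K) ⟩
    correction x                                        ∎))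
    where
    open ℚ.≤-Reasoning
    Ks : List (Subset (t +ⁿ k))
    Ks = subsets (t +ⁿ k)
    b B V : ℚ
    b = pow (ι v) t * gadgetBound
    B = pow (ι 2) t * b
    V = pow (ι v) k
    0≤b : 0ℚ ≤ b
    0≤b = 0≤* (pow-nonNeg t (ι-nonNeg v)) 0≤gadgetBound
    lemma : ∀ x y → - x * y ≡ x * - y
    lemma = solve-∀ ℚ-ring
    term : ∀ K → abs (f K) * - b ≤ f K * ∑ (words v t) (λ u → gadgetWeight (merge K x u))
    term K = begin
      abs (f K) * - b    ≡⟨ lemma (abs (f K)) b ⟨
      - abs (f K) * b    ≡⟨ ℚ.neg-distribˡ-* (abs (f K)) b ⟨
      - (abs (f K) * b)  ≤⟨ ℚ.neg-antimono-≤ (*-monoʳ-≤ (ℚ.0≤∣p∣ (f K)) s≤b) ⟩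
      - (abs (f K) * s)  ≡⟨ ℚ.neg-distribˡ-* (abs (f K)) s ⟩
      - abs (f K) * s    ≤⟨ *-monoˡ-≤ 0≤s (-∣p∣≤p (f K)) ⟩
      f K * s            ∎
      where
      s : ℚ
      s = ∑ (words v t) (λ u → gadgetWeight (merge K x u))
      0≤s : 0ℚ ≤ s
      0≤s = ∑-nonNeg (words v t) λ {u} _ → proj₁ (gadgetWeight-bounds (merge K x u))
      s≤b : s ≤ b
      s≤b = subst (s ≤_) (∑-words-const t gadgetBound)
        (∑-mono (words v t) λ {u} _ → proj₂ (gadgetWeight-bounds (merge K x u)))
    B<w₀ : B < w₀
    -- Multiplying by (q v)^k `Λ` clears the denominators of both `B` and `w₀`.
    B<w₀ = *-cancelʳ-< (0≤* (pow-nonNeg k 0≤Q) (ℚ.<⇒≤ 0<Λ)) (begin-strict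
      B * (pow Q k * Λ)
        ≡⟨ regroup (pow (ι 2) t) (pow (ι v) t) (1ℚ - pow q k) (recip (pow Q k)) (pow Q k) Λ ⟩
      pow (ι 2) t * (1ℚ - pow q k) * (recip (pow Q k) * pow Q k) * (Λ * pow (ι v) t)
        ≡⟨ cong (λ r → pow (ι 2) t * (1ℚ - pow q k) * r * (Λ * pow (ι v) t)) (recip-inverse (0<⇒≢0 (pow-pos k 0<Q))) ⟩
      pow (ι 2) t * (1ℚ - pow q k) * 1ℚ * (Λ * pow (ι v) t)
        ≤⟨ *-monoʳ-≤ (0≤* (0≤* (pow-nonNeg t (ι-nonNeg 2)) 0≤1-q^k) 0≤1) (L-upper (ι-nonNeg v) k t) ⟩
      pow (ι 2) t * (1ℚ - pow q k) * 1ℚ * (pow (ι k) t * V)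
        ≡⟨ regroup₂ (pow (ι 2) t) (1ℚ - pow q k) (pow (ι k) t) V ⟩
      pow (ι 2) t * pow (ι k) t * (1ℚ - pow q k) * V
        <⟨ ℚ.*-monoˡ-<-pos V {{positive (pow-pos k 0<v)}} small ⟩
      pow q k * V
        ≡⟨ pow-* q (ι v) k ⟨
      pow Q k
        ≡⟨ trans (sym (ℚ.*-identityʳ (pow Q k))) (cong (pow Q k *_) (sym w₀Λ≡1)) ⟩
      pow Q k * (w₀ * Λ)
        ≡⟨ regroup₃ (pow Q k) w₀ Λ ⟩
      w₀ * (pow Q k * Λ) ∎)
      where
      regroup : ∀ a c d r y l → a * (c * (d * r)) * (y * l) ≡ a * d * (r * y) * (l * c)
      regroup = solve-∀ ℚ-ring
      regroup₂ : ∀ a d m V → a * d * 1ℚ * (m * V) ≡ a * m * d * V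
      regroup₂ = solve-∀ ℚ-ring
      regroup₃ : ∀ y w l → y * (w * l) ≡ w * (y * l)
      regroup₃ = solve-∀ ℚ-ring
    0<w₀-B : 0ℚ < w₀ - B
    0<w₀-B = subst (_< w₀ - B) (ℚ.+-inverseʳ B) (ℚ.+-monoˡ-< (- B) B<w₀)

  module _ {T : Subset v} (T∈E : T ∈ TGraph.edges G) where

    ∣T∣≡t : ∣ T ∣ ≡ t
    ∣T∣≡t = All.lookup (TGraph.uniform G) T∈E

    edge-Clique : Clique T
    edge-Clique e ∣e∣≡t e⊆T =
      subst (_∈ TGraph.edges G) (sym (⊆∧∣∣≤⇒≡ e⊆T (ℕ.≤-reflexive (trans ∣T∣≡t (sym ∣e∣≡t))))) T∈E

    at : List (Fin v) → ℚ
    at x = ind (ok? ⊥ x) * ind (covers? T x)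

    Ks : List (Subset (t +ⁿ k))
    Ks = subsets (t +ⁿ k)

    swap-sums : ∀ (xs : List (List (Fin v))) (a : List (Fin v) → ℚ) (g : Subset (t +ⁿ k) → List (Fin v) → ℚ) →
      ∑ xs (λ x → a x * ∑ Ks (λ K → f K * g K x)) ≡ ∑ Ks (λ K → f K * ∑ xs (λ x → a x * g K x))
    swap-sums xs a g = begin
      ∑ xs (λ x → a x * ∑ Ks (λ K → f K * g K x))
        ≡⟨ ∑-cong xs (λ {x} _ → sym (∑-*ˡ Ks (a x) (λ K → f K * g K x))) ⟩
      ∑ xs (λ x → ∑ Ks (λ K → a x * (f K * g K x)))
        ≡⟨ ∑-swap xs Ks (λ x K → a x * (f K * g K x)) ⟩
      ∑ Ks (λ K → ∑ xs (λ x → a x * (f K * g K x)))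
        ≡⟨ ∑-cong Ks (λ {K} _ → trans
             (∑-cong xs λ {x} _ → lemma (a x) (f K) (g K x))
             (∑-*ˡ xs (f K) (λ x → a x * g K x))) ⟩
      ∑ Ks (λ K → f K * ∑ xs (λ x → a x * g K x)) ∎
      where
      open ≡-Reasoning
      lemma : ∀ x y z → x * (y * z) ≡ y * (x * z)
      lemma = solve-∀ ℚ-ring

    -- For ∣K∣ = k the complement has `t` positions and `∑-words-split` applies. For other sizes the
    -- tuple lengths do not match, so `f K` is kept as a factor to make both sides 0.
    split-gadget : ∀ K →
      f K * ∑ (words v k) (λ x → at x * ∑ (words v t) (λ u → gadgetWeight (merge K x u))) ≡
      f K * ∑ (words v (t +ⁿ k)) (λ y → at (select K y) * gadgetWeight y)
    split-gadget K with ∣ K ∣ ≟ⁿ k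
    ... | no ∣K∣≢k = trans (vanish X) (sym (vanish Y))
      where
      X Y : ℚ
      X = ∑ (words v k) (λ x → at x * ∑ (words v t) (λ u → gadgetWeight (merge K x u)))
      Y = ∑ (words v (t +ⁿ k)) (λ y → at (select K y) * gadgetWeight y)
      vanish : ∀ x → f K * x ≡ 0ℚ
      vanish x = trans (cong (λ i → φ ∣ Vec.take t K ∣ * i * x) (ind-no (∣ K ∣ ≟ⁿ k) ∣K∣≢k))
        (lemma (φ ∣ Vec.take t K ∣) x)
        where
        lemma : ∀ a b → a * 0ℚ * b ≡ 0ℚ
        lemma = solve-∀ ℚ-ring
    ... | yes ∣K∣≡k = cong (f K *_) (begin
      ∑ (words v k) (λ x → at x * ∑ (words v t) (λ u → gadgetWeight (merge K x u)))
        ≡⟨ cong₂ (λ m n → ∑ (words v m) (λ x → at x * ∑ (words v n) (λ u → gadgetWeight (merge K x u))))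
             (sym ∣K∣≡k) (sym (∁-size t K ∣K∣≡k)) ⟩
      ∑ (words v ∣ K ∣) (λ x → at x * ∑ (words v ∣ ∁ K ∣) (λ u → gadgetWeight (merge K x u)))
        ≡⟨ ∑-cong (words v ∣ K ∣) (λ {x} _ → sym (∑-*ˡ (words v ∣ ∁ K ∣) (at x) (λ u → gadgetWeight (merge K x u)))) ⟩
      ∑ (words v ∣ K ∣) (λ x → ∑ (words v ∣ ∁ K ∣) (λ u → at x * gadgetWeight (merge K x u)))
        ≡⟨ ∑-words-split K (λ x y → at x * gadgetWeight y) ⟨
      ∑ (words v (t +ⁿ k)) (λ y → at (select K y) * gadgetWeight y) ∎)
      where open ≡-Reasoning

    share : List (Fin v) → ℚ
    share τ = γ (span ⊥ τ) * recip (cliquesThrough τ)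

    -- If the gadget is a clique then so is each of its sub-tuples. Hence `at` reduces to covering
    -- and `∑-isolating` evaluates the sum; if it is not, the indicator in front vanishes.
    isolate : ∀ τ z → length τ ≡ t → length z ≡ k →
      gadgetWeight (τ ++ z) * ∑ Ks (λ K → f K * at (select K (τ ++ z))) ≡
      ind (ok? ⊥ (τ ++ z)) * (share τ * ind (covers? T τ))
    isolate τ z ∣τ∣≡t ∣z∣≡k = begin
      gadgetWeight y * ∑ Ks (λ K → f K * at (select K y))
        ≡⟨ cong (λ τ′ → ind (ok? ⊥ y) * share τ′ * ∑ Ks (λ K → f K * at (select K y))) (take-length-++ τ z ∣τ∣≡t) ⟩
      ind (ok? ⊥ y) * share τ * ∑ Ks (λ K → f K * at (select K y))
        ≡⟨ ℚ.*-assoc (ind (ok? ⊥ y)) (share τ) (∑ Ks (λ K → f K * at (select K y))) ⟩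
      ind (ok? ⊥ y) * (share τ * ∑ Ks (λ K → f K * at (select K y)))
        ≡⟨ ind-guard (ok? ⊥ y) (λ ok → cong (share τ *_) (trans
             (∑-cong Ks λ {K} _ → cong (f K *_) (trans
               (cong (_* ind (covers? T (select K y)))
                 (ind-yes (ok? ⊥ (select K y)) (Ok-⊑ {p = ⊥} (select-⊑ K y) (λ b∈ → b∈) ok)))
               (ℚ.*-identityˡ (ind (covers? T (select K y))))))
             (∑-isolating iso G τ z T ∣τ∣≡t ∣z∣≡k t≤k ∣T∣≡t ok))) ⟩
      ind (ok? ⊥ y) * (share τ * ind (covers? T τ)) ∎
      where
      open ≡-Reasoning
      y : List (Fin v)
      y = τ ++ z

    -- A `t`-tuple covering the t-set `T` spans exactly `T`, and the number of gadgets through `τ`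
    -- cancels its reciprocal in `share`. If `τ` is not a clique there are no gadgets through it,
    -- and both sides are 0.
    cliquesThrough-cancels : ∀ τ → length τ ≡ t →
      cliquesThrough τ * (share τ * ind (covers? T τ)) ≡ at τ * γ T
    cliquesThrough-cancels τ ∣τ∣≡t = case (ok? ⊥ τ) ,′ covers? T τ of λ where
        (no ¬ok , _) → trans
          (trans (cong (_* (share τ * ind (covers? T τ))) (∑-zero (words v k) λ {z} _ →
                   ind-no (ok? ⊥ (τ ++ z)) (¬ok ∘ Ok-⊑ {p = ⊥} (++⁺ʳ z ⊆-refl) (λ b∈ → b∈))))
                 (ℚ.*-zeroˡ (share τ * ind (covers? T τ))))
          (sym (trans (cong (λ x → x * ind (covers? T τ) * γ T) (ind-no (ok? ⊥ τ) ¬ok))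
                      (zero₁ (ind (covers? T τ)) (γ T))))
        (yes _ , no ¬cov) → trans
          (cong (λ x → cliquesThrough τ * (share τ * x)) (ind-no (covers? T τ) ¬cov))
          (trans (zero₂ (cliquesThrough τ) (share τ) (ind (ok? ⊥ τ)) (γ T))
            (sym (cong (λ x → ind (ok? ⊥ τ) * x * γ T) (ind-no (covers? T τ) ¬cov))))
        (yes ok , yes cov) → begin
          D * (γ (span ⊥ τ) * recip D * ind (covers? T τ))
            ≡⟨ cong₂ (λ S x → D * (γ S * recip D * x)) (sym (T≡span cov)) (ind-yes (covers? T τ) cov) ⟩
          D * (γ T * recip D * 1ℚ)
            ≡⟨ regroup D (γ T) (recip D) ⟩
          recip D * D * γ T
            ≡⟨ cong (_* γ T) (recip-inverse (0<⇒≢0 (ℚ.<-≤-trans (pow-pos k 0<Q)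
                 (cliquesThrough-≥ τ (ℕ.≤-reflexive ∣τ∣≡t) ok)))) ⟩
          1ℚ * γ T
            ≡⟨ cong₂ (λ x y → x * y * γ T) (ind-yes (ok? ⊥ τ) ok) (ind-yes (covers? T τ) cov) ⟨
          at τ * γ T ∎
      where
      open ≡-Reasoning
      D : ℚ
      D = cliquesThrough τ
      zero₁ : ∀ x y → 0ℚ * x * y ≡ 0ℚ
      zero₁ = solve-∀ ℚ-ring
      zero₂ : ∀ x y z w → x * (y * 0ℚ) ≡ z * 0ℚ * w
      zero₂ = solve-∀ ℚ-ring
      regroup : ∀ d g r → d * (g * r * 1ℚ) ≡ r * d * g
      regroup = solve-∀ ℚ-ring
      T≡span : Covers T τ → T ≡ span ⊥ τ
      T≡span cov = ⊆∧∣∣≤⇒≡ (Covers⇒⊆span τ cov) (ℕ.≤-trans (∣span∣ ⊥ τ)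
        (ℕ.≤-reflexive (trans (cong (_+ⁿ length τ) (∣⊥∣≡0 v)) (trans ∣τ∣≡t (sym ∣T∣≡t)))))

    -- Exchanging sums collects the correction gadget by gadget. At `T` a gadget contributes its
    -- weight if its first `t` entries list `T`, and 0 otherwise, so what remains is the deficit of
    -- `T` distributed over its orderings.
    correction-total : ∑ (words v k) (λ x → at x * correction x) ≡ 1ℚ - w₀ * count ⊥ T k
    correction-total = begin
      ∑ (words v k) (λ x → at x * correction x)
        ≡⟨ swap-sums (words v k) at (λ K x → ∑ (words v t) (λ u → gadgetWeight (merge K x u))) ⟩
      ∑ Ks (λ K → f K * ∑ (words v k) (λ x → at x * ∑ (words v t) (λ u → gadgetWeight (merge K x u))))
        ≡⟨ ∑-cong Ks (λ {K} _ → trans (split-gadget K) (cong (f K *_)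
             (∑-cong (words v (t +ⁿ k)) λ {y} _ → ℚ.*-comm (at (select K y)) (gadgetWeight y)))) ⟩
      ∑ Ks (λ K → f K * ∑ (words v (t +ⁿ k)) (λ y → gadgetWeight y * at (select K y)))
        ≡⟨ swap-sums (words v (t +ⁿ k)) gadgetWeight (λ K y → at (select K y)) ⟨
      ∑ (words v (t +ⁿ k)) (λ y → gadgetWeight y * ∑ Ks (λ K → f K * at (select K y)))
        ≡⟨ ∑-words-+ t k (λ y → gadgetWeight y * ∑ Ks (λ K → f K * at (select K y))) ⟩
      ∑ (words v t) (λ τ → ∑ (words v k) (λ z → gadgetWeight (τ ++ z) * ∑ Ks (λ K → f K * at (select K (τ ++ z)))))
        ≡⟨ ∑-cong (words v t) (λ {τ} τ∈ → trans
             (∑-cong (words v k) λ {z} z∈ → isolate τ z (words-length t τ∈) (words-length k z∈))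
             (trans (∑-*ʳ (words v k) (share τ * ind (covers? T τ)) (λ z → ind (ok? ⊥ (τ ++ z))))
               (cliquesThrough-cancels τ (words-length t τ∈)))) ⟩
      ∑ (words v t) (λ τ → at τ * γ T)
        ≡⟨ ∑-*ʳ (words v t) (γ T) at ⟩
      count ⊥ T t * γ T
        ≡⟨ orderings*γ edge-Clique ∣T∣≡t ⟩
      1ℚ - w₀ * count ⊥ T k ∎
      where open ≡-Reasoning

    weight-total : ∑ (words v k) (λ x → at x * weight x) ≡ 1ℚ
    weight-total = begin
      ∑ (words v k) (λ x → at x * (w₀ + correction x))
        ≡⟨ ∑-cong (words v k) (λ {x} _ → ℚ.*-distribˡ-+ (at x) w₀ (correction x)) ⟩
      ∑ (words v k) (λ x → at x * w₀ + at x * correction x)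
        ≡⟨ ∑-+ (words v k) (λ x → at x * w₀) (λ x → at x * correction x) ⟩
      ∑ (words v k) (λ x → at x * w₀) + ∑ (words v k) (λ x → at x * correction x)
        ≡⟨ cong₂ _+_ (∑-*ʳ (words v k) w₀ at) correction-total ⟩
      count ⊥ T k * w₀ + (1ℚ - w₀ * count ⊥ T k)
        ≡⟨ lemma (count ⊥ T k) w₀ ⟩
      1ℚ ∎
      where
      open ≡-Reasoning
      lemma : ∀ n w → n * w + (1ℚ - w * n) ≡ 1ℚ
      lemma = solve-∀ ℚ-ring

  decomposition : FractionalDecomposition (complete t k) G
  decomposition = record
    { family   = family
    ; copies   = map⁺ (All.tabulate λ {x} x∈ → let x∈words , ok = ∈-filter⁻ (ok? ⊥) {xs = words v k} x∈ in
                   complete≅induced x (words-length k x∈words) ok)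
    ; positive = map⁺ (All.tabulate λ {x} _ → weight-pos x)
    ; total    = total
    }
    where
    open ≡-Reasoning
    good : List (List (Fin v))
    good = filter (ok? ⊥) (words v k)
    family : List (Subgraph G × ℚ)
    family = map (λ x → induced x , weight x) good
    total : ∀ T → T ∈ TGraph.edges G → weightAt family T ≡ 1ℚ
    total T T∈E = begin
      weightAt family T
        ≡⟨ ∑-filter (λ p → T ∈? Subgraph.edges (proj₁ p)) family proj₂ ⟩
      ∑ family (λ p → ind (T ∈? Subgraph.edges (proj₁ p)) * proj₂ p)
        ≡⟨ ∑-map (λ x → induced x , weight x) good (λ p → ind (T ∈? Subgraph.edges (proj₁ p)) * proj₂ p) ⟩
      ∑ good (λ x → ind (T ∈? Subgraph.edges (induced x)) * weight x)
        ≡⟨ ∑-filter (ok? ⊥) (words v k) (λ x → ind (T ∈? Subgraph.edges (induced x)) * weight x) ⟩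
      ∑ (words v k) (λ x → ind (ok? ⊥ x) * (ind (T ∈? Subgraph.edges (induced x)) * weight x))
        ≡⟨ ∑-cong (words v k) (λ {x} _ → trans
             (sym (ℚ.*-assoc (ind (ok? ⊥ x)) (ind (T ∈? Subgraph.edges (induced x))) (weight x)))
             (cong (λ i → ind (ok? ⊥ x) * i * weight x) (ind-cong (T ∈? Subgraph.edges (induced x)) (covers? T x)
               (λ T∈ → ⊆span⇒Covers x (λ _ → ∉⊥) (proj₂ (∈-filter⁻ (_⊆? span ⊥ x) {xs = TGraph.edges G} T∈)))
               (λ cov → ∈-filter⁺ (_⊆? span ⊥ x) T∈E (Covers⇒⊆span x cov))))) ⟩
      ∑ (words v k) (λ x → ind (ok? ⊥ x) * ind (covers? T x) * weight x)
        ≡⟨ weight-total T∈E ⟩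
      1ℚ ∎

-- Choice of constants

-- A clique with at most t + k vertices is extended by all but a proportion
-- 1 / scale t k of the vertices.
scale : ℕ → ℕ → ℕ
scale t k = 4 *ⁿ (2 ^ t *ⁿ k ^ suc t)

-- Since t + k ≤ 2k, the powers of k are k^(t + 1) from `scale` and k^(t - 1) from the (t -
-- 1)-subsets of a clique. This is where the exponent 2t arises; the constants combine to 8 · 2^t ·
-- 2^(t - 1) = 4 · 4^t.
scale-product : ∀ t k → 1 ≤ⁿ t → t ≤ⁿ k →
  2 *ⁿ scale t k *ⁿ (t +ⁿ k) ^ (t ∸ 1) ≤ⁿ 4 *ⁿ 4 ^ t *ⁿ k ^ (2 *ⁿ t)
scale-product (suc s) k _ t≤k = begin
  2 *ⁿ scale t k *ⁿ (t +ⁿ k) ^ s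
    ≤⟨ ℕ.*-monoʳ-≤ (2 *ⁿ scale t k) (ℕ.^-monoˡ-≤ s (ℕ.≤-trans (ℕ.+-monoˡ-≤ k t≤k)
         (ℕ.≤-reflexive (cong (k +ⁿ_) (sym (ℕ.+-identityʳ k)))))) ⟩
  2 *ⁿ scale t k *ⁿ (2 *ⁿ k) ^ s
    ≡⟨ cong (2 *ⁿ scale t k *ⁿ_) (^-distrib-* 2 k s) ⟩
  2 *ⁿ (4 *ⁿ (2 *ⁿ 2 ^ s *ⁿ (k *ⁿ (k *ⁿ k ^ s)))) *ⁿ (2 ^ s *ⁿ k ^ s)
    ≡⟨ lemma (2 ^ s) k (k ^ s) ⟩
  4 *ⁿ (4 *ⁿ (2 ^ s *ⁿ 2 ^ s)) *ⁿ ((k *ⁿ k ^ s) *ⁿ (k *ⁿ k ^ s))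
    ≡⟨ cong₂ (λ x y → 4 *ⁿ (4 *ⁿ x) *ⁿ y) (sym (^-distrib-* 2 2 s))
         (trans (sym (ℕ.^-distribˡ-+-* k t t)) (cong (λ n → k ^ (t +ⁿ n)) (sym (ℕ.+-identityʳ t)))) ⟩
  4 *ⁿ 4 ^ t *ⁿ k ^ (2 *ⁿ t) ∎
  where
  open ℕ.≤-Reasoning
  t : ℕ
  t = suc s
  ^-distrib-* : ∀ m n s → (m *ⁿ n) ^ s ≡ m ^ s *ⁿ n ^ s
  ^-distrib-* m n zero    = refl
  ^-distrib-* m n (suc s) = trans (cong (m *ⁿ n *ⁿ_) (^-distrib-* m n s)) (rearrange m n (m ^ s) (n ^ s))
    where
    rearrange : ∀ a b c d → a *ⁿ b *ⁿ (c *ⁿ d) ≡ a *ⁿ c *ⁿ (b *ⁿ d)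
    rearrange = ℕ-Solver.solve-∀
  lemma : ∀ p k r → 2 *ⁿ (4 *ⁿ (2 *ⁿ p *ⁿ (k *ⁿ (k *ⁿ r)))) *ⁿ (p *ⁿ r) ≡
                    4 *ⁿ (4 *ⁿ (p *ⁿ p)) *ⁿ ((k *ⁿ r) *ⁿ (k *ⁿ r))
  lemma = ℕ-Solver.solve-∀

-- With β = 1 / `scale t k`, density and the size of `v` must ensure that at most β v vertices fail
-- to extend a clique (`loss`), and β must be small enough for the weights to stay positive
-- (`small`).
dense⇒decomposition : ∀ t k v → 1 ≤ⁿ t → t ≤ⁿ k → 2 *ⁿ scale t k *ⁿ (t +ⁿ k) <ⁿ v →
  ∀ {ε ε′} → ε ≤ ε′ → ε′ * ι (4 *ⁿ 4 ^ t *ⁿ k ^ (2 *ⁿ t)) ≡ 1ℚ → 0ℚ ≤ ε′ →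
  (G : TGraph t v) → Dense ε G → FractionalDecomposition (complete t k) G
dense⇒decomposition t k v 1≤t t≤k v₀<v {ε} {ε′} ε≤ε′ ε′E≡1 0≤ε′ G dense =
  Weighting.decomposition G t≤k (proj₂ (isolating t k t≤k)) 0<v 0<q q≤1 extensions small
  where
  open Graph G
  open Counting G using (extends?)
  open Extension G 1≤t
  N m : ℕ
  N = t +ⁿ k
  m = 2 ^ t *ⁿ k ^ t
  instance
    k≢0 : NonZero k
    k≢0 = >-nonZero (ℕ.≤-trans 1≤t t≤k)
    2^t≢0 : NonZero (2 ^ t)
    2^t≢0 = ℕ.m^n≢0 2 t
    k^t≢0 : NonZero (k ^ t)
    k^t≢0 = ℕ.m^n≢0 k t
    k^1+t≢0 : NonZero (k ^ suc t)
    k^1+t≢0 = ℕ.m^n≢0 k (suc t)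
    product≢0 : NonZero (2 ^ t *ⁿ k ^ suc t)
    product≢0 = ℕ.m*n≢0 (2 ^ t) (k ^ suc t)
    scale≢0 : NonZero (scale t k)
    scale≢0 = ℕ.m*n≢0 4 (2 ^ t *ⁿ k ^ suc t)
    2scale≢0 : NonZero (2 *ⁿ scale t k)
    2scale≢0 = ℕ.m*n≢0 2 (scale t k)
    m≢0 : NonZero m
    m≢0 = ℕ.m*n≢0 (2 ^ t) (k ^ t)
  A a X β q : ℚ
  A = ι (scale t k)
  a = ι (2 *ⁿ scale t k)
  β = recip A
  q = 1ℚ - β
  -- `scale` is chosen so that `X` = 2^t k^t · k β = 1/4. Bernoulli's inequality gives 1 - q^k ≤ k
  -- β, so the left side of `small` is at most 1/4 while q^k ≥ 1 - k β ≥ 3/4.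
  X = ι m * (ι k * β)
  0<A : 0ℚ < A
  0<A = ι-pos (>-nonZero⁻¹ (scale t k))
  0<a : 0ℚ < a
  0<a = ι-pos (>-nonZero⁻¹ (2 *ⁿ scale t k))
  0<β : 0ℚ < β
  0<β = recip-pos 0<A
  βA≡1 : β * A ≡ 1ℚ
  βA≡1 = recip-inverse (0<⇒≢0 0<A)
  4X≡1 : ι 4 * X ≡ 1ℚ
  4X≡1 = trans (regroup (ι 4) (ι m) (ι k) β) (trans (cong (β *_) (sym A≡)) βA≡1)
    where
    regroup : ∀ c m k β → c * (m * (k * β)) ≡ β * (c * (m * k))
    regroup = solve-∀ ℚ-ring
    A≡ : A ≡ ι 4 * (ι m * ι k)
    A≡ = trans (ι-* 4 (2 ^ t *ⁿ k ^ suc t)) (cong (ι 4 *_) (trans (cong ι (assoc (2 ^ t) k (k ^ t))) (ι-* m k)))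
      where
      assoc : ∀ p k r → p *ⁿ (k *ⁿ r) ≡ p *ⁿ r *ⁿ k
      assoc = ℕ-Solver.solve-∀
  1≤m : 1ℚ ≤ ι m
  1≤m = ι-mono {1} (>-nonZero⁻¹ m)
  1≤k : 1ℚ ≤ ι k
  1≤k = ι-mono {1} (>-nonZero⁻¹ k)
  0≤kβ : 0ℚ ≤ ι k * β
  0≤kβ = 0≤* (ι-nonNeg k) (ℚ.<⇒≤ 0<β)
  kβ≤X : ι k * β ≤ X
  kβ≤X = subst (_≤ X) (ℚ.*-identityˡ (ι k * β)) (*-monoˡ-≤ 0≤kβ 1≤m)
  β≤kβ : β ≤ ι k * β
  β≤kβ = subst (_≤ ι k * β) (ℚ.*-identityˡ β) (*-monoˡ-≤ (ℚ.<⇒≤ 0<β) 1≤k)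
  0<X : 0ℚ < X
  0<X = ℚ.<-≤-trans 0<β (ℚ.≤-trans β≤kβ kβ≤X)
  X<1-X : X < 1ℚ - X
  X<1-X = subst₂ _<_ (ℚ.+-identityʳ X) (trans (lemma X) (cong (_- X) 4X≡1))
    (ℚ.+-monoʳ-< X (0<* (ι-pos {2} (s≤s z≤n)) 0<X))
    where
    lemma : ∀ X → X + (1ℚ + (1ℚ + 0ℚ)) * X ≡ (1ℚ + (1ℚ + (1ℚ + (1ℚ + 0ℚ)))) * X - X
    lemma = solve-∀ ℚ-ring
  1-X≤q : 1ℚ - X ≤ q
  1-X≤q = ℚ.+-monoʳ-≤ 1ℚ (ℚ.neg-antimono-≤ (ℚ.≤-trans β≤kβ kβ≤X))
  0<q : 0ℚ < q
  0<q = ℚ.<-≤-trans (ℚ.<-trans 0<X X<1-X) 1-X≤q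
  q≤1 : q ≤ 1ℚ
  q≤1 = ℚ.≤-trans (ℚ.+-monoʳ-≤ 1ℚ (ℚ.neg-antimono-≤ (ℚ.<⇒≤ 0<β))) (ℚ.≤-reflexive (ℚ.+-identityʳ 1ℚ))
  1-kβ≤q^k : 1ℚ - ι k * β ≤ pow q k
  1-kβ≤q^k = bernoulli (ℚ.<⇒≤ 0<β) (0≤q-p⇒p≤q (ℚ.<⇒≤ 0<q)) k
  small : pow (ι 2) t * pow (ι k) t * (1ℚ - pow q k) < pow q k
  small = begin-strict
    pow (ι 2) t * pow (ι k) t * (1ℚ - pow q k)
      ≡⟨ cong (_* (1ℚ - pow q k)) (trans (ι-* (2 ^ t) (k ^ t)) (cong₂ _*_ (ι-^ 2 t) (ι-^ k t))) ⟨
    ι m * (1ℚ - pow q k)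
      ≤⟨ *-monoʳ-≤ (ι-nonNeg m) (ℚ.≤-trans (ℚ.+-monoʳ-≤ 1ℚ (ℚ.neg-antimono-≤ 1-kβ≤q^k))
           (ℚ.≤-reflexive (lemma (ι k * β)))) ⟩
    X
      <⟨ X<1-X ⟩
    1ℚ - X
      ≤⟨ ℚ.+-monoʳ-≤ 1ℚ (ℚ.neg-antimono-≤ kβ≤X) ⟩
    1ℚ - ι k * β
      ≤⟨ 1-kβ≤q^k ⟩
    pow q k ∎
    where
    open ℚ.≤-Reasoning
    lemma : ∀ x → 1ℚ - (1ℚ - x) ≡ x
    lemma = solve-∀ ℚ-ring
  N≤v : N ≤ⁿ v
  N≤v = ℕ.≤-trans (ℕ.m≤n*m N (2 *ⁿ scale t k)) (ℕ.<⇒≤ v₀<v)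
  0<v : 0ℚ < ι v
  0<v = ι-pos (ℕ.≤-trans (ℕ.≤-trans 1≤t (ℕ.m≤m+n t k)) N≤v)
  μ : ℚ
  μ = ε′ * ι v
  0≤μ : 0ℚ ≤ μ
  0≤μ = 0≤* 0≤ε′ (ι-nonNeg v)
  -- Each summand takes half of β v: the vertices of the clique itself because v > 2 · `scale t k` ·
  -- N, and the missing vertices by `scale-product` and the size of `ε′`.
  loss : ι N + pow (ι N) (t ∸ 1) * μ ≤ β * ι v
  loss = *-cancelʳ-≤ 0<a (begin
    (ι N + pow (ι N) (t ∸ 1) * μ) * a
      ≡⟨ expand (ι N) (pow (ι N) (t ∸ 1)) ε′ (ι v) a ⟩
    a * ι N + ε′ * (a * pow (ι N) (t ∸ 1)) * ι v
      ≡⟨ cong₂ (λ x y → x + ε′ * y * ι v) (sym (ι-* (2 *ⁿ scale t k) N))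
           (trans (cong (a *_) (sym (ι-^ N (t ∸ 1)))) (sym (ι-* (2 *ⁿ scale t k) (N ^ (t ∸ 1))))) ⟩
    ι (2 *ⁿ scale t k *ⁿ N) + ε′ * ι (2 *ⁿ scale t k *ⁿ N ^ (t ∸ 1)) * ι v
      ≤⟨ ℚ.+-mono-≤ (ι-mono (ℕ.<⇒≤ v₀<v))
           (*-monoˡ-≤ (ι-nonNeg v) (*-monoʳ-≤ 0≤ε′ (ι-mono (scale-product t k 1≤t t≤k)))) ⟩
    ι v + ε′ * ι (4 *ⁿ 4 ^ t *ⁿ k ^ (2 *ⁿ t)) * ι v
      ≡⟨ cong (λ x → ι v + x * ι v) (trans ε′E≡1 (sym βA≡1)) ⟩
    ι v + β * A * ι v
      ≡⟨ cong (_+ β * A * ι v) (trans (sym (ℚ.*-identityˡ (ι v))) (cong (_* ι v) (sym βA≡1))) ⟩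
    β * A * ι v + β * A * ι v
      ≡⟨ collect β A (ι v) ⟩
    β * ι v * (ι 2 * A)
      ≡⟨ cong (β * ι v *_) (ι-* 2 (scale t k)) ⟨
    β * ι v * a ∎)
    where
    open ℚ.≤-Reasoning
    expand : ∀ n p ε v a → (n + p * (ε * v)) * a ≡ a * n + ε * (a * p) * v
    expand = solve-∀ ℚ-ring
    collect : ∀ β A v → β * A * v + β * A * v ≡ β * v * ((1ℚ + (1ℚ + 0ℚ)) * A)
    collect = solve-∀ ℚ-ring
  extensions : ∀ S → Clique S → ∣ S ∣ ≤ⁿ N → q * ι v ≤ ∑ (allFin v) (λ a → ind (extends? S a))
  extensions S cl ∣S∣≤N = begin
    q * ι v                       ≡⟨ lemma₁ β (ι v) ⟩
    ι v - β * ι v                 ≤⟨ ℚ.+-monoˡ-≤ (- (β * ι v)) (∑-extensions 0≤μ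
                                       (Dense⇒few-missing dense ε≤ε′ 0≤ε′ (ℕ.≤-trans (ℕ.m≤m+n t k) N≤v)) S cl) ⟩
    Y + (ι ∣ S ∣ + pow (ι ∣ S ∣) (t ∸ 1) * μ) - β * ι v
                                  ≤⟨ ℚ.+-monoˡ-≤ (- (β * ι v)) (ℚ.+-monoʳ-≤ Y (ℚ.≤-trans
                                       (ℚ.+-mono-≤ (ι-mono ∣S∣≤N) (*-monoˡ-≤ 0≤μ
                                         (pow-mono (t ∸ 1) (ι-nonNeg ∣ S ∣) (ι-mono ∣S∣≤N))))
                                       loss)) ⟩
    Y + β * ι v - β * ι v         ≡⟨ lemma₂ Y (β * ι v) ⟩
    Y                             ∎
    where
    open ℚ.≤-Reasoning
    Y : ℚ
    Y = ∑ (allFin v) (λ a → ind (extends? S a))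
    lemma₁ : ∀ β v → (1ℚ - β) * v ≡ v - β * v
    lemma₁ = solve-∀ ℚ-ring
    lemma₂ : ∀ x y → x + y - y ≡ x
    lemma₂ = solve-∀ ℚ-ring

^--inverse : ∀ k m .{{_ : NonZero k}} → k ^- m * ι (k ^ m) ≡ 1ℚ
^--inverse k m = 1/n*n (k ^ m) {{ℕ.m^n≢0 k m}}

theorem1p3 :
    ∀ (t : ℕ) → (2≤t : 2 ≤ⁿ t) →
    ∃[ C ] (0ℚ < C ×
      (∀ (k : ℕ) → (t≤k : t ≤ⁿ k) →
        let instance
              k≢0 : NonZero k
              k≢0 = >-nonZero (≤-trans (≤-trans (s≤s z≤n) 2≤t) t≤k)
        in
        ∃[ v₀ ] (∀ (v : ℕ) → v₀ <ⁿ v →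
          ∀ (ε : ℚ) → ε < C * k ^- (2 *ⁿ t) →
          ∀ (G : TGraph t v) → Dense ε G →
          FractionalDecomposition (complete t k) G)))
theorem1p3 t 2≤t = c , recip-pos 0<4^t , λ k t≤k →
  let instance
        k≢0 : NonZero k
        k≢0 = >-nonZero (≤-trans (≤-trans (s≤s z≤n) 2≤t) t≤k)
  in
  2 *ⁿ scale t k *ⁿ (t +ⁿ k) , λ v v₀<v ε ε<ε′ G dense →
    dense⇒decomposition t k v (≤-trans (s≤s z≤n) 2≤t) t≤k v₀<v (ℚ.<⇒≤ ε<ε′) (unit k) (0≤ε′ k) G dense
  where
  0<4^t : 0ℚ < ι (4 *ⁿ 4 ^ t)
  0<4^t = ι-pos (>-nonZero⁻¹ (4 *ⁿ 4 ^ t) {{ℕ.m*n≢0 4 (4 ^ t) {{_}} {{ℕ.m^n≢0 4 t}}}})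
  c : ℚ
  -- With this constant `c * k ^- (2 *ⁿ t)` is the reciprocal of the bound in `scale-product`.
  c = recip (ι (4 *ⁿ 4 ^ t))
  0≤ε′ : ∀ k .{{_ : NonZero k}} → 0ℚ ≤ c * k ^- (2 *ⁿ t)
  0≤ε′ k = 0≤* (ℚ.<⇒≤ (recip-pos 0<4^t))
    (ℚ.nonNegative⁻¹ _ {{ℚ.normalize-nonNeg 1 (k ^ (2 *ⁿ t)) {{ℕ.m^n≢0 k (2 *ⁿ t)}}}})
  unit : ∀ k .{{_ : NonZero k}} → c * k ^- (2 *ⁿ t) * ι (4 *ⁿ 4 ^ t *ⁿ k ^ (2 *ⁿ t)) ≡ 1ℚ
  unit k = trans (cong (c * k ^- (2 *ⁿ t) *_) (ι-* (4 *ⁿ 4 ^ t) (k ^ (2 *ⁿ t))))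
    (trans (regroup c (k ^- (2 *ⁿ t)) (ι (4 *ⁿ 4 ^ t)) (ι (k ^ (2 *ⁿ t))))
      (trans (cong₂ _*_ (recip-inverse (0<⇒≢0 0<4^t)) (^--inverse k (2 *ⁿ t))) (ℚ.*-identityˡ 1ℚ)))
    where
    regroup : ∀ a b c d → a * b * (c * d) ≡ a * c * (b * d)
    regroup = solve-∀ ℚ-ring
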